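{- Let $p>3$ be a prime. Define the Delannoy numbers $D_n=\sum_{k=0}^n\binom{n}{k}\binom{n+k}{k}$ and the Schröder numbers $S_n=\sum_{k=0}^n\binom{n}{k}\binom{n+k}{k}\frac{1}{k+1}$. Then $$\sum_{k=1}^{p-1}D_kS_k\equiv 2p^3B_{p-3}-2pH^{*}_{p-1}\pmod{p^4},$$ where $H^{*}_n=\sum_{k=1}^{n}\frac{(-1)^k}{k}$.
   Context: $B_n$ denotes the $n$-th Bernoulli number, defined by $\frac{x}{e^x-1}=\sum_{n\ge0}B_n\frac{x^n}{n!}$. For rational numbers $a,b$, $a\equiv b\pmod{p^r}$ means $a-b=p^rc$ for some rational $c$ whose denominator is not divisible by $p$. -}

module Defs where

open import Data.Nat as ℕ using (ℕ; zero; suc)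
open import Data.Nat.Combinatorics using (_C_)
open import Data.Nat.Divisibility using (_∣_)
open import Data.Integer as ℤ using (ℤ; +_)
open import Data.Rational as ℚ using (ℚ; _+_; _*_; _-_; -_; _/_; 0ℚ; 1ℚ)
open import Data.List as L using (List; []; _∷_)
open import Data.Product using (Σ; _×_)
open import Relation.Binary.PropositionalEquality using (_≡_)
open import Relation.Nullary using (¬_)

ℕtoℚ : ℕ → ℚ
ℕtoℚ n = (+ n) / 1

-- Σ_{k=a}^{b} f k  (empty, i.e. 0, if b < a)
sumFromTo : ℕ → ℕ → (ℕ → ℚ) → ℚ
sumFromTo a b f = go a (suc b ℕ.∸ a)
  where
  go : ℕ → ℕ → ℚ
  go i zero    = 0ℚ
  go i (suc m) = f i + go (suc i) m

-- Bernoulli numbers B_0, B_1, ... with x/(e^x-1) = Σ B_n x^n/n!  (so B_1 = -1/2).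
-- Comparing coefficients of x^n in x = (e^x - 1) Σ B_n x^n/n! gives
-- B_0 = 1 and Σ_{k=0}^{n} C(n+1,k) B_k = 0 for n ≥ 1, i.e.
-- B_n = -(1/(n+1)) Σ_{k=0}^{n-1} C(n+1,k) B_k.
-- bernoulliList n = [B_0, ..., B_{n}] (with the list built structurally).
private
  nth : List ℚ → ℕ → ℚ
  nth []       _       = 0ℚ
  nth (x ∷ xs) zero    = x
  nth (x ∷ xs) (suc k) = nth xs k

bernoulliList : ℕ → List ℚ
bernoulliList zero    = 1ℚ ∷ []
bernoulliList (suc n) = prev L.++ (Bn ∷ [])
  where
  prev : List ℚ
  prev = bernoulliList n
  Bn : ℚ
  Bn = - ((+ 1 / suc (suc n)) * sumFromTo 0 n (λ k → ℕtoℚ ((suc (suc n)) C k) * nth prev k))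

bernoulli : ℕ → ℚ
bernoulli n = nth (bernoulliList n) n

binomℚ : ℕ → ℕ → ℚ
binomℚ n k = ℕtoℚ (n C k)

delannoy : ℕ → ℚ
delannoy n = sumFromTo 0 n (λ k → binomℚ n k * binomℚ (n ℕ.+ k) k)

schroeder : ℕ → ℚ
schroeder n = sumFromTo 0 n (λ k → binomℚ n k * binomℚ (n ℕ.+ k) k * (+ 1 / suc k))

altHarmonic : ℕ → ℚ
altHarmonic n = sumFromTo 1 n (λ k → sign k * ((+ 1) / suc (k ℕ.∸ 1)))
  where
  sign : ℕ → ℚ
  sign zero          = 1ℚ
  sign (suc zero)    = - 1ℚ
  sign (suc (suc k)) = sign k

_≡_[modℚ_^_] : ℚ → ℚ → ℕ → ℕ → Set
a ≡ b [modℚ p ^ r ] = Σ ℚ (λ c → (a - b ≡ ℕtoℚ (p ℕ.^ r) * c) × ¬ (p ∣ ℚ.denominatorℕ c))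

-- With d(n,k) = C(n,k) C(n+k,k) and D_n(x) = Σ_k d(n,k) x^k we have D_n = D_n(1) and S_n = ∫₀¹ D_n.
-- The recurrence D_{n+1} + D_{n-1} = 2(2x+1) D_n - 2 ∫₀ˣ D_n makes the sum telescope:
--   Σ_{n<N} D_n S_n = ½ ∫₀¹ (D_{N-1} D_N′ - D_{N-1}′ D_N) dx.
-- Put g_k = (1/k) Π_{0<i<k} (N²/i² - 1).  The half sum and half difference of D_N and D_{N-1} have
-- coefficients N² g_k / k and N g_k (and constant terms 1 and 0), so the right-hand side is
--   (1 + N² Σ g_k / k) (N Σ g_k) - 2N³ ΣΣ g_j g_k / (j+k),    1 ≤ j, k ≤ N.
-- For N = p the terms of index p are split off, and the others are expanded p-adically with
-- g_k ≡ -(-1)^k / k (1 - p² Σ_{i<k} 1/i²).  In the double sum, k ↦ p-k leaves a diagonal and, modulo p,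
-- an antisymmetric part, which vanishes.  With R = Σ 1/k² and E = Σ (-1)^k / k³ over 0 < k < p this gives
--   Σ_{n<p} D_n S_n ≡ 1 - 2p H* - 3p² R - 8p³ E  (mod p⁴).
-- Comparing the sums over all k, over even k and over k < p/2 of a function F with
-- F(p-k) ≡ F(k) - p G(k) expresses Σ F by Σ (-1)^k G(k): for F = k⁻² it yields 3R ≡ -4pE, and for
-- F = k^{p-3}, by Fermat, Σ k^{p-3} ≡ -2pE (mod p²).  The last sum is ≡ p B_{p-3} (mod p²).

module Submission where

open import Defs
open import Level using (0ℓ)
open import Data.Nat as ℕ using (ℕ; zero; suc; _<_; _≤_; _>_; _∸_; _^_; s≤s; z≤n)
open import Data.Nat.Primality using (Prime; euclidsLemma; prime⇒irreducible; prime⇒nonTrivial)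
open import Data.Rational using (ℚ; mkℚ; _+_; _*_; _-_; -_; _/_; 0ℚ; 1ℚ; toℚᵘ; ↥_; ↧ₙ_)
open import Data.Integer.Base as ℤ using (ℤ)
open import Data.List.Base as List using (List; []; _∷_)
open import Data.Nat.Combinatorics using (_C_; nCk+nC[k+1]≡[n+1]C[k+1]; nCn≡1; k>n⇒nCk≡0; nCk≡nC[n∸k])
open import Data.Nat.Divisibility using (_∣_; _∣0; divides; ∣⇒≤; ∣m+n∣m⇒∣n; ∣-refl; ∣-reflexive)
open import Data.Product using (∃; _,_)
open import Data.Sum using (_⊎_; inj₁; inj₂; [_,_]′)
open import Relation.Binary.Bundles using (Setoid)
open import Relation.Binary.Definitions using (tri<; tri≈; tri>)
open import Relation.Binary.PropositionalEquality
  using (_≡_; refl; sym; trans; cong; cong₂; subst; module ≡-Reasoning)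
open import Relation.Nullary using (¬_; contradiction)
open import Relation.Nullary.Decidable.Core using (dec⇒maybe)
open import Tactic.RingSolver using (solve-∀)
open import Tactic.RingSolver.Core.AlmostCommutativeRing using (AlmostCommutativeRing; fromCommutativeRing)
import Data.Integer.Divisibility.Signed as Signed
import Data.Integer.Properties as ℤ
import Data.List.Properties as List
import Data.Nat.Coprimality as Coprime
import Data.Nat.Properties as ℕ
import Data.Rational.Properties as ℚ
import Data.Rational.Unnormalised as ℚᵘ
import Data.Rational.Unnormalised.Properties as ℚᵘ
import Relation.Binary.Reasoning.Setoid as ≈-Reasoning

-- The telescoping rests on the antisymmetry of `ω f h = ∫₀¹ (f h′ - f′ h)`: consecutive values
-- differ by `ω D_n (D_{n+1} + D_{n-1})`, which the recurrence turns into
-- `ω D_n (4x D_n - 2 ∫ D_n)`, and integration by parts gives `2 D_n(1) ∫₀¹ D_n`. The half sum `a`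
-- and half difference `b` are linked by `x a′ = N b`. As `(k - j)/(j + k) = 1 - 2j/(j + k)`, this
-- removes `a` from the double sum, which becomes symmetric in `b` with `N³` in front. The obstacle
-- is the denominators divisible by `p`: index `p` brings `1/p` and `1/(2p)`, and the pairs with
-- `j + k = p` bring another `1/p`. The algebra therefore stays exact until all of them have been
-- paired with factors `p`; each remaining sum is then needed only to the precision that its power
-- of `p` leaves. In the comparison of sums, `F` is an even power of `k` and `G` its derivative, so
-- `F(p - k) = F(k - p) ≡ F(k) - p G(k)`. With `F(2k) = c F(k)` the comparison determines
-- `(1 - c) Σ F`. Both choices of `F` have `c ≡ 1/4` modulo `p`, so 3 has to be invertible. They
-- agree modulo `p` only, hence each needs its own argument modulo `p²`.

ℚ-ring : AlmostCommutativeRing 0ℓ 0ℓ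
ℚ-ring = fromCommutativeRing ℚ.+-*-commutativeRing λ x → dec⇒maybe (0ℚ ℚ.≟ x)

2ℚ 4ℚ : ℚ
2ℚ = 1ℚ + 1ℚ
4ℚ = 2ℚ + 2ℚ

sq cube : ℚ → ℚ
sq x   = x * x
cube x = x * (x * x)

-- Naturals and their reciprocals as rationals

abstract
  -- Outside the abstract block `ι n` and `rec n` do not unfold to normalised fractions. All later
  -- reasoning goes through the equations given here; `ι≡ℕtoℚ` and `rec-suc` lead back to the
  -- original notation.
  ι : ℕ → ℚ
  ι = ℕtoℚ

  ι≡ℕtoℚ : ∀ n → ι n ≡ ℕtoℚ n
  ι≡ℕtoℚ n = refl

  ι-0 : ι 0 ≡ 0ℚ
  ι-0 = refl

  ι-1 : ι 1 ≡ 1ℚ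
  ι-1 = refl

  ι-+ : ∀ m n → ι (m ℕ.+ n) ≡ ι m + ι n
  ι-+ m n = ℚ.toℚᵘ-injective (begin
    toℚᵘ (ℕtoℚ (m ℕ.+ n))                    ≈⟨ ℚ.toℚᵘ-fromℚᵘ (ℚᵘ.mkℚᵘ (ℤ.+ (m ℕ.+ n)) 0) ⟩
    ℚᵘ.mkℚᵘ (ℤ.+ (m ℕ.+ n)) 0
      ≈⟨ ℚᵘ.*≡* (cong (ℤ._* (ℤ.+ 1)) (sym (cong₂ ℤ._+_ (ℤ.*-identityʳ (ℤ.+ m)) (ℤ.*-identityʳ (ℤ.+ n))))) ⟩
    ℚᵘ.mkℚᵘ (ℤ.+ m) 0 ℚᵘ.+ ℚᵘ.mkℚᵘ (ℤ.+ n) 0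
      ≈⟨ ℚᵘ.+-cong (ℚ.toℚᵘ-fromℚᵘ (ℚᵘ.mkℚᵘ (ℤ.+ m) 0)) (ℚ.toℚᵘ-fromℚᵘ (ℚᵘ.mkℚᵘ (ℤ.+ n) 0)) ⟨
    toℚᵘ (ℕtoℚ m) ℚᵘ.+ toℚᵘ (ℕtoℚ n)         ≈⟨ ℚ.toℚᵘ-homo-+ (ℕtoℚ m) (ℕtoℚ n) ⟨
    toℚᵘ (ℕtoℚ m + ℕtoℚ n)                   ∎)
    where open import Relation.Binary.Reasoning.Setoid ℚᵘ.≃-setoid

  ι-* : ∀ m n → ι (m ℕ.* n) ≡ ι m * ι n
  ι-* m n = ℚ.toℚᵘ-injective (begin
    toℚᵘ (ℕtoℚ (m ℕ.* n))                    ≈⟨ ℚ.toℚᵘ-fromℚᵘ (ℚᵘ.mkℚᵘ (ℤ.+ (m ℕ.* n)) 0) ⟩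
    ℚᵘ.mkℚᵘ (ℤ.+ (m ℕ.* n)) 0                  ≈⟨ ℚᵘ.*≡* (cong (ℤ._* (ℤ.+ 1)) (ℤ.pos-* m n)) ⟩
    ℚᵘ.mkℚᵘ (ℤ.+ m) 0 ℚᵘ.* ℚᵘ.mkℚᵘ (ℤ.+ n) 0
      ≈⟨ ℚᵘ.*-cong (ℚ.toℚᵘ-fromℚᵘ (ℚᵘ.mkℚᵘ (ℤ.+ m) 0)) (ℚ.toℚᵘ-fromℚᵘ (ℚᵘ.mkℚᵘ (ℤ.+ n) 0)) ⟨
    toℚᵘ (ℕtoℚ m) ℚᵘ.* toℚᵘ (ℕtoℚ n)         ≈⟨ ℚ.toℚᵘ-homo-* (ℕtoℚ m) (ℕtoℚ n) ⟨
    toℚᵘ (ℕtoℚ m * ℕtoℚ n)                   ∎)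
    where open import Relation.Binary.Reasoning.Setoid ℚᵘ.≃-setoid

  -- rec 0 = 0, so that rec is total and antisymmetric kernels need no case distinction.
  rec : ℕ → ℚ
  rec zero    = 0ℚ
  rec (suc n) = ℤ.+ 1 / suc n

  rec-0 : rec 0 ≡ 0ℚ
  rec-0 = refl

  rec-suc : ∀ n → rec (suc n) ≡ ℤ.+ 1 / suc n
  rec-suc n = refl

  ι*rec : ∀ n → ι (suc n) * rec (suc n) ≡ 1ℚ
  ι*rec n = ℚ.toℚᵘ-injective (begin
    toℚᵘ (ι (suc n) * rec (suc n))           ≈⟨ ℚ.toℚᵘ-homo-* (ι (suc n)) (rec (suc n)) ⟩
    toℚᵘ (ι (suc n)) ℚᵘ.* toℚᵘ (rec (suc n))
      ≈⟨ ℚᵘ.*-cong (ℚ.toℚᵘ-fromℚᵘ (ℚᵘ.mkℚᵘ (ℤ.+ suc n) 0)) (ℚ.toℚᵘ-fromℚᵘ (ℚᵘ.mkℚᵘ (ℤ.+ 1) n)) ⟩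
    ℚᵘ.mkℚᵘ (ℤ.+ suc n) 0 ℚᵘ.* ℚᵘ.mkℚᵘ (ℤ.+ 1) n
      ≈⟨ ℚᵘ.*≡* (cong (λ z → ℤ.+ suc z) (trans (ℕ.*-identityʳ _) (trans (ℕ.*-identityʳ n) (sym (trans (ℕ.+-identityʳ _) (ℕ.+-identityʳ n)))))) ⟩
    toℚᵘ 1ℚ                                  ∎)
    where open import Relation.Binary.Reasoning.Setoid ℚᵘ.≃-setoid

ι-suc : ∀ n → ι (suc n) ≡ ι n + 1ℚ
ι-suc n = trans (cong ι (ℕ.+-comm 1 n)) (trans (ι-+ n 1) (cong (ι n +_) ι-1))

ι*rec⁺ : ∀ {n} → 0 < n → ι n * rec n ≡ 1ℚ
ι*rec⁺ {suc n} _ = ι*rec n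

ι-∸ : ∀ {m n} → n ≤ m → ι (m ∸ n) ≡ ι m - ι n
ι-∸ {m} {n} n≤m = begin
  ι (m ∸ n)             ≡⟨ lem (ι (m ∸ n)) (ι n) ⟩
  (ι (m ∸ n) + ι n) - ι n ≡⟨ cong (_- ι n) (sym (ι-+ (m ∸ n) n)) ⟩
  ι (m ∸ n ℕ.+ n) - ι n ≡⟨ cong (λ z → ι z - ι n) (ℕ.m∸n+n≡m n≤m) ⟩
  ι m - ι n             ∎
  where
  open ≡-Reasoning
  lem : ∀ x y → x ≡ (x + y) - y
  lem = solve-∀ ℚ-ring

ι-cancel : ∀ {n} → 0 < n → ∀ {x y} → ι n * x ≡ ι n * y → x ≡ y
ι-cancel {n} 0<n {x} {y} eq = trans (sym (lem x)) (trans (cong (rec n *_) eq) (lem y))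
  where
  lem′ : ∀ r i z → r * (i * z) ≡ (i * r) * z
  lem′ = solve-∀ ℚ-ring
  lem : ∀ z → rec n * (ι n * z) ≡ z
  lem z = trans (lem′ (rec n) (ι n) z) (trans (cong (_* z) (ι*rec⁺ 0<n)) (ℚ.*-identityˡ z))

rec-unique : ∀ {n} → 0 < n → ∀ {x} → ι n * x ≡ 1ℚ → rec n ≡ x
rec-unique 0<n eq = ι-cancel 0<n (trans (ι*rec⁺ 0<n) (sym eq))

ι-2 : ι 2 ≡ 2ℚ
ι-2 = trans (ι-suc 1) (cong (_+ 1ℚ) ι-1)

2-cancel : ∀ {x y} → 2ℚ * x ≡ 2ℚ * y → x ≡ y
2-cancel {x} {y} eq = ι-cancel {2} (s≤s z≤n) (trans (cong (_* x) ι-2) (trans eq (cong (_* y) (sym ι-2))))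

-- Finite sums and double sums

∑ : ℕ → (ℕ → ℚ) → ℚ
∑ zero    f = 0ℚ
∑ (suc n) f = ∑ n f + f n

∑-cong : ∀ n {f g : ℕ → ℚ} → (∀ k → k < n → f k ≡ g k) → ∑ n f ≡ ∑ n g
∑-cong zero    eq = refl
∑-cong (suc n) eq = cong₂ _+_ (∑-cong n λ k k<n → eq k (ℕ.m<n⇒m<1+n k<n)) (eq n ℕ.≤-refl)

∑-ext : ∀ n {f g : ℕ → ℚ} → (∀ k → f k ≡ g k) → ∑ n f ≡ ∑ n g
∑-ext n eq = ∑-cong n λ k _ → eq k

∑-+ : ∀ n (f g : ℕ → ℚ) → ∑ n (λ k → f k + g k) ≡ ∑ n f + ∑ n g
∑-+ zero    f g = refl
∑-+ (suc n) f g = trans (cong (_+ (f n + g n)) (∑-+ n f g)) (lem (∑ n f) (∑ n g) (f n) (g n))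
  where
  lem : ∀ a b c d → (a + b) + (c + d) ≡ (a + c) + (b + d)
  lem = solve-∀ ℚ-ring

∑-*ˡ : ∀ n c (f : ℕ → ℚ) → ∑ n (λ k → c * f k) ≡ c * ∑ n f
∑-*ˡ zero    c f = sym (ℚ.*-zeroʳ c)
∑-*ˡ (suc n) c f = trans (cong (_+ c * f n) (∑-*ˡ n c f)) (sym (ℚ.*-distribˡ-+ c (∑ n f) (f n)))

∑-*ʳ : ∀ n c (f : ℕ → ℚ) → ∑ n (λ k → f k * c) ≡ ∑ n f * c
∑-*ʳ n c f = trans (∑-ext n λ k → ℚ.*-comm (f k) c) (trans (∑-*ˡ n c f) (ℚ.*-comm c (∑ n f)))

∑-0 : ∀ n → ∑ n (λ _ → 0ℚ) ≡ 0ℚ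
∑-0 zero    = refl
∑-0 (suc n) = trans (ℚ.+-identityʳ _) (∑-0 n)

∑-head : ∀ n (f : ℕ → ℚ) → ∑ (suc n) f ≡ f 0 + ∑ n (λ k → f (suc k))
∑-head zero    f = trans (ℚ.+-identityˡ (f 0)) (sym (ℚ.+-identityʳ (f 0)))
∑-head (suc n) f = trans (cong (_+ f (suc n)) (∑-head n f)) (ℚ.+-assoc (f 0) _ (f (suc n)))

∑-split : ∀ m n (f : ℕ → ℚ) → ∑ (n ℕ.+ m) f ≡ ∑ m f + ∑ n (λ k → f (k ℕ.+ m))
∑-split m zero    f = sym (ℚ.+-identityʳ _)
∑-split m (suc n) f = trans (cong (_+ f (n ℕ.+ m)) (∑-split m n f)) (ℚ.+-assoc (∑ m f) _ _)

∑-rev : ∀ n (f : ℕ → ℚ) → ∑ n f ≡ ∑ n (λ k → f (n ∸ suc k))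
∑-rev zero    f = refl
∑-rev (suc n) f = begin
  ∑ n f + f n                          ≡⟨ ℚ.+-comm (∑ n f) (f n) ⟩
  f n + ∑ n f                          ≡⟨ cong (f n +_) (∑-rev n f) ⟩
  f n + ∑ n (λ k → f (n ∸ suc k))      ≡⟨ sym (∑-head n (λ k → f (n ∸ k))) ⟩
  ∑ (suc n) (λ k → f (n ∸ k))          ∎
  where open ≡-Reasoning

∑-swap : ∀ m n (f : ℕ → ℕ → ℚ) → ∑ m (λ i → ∑ n (f i)) ≡ ∑ n (λ j → ∑ m (λ i → f i j))
∑-swap zero    n f = sym (∑-0 n)
∑-swap (suc m) n f = trans (cong (_+ ∑ n (f m)) (∑-swap m n f)) (sym (∑-+ n _ (f m)))

∑-extend : ∀ {m} n (f : ℕ → ℚ) → m ≤ n → (∀ k → m ≤ k → f k ≡ 0ℚ) → ∑ n f ≡ ∑ m f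
∑-extend {m} n f m≤n f≡0 = begin
  ∑ n f                                          ≡⟨ cong (λ z → ∑ z f) (sym (ℕ.m∸n+n≡m m≤n)) ⟩
  ∑ (n ∸ m ℕ.+ m) f                              ≡⟨ ∑-split m (n ∸ m) f ⟩
  ∑ m f + ∑ (n ∸ m) (λ k → f (k ℕ.+ m))
    ≡⟨ cong (∑ m f +_) (trans (∑-ext (n ∸ m) λ k → f≡0 (k ℕ.+ m) (ℕ.m≤n+m m k)) (∑-0 (n ∸ m))) ⟩
  ∑ m f + 0ℚ                                     ≡⟨ ℚ.+-identityʳ (∑ m f) ⟩
  ∑ m f                                          ∎
  where open ≡-Reasoning

∑₁ : ℕ → (ℕ → ℚ) → ℚ
∑₁ n f = ∑ n (λ k → f (suc k))

∑₁-ext : ∀ n {f g : ℕ → ℚ} → (∀ k → f k ≡ g k) → ∑₁ n f ≡ ∑₁ n g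
∑₁-ext n eq = ∑-ext n λ k → eq (suc k)

∑∑ : ℕ → (ℕ → ℕ → ℚ) → ℚ
∑∑ n f = ∑ n λ i → ∑ n (f i)

∑∑-cong : ∀ n {f g : ℕ → ℕ → ℚ} → (∀ i j → i < n → j < n → f i j ≡ g i j) → ∑∑ n f ≡ ∑∑ n g
∑∑-cong n eq = ∑-cong n λ i i<n → ∑-cong n λ j j<n → eq i j i<n j<n

∑∑-ext : ∀ n {f g : ℕ → ℕ → ℚ} → (∀ i j → f i j ≡ g i j) → ∑∑ n f ≡ ∑∑ n g
∑∑-ext n eq = ∑∑-cong n λ i j _ _ → eq i j

∑∑-+ : ∀ n (f g : ℕ → ℕ → ℚ) → ∑∑ n (λ i j → f i j + g i j) ≡ ∑∑ n f + ∑∑ n g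
∑∑-+ n f g = trans (∑-ext n λ i → ∑-+ n (f i) (g i)) (∑-+ n _ _)

∑∑-*ˡ : ∀ n c (f : ℕ → ℕ → ℚ) → ∑∑ n (λ i j → c * f i j) ≡ c * ∑∑ n f
∑∑-*ˡ n c f = trans (∑-ext n λ i → ∑-*ˡ n c (f i)) (∑-*ˡ n c _)

∑∑-* : ∀ n (f g : ℕ → ℚ) → ∑∑ n (λ i j → f i * g j) ≡ ∑ n f * ∑ n g
∑∑-* n f g = trans (∑-ext n λ i → ∑-*ˡ n (f i) g) (∑-*ʳ n (∑ n g) f)

∑∑-swap : ∀ n (f : ℕ → ℕ → ℚ) → ∑∑ n f ≡ ∑∑ n (λ i j → f j i)
∑∑-swap n f = ∑-swap n n f

x+x≡0⇒x≡0 : ∀ {x} → x + x ≡ 0ℚ → x ≡ 0ℚ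
x+x≡0⇒x≡0 {x} eq = 2-cancel (trans (lem x) (trans eq (sym (ℚ.*-zeroʳ 2ℚ))))
  where
  lem : ∀ x → 2ℚ * x ≡ x + x
  lem = solve-∀ ℚ-ring

∑∑-antisym : ∀ n (f : ℕ → ℕ → ℚ) → (∀ i j → f i j + f j i ≡ 0ℚ) → ∑∑ n f ≡ 0ℚ
∑∑-antisym n f anti = x+x≡0⇒x≡0 (begin
  ∑∑ n f + ∑∑ n f                 ≡⟨ cong (λ z → ∑∑ n f + z) (∑∑-swap n f) ⟩
  ∑∑ n f + ∑∑ n (λ i j → f j i)   ≡⟨ sym (∑∑-+ n f _) ⟩
  ∑∑ n (λ i j → f i j + f j i)    ≡⟨ ∑∑-ext n anti ⟩
  ∑∑ n (λ _ _ → 0ℚ)               ≡⟨ trans (∑-ext n λ _ → ∑-0 n) (∑-0 n) ⟩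
  0ℚ                              ∎)
  where open ≡-Reasoning

suc[n∸suck]≡n∸k : ∀ {n k} → k < n → suc (n ∸ suc k) ≡ n ∸ k
suc[n∸suck]≡n∸k {n} {k} k<n = sym (ℕ.+-∸-assoc 1 k<n)

∑₁-rev : ∀ n (f : ℕ → ℚ) → ∑₁ n f ≡ ∑₁ n (λ k → f (suc n ∸ k))
∑₁-rev n f = trans (∑-rev n _) (∑-cong n λ k k<n → cong f (suc[n∸suck]≡n∸k k<n))

-- The map `k ↦ 2h + 1 - k` exchanges the two halves of `1, …, 2h`. For `p = 2h + 1` it is
-- `k ↦ p - k`.
∑₁-halves : ∀ h (f : ℕ → ℚ) → ∑₁ (h ℕ.+ h) f ≡ ∑₁ h f + ∑₁ h (λ k → f (suc (h ℕ.+ h) ∸ k))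
∑₁-halves h f = trans (∑-split h h _) (cong (∑₁ h f +_) (trans (∑-rev h _) (∑-cong h λ k k<h → cong f
  (trans (cong suc (sym (ℕ.+-∸-comm h k<h))) (suc[n∸suck]≡n∸k (ℕ.<-≤-trans k<h (ℕ.m≤m+n h h)))))))

rec-double : ∀ k → rec (k ℕ.+ k) ≡ rec 2 * rec k
rec-double zero    = trans rec-0 (sym (trans (cong (rec 2 *_) rec-0) (ℚ.*-zeroʳ (rec 2))))
rec-double (suc k) = rec-unique (s≤s z≤n) (begin
  ι (suc k ℕ.+ suc k) * (rec 2 * rec (suc k))    ≡⟨ cong (_* (rec 2 * rec (suc k))) (ι-+ (suc k) (suc k)) ⟩
  (ι (suc k) + ι (suc k)) * (rec 2 * rec (suc k)) ≡⟨ lem (ι (suc k)) (rec 2) (rec (suc k)) ⟩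
  (2ℚ * rec 2) * (ι (suc k) * rec (suc k))       ≡⟨ cong₂ _*_ (trans (cong (_* rec 2) (sym ι-2)) (ι*rec 1)) (ι*rec k) ⟩
  1ℚ                                             ∎)
  where
  open ≡-Reasoning
  lem : ∀ i r s → (i + i) * (r * s) ≡ (2ℚ * r) * (i * s)
  lem = solve-∀ ℚ-ring

2*rec2 : 2ℚ * rec 2 ≡ 1ℚ
2*rec2 = trans (cong (_* rec 2) (sym ι-2)) (ι*rec 1)

ι-3 : ι 3 ≡ 2ℚ + 1ℚ
ι-3 = trans (ι-suc 2) (cong (_+ 1ℚ) ι-2)

-- The exact identity

module _ where
  open ≡-Reasoning

  -- Each step of `D` divides by `(k+1)²`. Multiplying by that square first leaves polynomial
  -- identities for the ring solver.
  sq-cancel : ∀ k {x y} → x * sq (ι (suc k)) ≡ y * sq (ι (suc k)) → x ≡ y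
  sq-cancel k {x} {y} eq = ι-cancel {suc k} (s≤s z≤n) (ι-cancel {suc k} (s≤s z≤n)
    (trans (lem (ι (suc k)) x) (trans eq (sym (lem (ι (suc k)) y)))))
    where
    lem : ∀ i z → i * (i * z) ≡ z * (i * i)
    lem = solve-∀ ℚ-ring

  -- D (ι n) k = C(n,k) C(n+k,k)
  D : ℚ → ℕ → ℚ
  D x zero    = 1ℚ
  D x (suc k) = D x k * ((x - ι k) * (x + ι k + 1ℚ)) * sq (rec (suc k))

  D-step : ∀ x k → D x (suc k) * sq (ι (suc k)) ≡ D x k * ((x - ι k) * (x + ι k + 1ℚ))
  D-step x k = begin
    y * sq r * sq i        ≡⟨ lem y r i ⟩
    y * sq (i * r)         ≡⟨ cong (λ z → y * sq z) (ι*rec k) ⟩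
    y * 1ℚ                 ≡⟨ ℚ.*-identityʳ y ⟩
    y                      ∎
    where
    y r i : ℚ
    y = D x k * ((x - ι k) * (x + ι k + 1ℚ))
    r = rec (suc k)
    i = ι (suc k)
    lem : ∀ y r i → y * (r * r) * (i * i) ≡ y * ((i * r) * (i * r))
    lem = solve-∀ ℚ-ring

  -- Both products in `D` shift by one place; the factor `x + 1` gained by one is lost by the other,
  -- and no division by `x + 1` remains. With `D-step` and `D-pred` this puts the coefficients of
  -- index `k + 1` of three consecutive polynomials over the common factor `D x k`.
  D-suc : ∀ x k → D (x + 1ℚ) (suc k) * sq (ι (suc k)) ≡ D x k * ((x + ι k + 1ℚ) * (x + ι k + 2ℚ))
  D-suc x zero = trans (D-step (x + 1ℚ) 0) (cong (1ℚ *_) (trans (cong (λ z → (x + 1ℚ - z) * (x + 1ℚ + z + 1ℚ)) ι-0)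
    (trans (lem x) (cong (λ z → (x + z + 1ℚ) * (x + z + 2ℚ)) (sym ι-0)))))
    where
    lem : ∀ x → (x + 1ℚ - 0ℚ) * (x + 1ℚ + 0ℚ + 1ℚ) ≡ (x + 0ℚ + 1ℚ) * (x + 0ℚ + 2ℚ)
    lem = solve-∀ ℚ-ring
  D-suc x (suc k) = trans (D-step (x + 1ℚ) (suc k)) (sq-cancel k (begin
    D (x + 1ℚ) (suc k) * ((x + 1ℚ - i) * (x + 1ℚ + i + 1ℚ)) * sq i
      ≡⟨ lem₁ (D (x + 1ℚ) (suc k)) ((x + 1ℚ - i) * (x + 1ℚ + i + 1ℚ)) (sq i) ⟩
    D (x + 1ℚ) (suc k) * sq i * ((x + 1ℚ - i) * (x + 1ℚ + i + 1ℚ))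
      ≡⟨ cong₂ _*_ (D-suc x k) (cong (λ z → (x + 1ℚ - z) * (x + 1ℚ + z + 1ℚ)) (ι-suc k)) ⟩
    D x k * ((x + κ + 1ℚ) * (x + κ + 2ℚ)) * ((x + 1ℚ - (κ + 1ℚ)) * (x + 1ℚ + (κ + 1ℚ) + 1ℚ))
      ≡⟨ lem₂ (D x k) x κ ⟩
    D x k * ((x - κ) * (x + κ + 1ℚ)) * ((x + (κ + 1ℚ) + 1ℚ) * (x + (κ + 1ℚ) + 2ℚ))
      ≡⟨ cong₂ _*_ (sym (D-step x k)) (cong (λ z → (x + z + 1ℚ) * (x + z + 2ℚ)) (sym (ι-suc k))) ⟩
    D x (suc k) * sq i * ((x + i + 1ℚ) * (x + i + 2ℚ))
      ≡⟨ lem₁ (D x (suc k)) (sq i) ((x + i + 1ℚ) * (x + i + 2ℚ)) ⟩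
    D x (suc k) * ((x + i + 1ℚ) * (x + i + 2ℚ)) * sq i ∎))
    where
    i κ : ℚ
    i = ι (suc k)
    κ = ι k
    lem₁ : ∀ a b c → a * b * c ≡ a * c * b
    lem₁ = solve-∀ ℚ-ring
    lem₂ : ∀ d x κ → d * ((x + κ + 1ℚ) * (x + κ + 2ℚ)) * ((x + 1ℚ - (κ + 1ℚ)) * (x + 1ℚ + (κ + 1ℚ) + 1ℚ))
                   ≡ d * ((x - κ) * (x + κ + 1ℚ)) * ((x + (κ + 1ℚ) + 1ℚ) * (x + (κ + 1ℚ) + 2ℚ))
    lem₂ = solve-∀ ℚ-ring

  -- This is `D-suc` under `x ↦ -1 - x`, a substitution that fixes `D`.
  D-pred : ∀ x k → D (x - 1ℚ) (suc k) * sq (ι (suc k)) ≡ D x k * ((x - ι k - 1ℚ) * (x - ι k))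
  D-pred x zero = trans (D-step (x - 1ℚ) 0) (cong (1ℚ *_) (trans (cong (λ z → (x - 1ℚ - z) * (x - 1ℚ + z + 1ℚ)) ι-0)
    (trans (lem x) (cong (λ z → (x - z - 1ℚ) * (x - z)) (sym ι-0)))))
    where
    lem : ∀ x → (x - 1ℚ - 0ℚ) * (x - 1ℚ + 0ℚ + 1ℚ) ≡ (x - 0ℚ - 1ℚ) * (x - 0ℚ)
    lem = solve-∀ ℚ-ring
  D-pred x (suc k) = trans (D-step (x - 1ℚ) (suc k)) (sq-cancel k (begin
    D (x - 1ℚ) (suc k) * ((x - 1ℚ - i) * (x - 1ℚ + i + 1ℚ)) * sq i
      ≡⟨ lem₁ (D (x - 1ℚ) (suc k)) ((x - 1ℚ - i) * (x - 1ℚ + i + 1ℚ)) (sq i) ⟩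
    D (x - 1ℚ) (suc k) * sq i * ((x - 1ℚ - i) * (x - 1ℚ + i + 1ℚ))
      ≡⟨ cong₂ _*_ (D-pred x k) (cong (λ z → (x - 1ℚ - z) * (x - 1ℚ + z + 1ℚ)) (ι-suc k)) ⟩
    D x k * ((x - κ - 1ℚ) * (x - κ)) * ((x - 1ℚ - (κ + 1ℚ)) * (x - 1ℚ + (κ + 1ℚ) + 1ℚ))
      ≡⟨ lem₂ (D x k) x κ ⟩
    D x k * ((x - κ) * (x + κ + 1ℚ)) * ((x - (κ + 1ℚ) - 1ℚ) * (x - (κ + 1ℚ)))
      ≡⟨ cong₂ _*_ (sym (D-step x k)) (cong (λ z → (x - z - 1ℚ) * (x - z)) (sym (ι-suc k))) ⟩
    D x (suc k) * sq i * ((x - i - 1ℚ) * (x - i))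
      ≡⟨ lem₁ (D x (suc k)) (sq i) ((x - i - 1ℚ) * (x - i)) ⟩
    D x (suc k) * ((x - i - 1ℚ) * (x - i)) * sq i ∎))
    where
    i κ : ℚ
    i = ι (suc k)
    κ = ι k
    lem₁ : ∀ a b c → a * b * c ≡ a * c * b
    lem₁ = solve-∀ ℚ-ring
    lem₂ : ∀ d x κ → d * ((x - κ - 1ℚ) * (x - κ)) * ((x - 1ℚ - (κ + 1ℚ)) * (x - 1ℚ + (κ + 1ℚ) + 1ℚ))
                   ≡ d * ((x - κ) * (x + κ + 1ℚ)) * ((x - (κ + 1ℚ) - 1ℚ) * (x - (κ + 1ℚ)))
    lem₂ = solve-∀ ℚ-ring

  -- The generating polynomials satisfy D_{n+1} + D_{n-1} = 2(2x+1) D_n - 2 ∫ D_n.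
  D-recurrence : ∀ x k → D (x + 1ℚ) (suc k) + D (x - 1ℚ) (suc k) ≡ 2ℚ * D x (suc k) + (4ℚ - 2ℚ * rec (suc k)) * D x k
  D-recurrence x k = sq-cancel k (begin
    (D (x + 1ℚ) (suc k) + D (x - 1ℚ) (suc k)) * sq i
      ≡⟨ ℚ.*-distribʳ-+ (sq i) (D (x + 1ℚ) (suc k)) (D (x - 1ℚ) (suc k)) ⟩
    D (x + 1ℚ) (suc k) * sq i + D (x - 1ℚ) (suc k) * sq i
      ≡⟨ cong₂ _+_ (D-suc x k) (D-pred x k) ⟩
    d * ((x + κ + 1ℚ) * (x + κ + 2ℚ)) + d * ((x - κ - 1ℚ) * (x - κ))
      ≡⟨ lem₁ d x κ ⟩
    -- The factors `κ + 1ℚ` and `1ℚ` are displayed because they are about to become `i` and `i * r`.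
    -- Reading `1ℚ` backwards as `i * r` is how reciprocals enter an identity that the ring solver
    -- can check.
    2ℚ * (d * ((x - κ) * (x + κ + 1ℚ))) + (4ℚ * (κ + 1ℚ) - 2ℚ * 1ℚ) * (κ + 1ℚ) * d
      ≡⟨ cong₂ (λ y z → 2ℚ * y + z) (sym (D-step x k)) (cong₂ (λ y z → (4ℚ * y - 2ℚ * z) * y * d) (sym (ι-suc k)) (sym (ι*rec k))) ⟩
    2ℚ * (D x (suc k) * sq i) + (4ℚ * i - 2ℚ * (i * r)) * i * d
      ≡⟨ lem₂ d (D x (suc k)) i r ⟩
    (2ℚ * D x (suc k) + (4ℚ - 2ℚ * r) * D x k) * sq i ∎)
    where
    i κ d r : ℚ
    i = ι (suc k)
    κ = ι k
    d = D x k
    r = rec (suc k)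
    lem₁ : ∀ d x κ → d * ((x + κ + 1ℚ) * (x + κ + 2ℚ)) + d * ((x - κ - 1ℚ) * (x - κ))
      ≡ 2ℚ * (d * ((x - κ) * (x + κ + 1ℚ))) + (4ℚ * (κ + 1ℚ) - 2ℚ * 1ℚ) * (κ + 1ℚ) * d
    lem₁ = solve-∀ ℚ-ring
    lem₂ : ∀ d e i r → 2ℚ * (e * (i * i)) + (4ℚ * i - 2ℚ * (i * r)) * i * d
      ≡ (2ℚ * e + (4ℚ - 2ℚ * r) * d) * (i * i)
    lem₂ = solve-∀ ℚ-ring

  D-vanish : ∀ n k → n < k → D (ι n) k ≡ 0ℚ
  D-vanish n (suc k) (s≤s n≤k) with ℕ.m≤n⇒m<n∨m≡n n≤k
  ... | inj₁ n<k = trans (cong (λ z → z * ((ι n - ι k) * (ι n + ι k + 1ℚ)) * sq (rec (suc k))) (D-vanish n k n<k))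
                         (lem ((ι n - ι k) * (ι n + ι k + 1ℚ)) (sq (rec (suc k))))
    where
    lem : ∀ x y → 0ℚ * x * y ≡ 0ℚ
    lem = solve-∀ ℚ-ring
  ... | inj₂ refl = lem (D (ι n) n) (ι n) (ι n + ι n + 1ℚ) (sq (rec (suc n)))
    where
    lem : ∀ d x y z → d * ((x - x) * y) * z ≡ 0ℚ
    lem = solve-∀ ℚ-ring

  -- Half sum and half difference of consecutive polynomials

  u : ℚ → ℕ → ℚ
  u x zero    = 1ℚ
  u x (suc k) = u x k * (sq x * sq (rec (suc k)) - 1ℚ)

  -- At `k = 0` the factor `rec 0` gives 0, in agreement with the missing constant term of the half
  -- difference.
  g : ℚ → ℕ → ℚ
  g x k = rec k * u x (k ∸ 1)

  -- Multiplication by `x - k` completes the linear factors of `D x k` to `x` times the pairs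
  -- `(x - i)(x + i)` with `0 < i ≤ k`.
  D-u : ∀ x k → D x k * (x - ι k) ≡ x * u x k
  D-u x zero = trans (cong (λ z → 1ℚ * (x - z)) ι-0) (lem x)
    where
    lem : ∀ x → 1ℚ * (x - 0ℚ) ≡ x * 1ℚ
    lem = solve-∀ ℚ-ring
  D-u x (suc k) = sq-cancel k (begin
    D x (suc k) * (x - i) * sq i                 ≡⟨ lem₁ (D x (suc k)) (x - i) (sq i) ⟩
    D x (suc k) * sq i * (x - i)                 ≡⟨ cong₂ (λ y z → y * (x - z)) (D-step x k) (ι-suc k) ⟩
    d * ((x - κ) * (x + κ + 1ℚ)) * (x - (κ + 1ℚ)) ≡⟨ lem₂ d x κ ⟩
    d * (x - κ) * (sq x - sq (κ + 1ℚ))           ≡⟨ cong₂ (λ y z → y * (sq x - sq z)) (D-u x k) (sym (ι-suc k)) ⟩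
    x * u x k * (sq x - sq i)                    ≡⟨ lem₃ (x * u x k) (sq x) (sq i) ⟩
    x * u x k * (sq x * sq 1ℚ - sq i)            ≡⟨ cong (λ z → x * u x k * (sq x * sq z - sq i)) (sym (ι*rec k)) ⟩
    x * u x k * (sq x * sq (i * r) - sq i)       ≡⟨ lem₄ x (u x k) i r ⟩
    x * (u x k * (sq x * sq r - 1ℚ)) * sq i      ∎)
    where
    i κ d r : ℚ
    i = ι (suc k)
    κ = ι k
    d = D x k
    r = rec (suc k)
    lem₁ : ∀ a b c → a * b * c ≡ a * c * b
    lem₁ = solve-∀ ℚ-ring
    lem₂ : ∀ d x κ → d * ((x - κ) * (x + κ + 1ℚ)) * (x - (κ + 1ℚ)) ≡ d * (x - κ) * (x * x - (κ + 1ℚ) * (κ + 1ℚ))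
    lem₂ = solve-∀ ℚ-ring
    lem₃ : ∀ a b c → a * (b - c) ≡ a * (b * (1ℚ * 1ℚ) - c)
    lem₃ = solve-∀ ℚ-ring
    lem₄ : ∀ x u i r → x * u * (x * x * ((i * r) * (i * r)) - i * i) ≡ x * (u * (x * x * (r * r) - 1ℚ)) * (i * i)
    lem₄ = solve-∀ ℚ-ring

  -- The half sum and the half difference of D x and D (x - 1).
  half-sum : ℚ → ℕ → ℚ
  half-sum x zero    = 1ℚ
  half-sum x (suc k) = sq x * (rec (suc k) * g x (suc k))

  half-diff : ℚ → ℕ → ℚ
  half-diff x k = x * g x k

  half-diff-0 : ∀ x → half-diff x 0 ≡ 0ℚ
  half-diff-0 x = trans (cong (λ z → x * (z * 1ℚ)) rec-0) (lem x)
    where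
    lem : ∀ x → x * (0ℚ * 1ℚ) ≡ 0ℚ
    lem = solve-∀ ℚ-ring

  -- Once `D-u` has absorbed `x - k`, the factor `x + (k+1)` is left, and for `D (x - 1)` the factor
  -- `x - (k+1)`. The summand `x` produces the half sum, the summand `k+1` the half difference.
  D≡half-sum+half-diff : ∀ x k → D x k ≡ half-sum x k + half-diff x k
  D≡half-sum+half-diff x zero = sym (cong (1ℚ +_) (half-diff-0 x))
  D≡half-sum+half-diff x (suc k) = sq-cancel k (begin
    D x (suc k) * sq i                   ≡⟨ D-step x k ⟩
    d * ((x - κ) * (x + κ + 1ℚ))         ≡⟨ lem₁ d x κ ⟩
    d * (x - κ) * (x + (κ + 1ℚ))         ≡⟨ cong₂ (λ y z → y * (x + z)) (D-u x k) (sym (ι-suc k)) ⟩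
    x * u x k * (x + i)                  ≡⟨ lem₂ x (u x k) i ⟩
    x * u x k * (x * sq 1ℚ + i * 1ℚ)     ≡⟨ cong (λ z → x * u x k * (x * sq z + i * z)) (sym (ι*rec k)) ⟩
    x * u x k * (x * sq (i * r) + i * (i * r)) ≡⟨ lem₃ x (u x k) i r ⟩
    (sq x * (r * (r * u x k)) + x * (r * u x k)) * sq i ∎)
    where
    i κ d r : ℚ
    i = ι (suc k)
    κ = ι k
    d = D x k
    r = rec (suc k)
    lem₁ : ∀ d x κ → d * ((x - κ) * (x + κ + 1ℚ)) ≡ d * (x - κ) * (x + (κ + 1ℚ))
    lem₁ = solve-∀ ℚ-ring
    lem₂ : ∀ x u i → x * u * (x + i) ≡ x * u * (x * (1ℚ * 1ℚ) + i * 1ℚ)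
    lem₂ = solve-∀ ℚ-ring
    lem₃ : ∀ x u i r → x * u * (x * ((i * r) * (i * r)) + i * (i * r)) ≡ (x * x * (r * (r * u)) + x * (r * u)) * (i * i)
    lem₃ = solve-∀ ℚ-ring

  D-1≡half-sum-half-diff : ∀ x k → D (x - 1ℚ) k ≡ half-sum x k - half-diff x k
  D-1≡half-sum-half-diff x zero = sym (trans (cong (λ z → 1ℚ - z) (half-diff-0 x)) refl)
  D-1≡half-sum-half-diff x (suc k) = sq-cancel k (begin
    D (x - 1ℚ) (suc k) * sq i            ≡⟨ D-pred x k ⟩
    d * ((x - κ - 1ℚ) * (x - κ))         ≡⟨ lem₁ d x κ ⟩
    d * (x - κ) * (x - (κ + 1ℚ))         ≡⟨ cong₂ (λ y z → y * (x - z)) (D-u x k) (sym (ι-suc k)) ⟩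
    x * u x k * (x - i)                  ≡⟨ lem₂ x (u x k) i ⟩
    x * u x k * (x * sq 1ℚ - i * 1ℚ)     ≡⟨ cong (λ z → x * u x k * (x * sq z - i * z)) (sym (ι*rec k)) ⟩
    x * u x k * (x * sq (i * r) - i * (i * r)) ≡⟨ lem₃ x (u x k) i r ⟩
    (sq x * (r * (r * u x k)) - x * (r * u x k)) * sq i ∎)
    where
    i κ d r : ℚ
    i = ι (suc k)
    κ = ι k
    d = D x k
    r = rec (suc k)
    lem₁ : ∀ d x κ → d * ((x - κ - 1ℚ) * (x - κ)) ≡ d * (x - κ) * (x - (κ + 1ℚ))
    lem₁ = solve-∀ ℚ-ring
    lem₂ : ∀ x u i → x * u * (x - i) ≡ x * u * (x * (1ℚ * 1ℚ) - i * 1ℚ)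
    lem₂ = solve-∀ ℚ-ring
    lem₃ : ∀ x u i r → x * u * (x * ((i * r) * (i * r)) - i * (i * r)) ≡ (x * x * (r * (r * u)) - x * (r * u)) * (i * i)
    lem₃ = solve-∀ ℚ-ring

  -- In terms of the polynomials `a` and `b` with these coefficients, this is `X a′ = x b`. It
  -- serves to eliminate `a` from the double sum.
  half-sum-ι : ∀ x k → ι k * half-sum x k ≡ x * half-diff x k
  half-sum-ι x zero = trans (cong (_* 1ℚ) ι-0) (trans (lem x) (sym (cong (x *_) (half-diff-0 x))))
    where
    lem : ∀ x → 0ℚ * 1ℚ ≡ x * 0ℚ
    lem = solve-∀ ℚ-ring
  half-sum-ι x (suc k) = trans (lem₁ (ι (suc k)) x (rec (suc k)) (g x (suc k))) (trans (cong (_* (x * (x * g x (suc k)))) (ι*rec k)) (ℚ.*-identityˡ _))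
    where
    lem₁ : ∀ i x r g → i * (x * x * (r * g)) ≡ (i * r) * (x * (x * g))
    lem₁ = solve-∀ ℚ-ring

  -- For polynomials f = Σ f_j x^j and h = Σ h_k x^k, ω f h is ∫₀¹ (f h′ - f′ h) dx.
  θ : ℕ → ℕ → ℚ
  θ j k = (ι k - ι j) * rec (j ℕ.+ k)

  ω : ℕ → (ℕ → ℚ) → (ℕ → ℚ) → ℚ
  ω K f h = ∑∑ K λ j k → f j * h k * θ j k

  θ-antisym : ∀ j k → θ k j ≡ - θ j k
  θ-antisym j k = trans (cong (λ z → (ι j - ι k) * rec z) (ℕ.+-comm k j)) (lem (ι j) (ι k) (rec (j ℕ.+ k)))
    where
    lem : ∀ x y z → (x - y) * z ≡ - ((y - x) * z)
    lem = solve-∀ ℚ-ring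

  ω-ext : ∀ K {f f′ h h′ : ℕ → ℚ} → (∀ k → f k ≡ f′ k) → (∀ k → h k ≡ h′ k) → ω K f h ≡ ω K f′ h′
  ω-ext K eq eq′ = ∑∑-ext K λ j k → cong₂ (λ y z → y * z * θ j k) (eq j) (eq′ k)

  ω-+ : ∀ K f h h′ → ω K f (λ k → h k + h′ k) ≡ ω K f h + ω K f h′
  ω-+ K f h h′ = trans (∑∑-ext K λ j k → lem (f j) (h k) (h′ k) (θ j k)) (∑∑-+ K _ _)
    where
    lem : ∀ a b c d → a * (b + c) * d ≡ a * b * d + a * c * d
    lem = solve-∀ ℚ-ring

  ω-antisym : ∀ K f h → ω K f h + ω K h f ≡ 0ℚ
  ω-antisym K f h = begin
    ω K f h + ω K h f                               ≡⟨ cong (λ z → ω K f h + z) (∑∑-swap K _) ⟩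
    ω K f h + ∑∑ K (λ j k → h k * f j * θ k j)      ≡⟨ sym (∑∑-+ K _ _) ⟩
    ∑∑ K (λ j k → f j * h k * θ j k + h k * f j * θ k j)
      ≡⟨ ∑∑-ext K (λ j k → trans (cong (λ z → f j * h k * θ j k + h k * f j * z) (θ-antisym j k)) (lem (f j) (h k) (θ j k))) ⟩
    ∑∑ K (λ _ _ → 0ℚ)                               ≡⟨ trans (∑-ext K λ _ → ∑-0 K) (∑-0 K) ⟩
    0ℚ ∎
    where
    lem : ∀ a b c → a * b * c + b * a * (- c) ≡ 0ℚ
    lem = solve-∀ ℚ-ring

  ω-self : ∀ K f → ω K f (λ k → 2ℚ * f k) ≡ 0ℚ
  ω-self K f = ∑∑-antisym K _ λ j k →
    trans (cong (λ z → f j * (2ℚ * f k) * θ j k + f k * (2ℚ * f j) * z) (θ-antisym j k)) (lem (f j) (f k) (θ j k))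
    where
    lem : ∀ a b c → a * (2ℚ * b) * c + b * (2ℚ * a) * (- c) ≡ 0ℚ
    lem = solve-∀ ℚ-ring

  -- Multiplication by the polynomial variable, acting on coefficients.
  shift : (ℕ → ℚ) → ℕ → ℚ
  shift e zero    = 0ℚ
  shift e (suc k) = e k

  -- ∫₀¹ (f h′ - f′ h) dx for h = 4xf - 2∫f: the part symmetric in j, k is all that survives.
  ω-shift : ∀ M f → f M ≡ 0ℚ →
    ω (suc M) f (shift λ k → (4ℚ - 2ℚ * rec (suc k)) * f k) ≡ 2ℚ * (∑ (suc M) f * ∑ (suc M) (λ k → f k * rec (suc k)))
  ω-shift M f fM≡0 = begin
    ω K f (shift e)
      ≡⟨ ∑-ext K inner ⟩
    ∑∑ K (λ j k → f j * e k * θ j (suc k))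
      ≡⟨ ∑∑-ext K (λ j k → pointwise j k) ⟩
    ∑∑ K (λ j k → anti j k + 2ℚ * (f j * (f k * rec (suc k))))
      ≡⟨ ∑∑-+ K anti (λ j k → 2ℚ * (f j * (f k * rec (suc k)))) ⟩
    ∑∑ K anti + ∑∑ K (λ j k → 2ℚ * (f j * (f k * rec (suc k))))
      ≡⟨ cong₂ _+_ (∑∑-antisym K anti anti-anti) (trans (∑∑-*ˡ K 2ℚ _) (cong (2ℚ *_) (∑∑-* K f (λ k → f k * rec (suc k))))) ⟩
    0ℚ + 2ℚ * (∑ K f * ∑ K (λ k → f k * rec (suc k)))
      ≡⟨ ℚ.+-identityˡ _ ⟩
    2ℚ * (∑ K f * ∑ K (λ k → f k * rec (suc k))) ∎
    where
    K = suc M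
    e : ℕ → ℚ
    e k = (4ℚ - 2ℚ * rec (suc k)) * f k
    anti : ℕ → ℕ → ℚ
    anti j k = 4ℚ * (f j * f k * ((ι k - ι j) * rec (suc (j ℕ.+ k))))
    anti-anti : ∀ j k → anti j k + anti k j ≡ 0ℚ
    anti-anti j k = trans (cong (λ z → anti j k + 4ℚ * (f k * f j * ((ι j - ι k) * rec (suc z)))) (ℕ.+-comm k j))
      (lem (f j) (f k) (ι j) (ι k) (rec (suc (j ℕ.+ k))))
      where
      lem : ∀ a b x y z → 4ℚ * (a * b * ((y - x) * z)) + 4ℚ * (b * a * ((x - y) * z)) ≡ 0ℚ
      lem = solve-∀ ℚ-ring
    -- Shifting pushes the coefficient `e M` out of the range of summation. It vanishes with `f M`,
    -- so the reindexed sum may again run over all of `K`.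
    inner : ∀ j → ∑ K (λ k → f j * shift e k * θ j k) ≡ ∑ K (λ k → f j * e k * θ j (suc k))
    inner j = trans (∑-head M _) (trans (cong (_+ S) (lem₁ (f j) (θ j 0)))
      (trans (ℚ.+-comm 0ℚ S) (cong (S +_)
        (sym (trans (cong (λ z → f j * ((4ℚ - 2ℚ * rec (suc M)) * z) * θ j (suc M)) fM≡0) (lem₂ (f j) (4ℚ - 2ℚ * rec (suc M)) (θ j (suc M))))))))
      where
      S : ℚ
      S = ∑ M (λ k → f j * e k * θ j (suc k))
      lem₁ : ∀ a c → a * 0ℚ * c ≡ 0ℚ
      lem₁ = solve-∀ ℚ-ring
      lem₂ : ∀ a b c → a * (b * 0ℚ) * c ≡ 0ℚ
      lem₂ = solve-∀ ℚ-ring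
    pointwise : ∀ j k → f j * e k * θ j (suc k) ≡ anti j k + 2ℚ * (f j * (f k * rec (suc k)))
    pointwise j k = begin
      f j * e k * ((i - J) * rec (j ℕ.+ suc k))
        ≡⟨ cong₂ (λ y z → f j * e k * ((y - J) * rec z)) (ι-suc k) (ℕ.+-suc j k) ⟩
      f j * e k * ((κ + 1ℚ - J) * R)
        ≡⟨ lem (f j) (f k) r κ J R ⟩
      -- The last bracket is built from `1 - (k+1) r` and `(j+k+1) R - 1`, which are zero. It is the
      -- correction that turns the claim into an identity in free variables.
      anti j k + 2ℚ * (f j * (f k * r)) + 2ℚ * f j * f k * (2ℚ * R * (1ℚ - (κ + 1ℚ) * r) + r * (((J + κ) + 1ℚ) * R - 1ℚ))
        ≡⟨ cong₂ (λ y z → anti j k + 2ℚ * (f j * (f k * r)) + 2ℚ * f j * f k * (2ℚ * R * (1ℚ - y) + r * (z - 1ℚ)))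
             (trans (cong (_* r) (sym (ι-suc k))) (ι*rec k))
             (trans (cong (_* R) (trans (cong (_+ 1ℚ) (sym (ι-+ j k))) (sym (ι-suc (j ℕ.+ k))))) (ι*rec (j ℕ.+ k))) ⟩
      anti j k + 2ℚ * (f j * (f k * r)) + 2ℚ * f j * f k * (2ℚ * R * (1ℚ - 1ℚ) + r * (1ℚ - 1ℚ))
        ≡⟨ lem′ (anti j k + 2ℚ * (f j * (f k * r))) (2ℚ * f j * f k) (2ℚ * R) r ⟩
      anti j k + 2ℚ * (f j * (f k * r)) ∎
      where
      i κ r J R : ℚ
      i = ι (suc k)
      κ = ι k
      r = rec (suc k)
      J = ι j
      R = rec (suc (j ℕ.+ k))
      lem : ∀ a b r κ J R → a * ((4ℚ - 2ℚ * r) * b) * ((κ + 1ℚ - J) * R)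
        ≡ 4ℚ * (a * b * ((κ - J) * R)) + 2ℚ * (a * (b * r))
          + 2ℚ * a * b * (2ℚ * R * (1ℚ - (κ + 1ℚ) * r) + r * (((J + κ) + 1ℚ) * R - 1ℚ))
      lem = solve-∀ ℚ-ring
      lem′ : ∀ a b c d → a + b * (c * (1ℚ - 1ℚ) + d * (1ℚ - 1ℚ)) ≡ a
      lem′ = solve-∀ ℚ-ring

  -- The product `D_n S_n`. Its sums stop at a common `K` instead of `n`, so that polynomials of
  -- different degrees share one range of coefficients; by `D-vanish` this changes nothing for
  -- `n < K`.
  δs : ℕ → ℕ → ℚ
  δs K n = ∑ K (D (ι n)) * ∑ K (λ k → D (ι n) k * rec (suc k))

  -- In the step from `N` to `N + 1`, antisymmetry writes the increment as
  -- `ω D_N (D_{N+1} + D_{N-1})`. In the recurrence the part `2 D_N` contributes nothing and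
  -- `ω-shift` evaluates the rest. There `N < M` guarantees that coefficient `M` of `D_N` vanishes.
  ω-consecutive : ∀ M N → N ≤ M → ω (suc M) (D (ι N - 1ℚ)) (D (ι N)) ≡ 2ℚ * ∑ N (δs (suc M))
  ω-consecutive M zero _ = begin
    ω (suc M) (D (ι 0 - 1ℚ)) (D (ι 0)) ≡⟨ ω-ext (suc M) same (λ _ → refl) ⟩
    ω (suc M) (D (ι 0)) (D (ι 0))      ≡⟨ x+x≡0⇒x≡0 (ω-antisym (suc M) (D (ι 0)) (D (ι 0))) ⟩
    0ℚ                                 ≡⟨⟩
    2ℚ * 0ℚ                            ∎
    where
    lem : ∀ a b → a - 0ℚ * b ≡ a + 0ℚ * b
    lem = solve-∀ ℚ-ring
    same : ∀ k → D (ι 0 - 1ℚ) k ≡ D (ι 0) k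
    same k = begin
      D (ι 0 - 1ℚ) k                           ≡⟨ D-1≡half-sum-half-diff (ι 0) k ⟩
      half-sum (ι 0) k - ι 0 * g (ι 0) k       ≡⟨ cong (λ z → half-sum (ι 0) k - z * g (ι 0) k) ι-0 ⟩
      half-sum (ι 0) k - 0ℚ * g (ι 0) k        ≡⟨ lem (half-sum (ι 0) k) (g (ι 0) k) ⟩
      half-sum (ι 0) k + 0ℚ * g (ι 0) k        ≡⟨ cong (λ z → half-sum (ι 0) k + z * g (ι 0) k) (sym ι-0) ⟩
      half-sum (ι 0) k + ι 0 * g (ι 0) k       ≡⟨ sym (D≡half-sum+half-diff (ι 0) k) ⟩
      D (ι 0) k ∎
  ω-consecutive M (suc N) N<M = begin
    ω K (D (ι (suc N) - 1ℚ)) (D (ι (suc N)))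
      ≡⟨ cong₂ (λ y z → ω K (D y) (D z)) (trans (cong (_- 1ℚ) (ι-suc N)) (lem₁ x)) (ι-suc N) ⟩
    ω K (D x) (D (x + 1ℚ))
      ≡⟨ lem₂ (ω K (D x) (D (x + 1ℚ))) (ω K (D x) (D (x - 1ℚ))) (ω K (D (x - 1ℚ)) (D x)) ⟩
    (ω K (D x) (D (x + 1ℚ)) + ω K (D x) (D (x - 1ℚ))) - (ω K (D x) (D (x - 1ℚ)) + ω K (D (x - 1ℚ)) (D x)) + ω K (D (x - 1ℚ)) (D x)
      ≡⟨ cong₂ (λ y z → y - z + ω K (D (x - 1ℚ)) (D x)) (sym (ω-+ K (D x) (D (x + 1ℚ)) (D (x - 1ℚ)))) (ω-antisym K (D x) (D (x - 1ℚ))) ⟩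
    ω K (D x) (λ k → D (x + 1ℚ) k + D (x - 1ℚ) k) - 0ℚ + ω K (D (x - 1ℚ)) (D x)
      ≡⟨ cong₂ (λ y z → y - 0ℚ + z) (ω-ext K {f = D x} (λ _ → refl) rec-eq) (ω-consecutive M N (ℕ.<⇒≤ N<M)) ⟩
    ω K (D x) (λ k → 2ℚ * D x k + shift e k) - 0ℚ + 2ℚ * ∑ N (δs K)
      ≡⟨ cong (λ y → y - 0ℚ + 2ℚ * ∑ N (δs K)) (trans (ω-+ K (D x) (λ k → 2ℚ * D x k) (shift e)) (cong₂ _+_ (ω-self K (D x)) (ω-shift M (D x) (D-vanish N M N<M)))) ⟩
    0ℚ + 2ℚ * δs K N - 0ℚ + 2ℚ * ∑ N (δs K)
      ≡⟨ lem₃ (δs K N) (∑ N (δs K)) ⟩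
    2ℚ * (∑ N (δs K) + δs K N) ∎
    where
    K = suc M
    x : ℚ
    x = ι N
    e : ℕ → ℚ
    e k = (4ℚ - 2ℚ * rec (suc k)) * D x k
    lem₁ : ∀ x → x + 1ℚ - 1ℚ ≡ x
    lem₁ = solve-∀ ℚ-ring
    lem₂ : ∀ a b c → a ≡ (a + b) - (b + c) + c
    lem₂ = solve-∀ ℚ-ring
    lem₃ : ∀ a b → 0ℚ + 2ℚ * a - 0ℚ + 2ℚ * b ≡ 2ℚ * (b + a)
    lem₃ = solve-∀ ℚ-ring
    rec-eq : ∀ k → D (x + 1ℚ) k + D (x - 1ℚ) k ≡ 2ℚ * D x k + shift e k
    rec-eq zero    = refl
    rec-eq (suc k) = D-recurrence x k

  -- Since `D_{N-1} = a - b` and `D_N = a + b`, antisymmetry reduces `ω (a - b) (a + b)` to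
  -- `2 ω a b`. The surplus `rest` is a symmetric weight times the antisymmetric `θ`.
  ∑δs≡ω : ∀ N → let x = ι N in ω (suc N) (half-sum x) (half-diff x) ≡ ∑ N (δs (suc N))
  ∑δs≡ω N = 2-cancel double
    where
    K = suc N
    x : ℚ
    x = ι N
    a b : ℕ → ℚ
    a = half-sum x
    b = half-diff x
    rest : ℕ → ℕ → ℚ
    rest j k = (a j * a k - b j * b k - a j * b k - b j * a k) * θ j k
    rest-anti : ∀ j k → rest j k + rest k j ≡ 0ℚ
    rest-anti j k = trans (cong (λ z → rest j k + (a k * a j - b k * b j - a k * b j - b k * a j) * z) (θ-antisym j k)) (lem (a j) (a k) (b j) (b k) (θ j k))
      where
      lem : ∀ s t v w z → (s * t - v * w - s * w - v * t) * z + (t * s - w * v - t * v - w * s) * (- z) ≡ 0ℚ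
      lem = solve-∀ ℚ-ring
    lem₁ : ∀ s t v w z → (s - v) * (t + w) * z ≡ 2ℚ * (s * w * z) + (s * t - v * w - s * w - v * t) * z
    lem₁ = solve-∀ ℚ-ring
    double : 2ℚ * ω K a b ≡ 2ℚ * ∑ N (δs K)
    double = begin
      2ℚ * ω K a b                                  ≡⟨ sym (ℚ.+-identityʳ _) ⟩
      2ℚ * ω K a b + 0ℚ
        ≡⟨ cong₂ _+_ (sym (∑∑-*ˡ K 2ℚ _)) (sym (∑∑-antisym K rest rest-anti)) ⟩
      ∑∑ K (λ j k → 2ℚ * (a j * b k * θ j k)) + ∑∑ K rest ≡⟨ sym (∑∑-+ K (λ j k → 2ℚ * (a j * b k * θ j k)) rest) ⟩
      ∑∑ K (λ j k → 2ℚ * (a j * b k * θ j k) + rest j k)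
        ≡⟨ ∑∑-ext K (λ j k → sym (lem₁ (a j) (a k) (b j) (b k) (θ j k))) ⟩
      ω K (λ k → a k - b k) (λ k → a k + b k)
        ≡⟨ ω-ext K (λ k → sym (D-1≡half-sum-half-diff x k)) (λ k → sym (D≡half-sum+half-diff x k)) ⟩
      ω K (D (x - 1ℚ)) (D x)                        ≡⟨ ω-consecutive N N ℕ.≤-refl ⟩
      2ℚ * ∑ N (δs K)                               ∎

  -- The kernel is `(k - j)/(j + k) = 1 - 2j/(j + k)`. The 1 separates into a product of two single
  -- sums; in the other part `half-sum-ι` replaces `j a_j` by `N b_j`.
  ∑δs-closed-form : ∀ N → let x = ι N in
    ∑ N (δs (suc N)) ≡ (1ℚ + sq x * ∑₁ N (λ k → rec k * g x k)) * (x * ∑₁ N (g x))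
                       - 2ℚ * x * sq x * ∑₁ N (λ j → ∑₁ N (λ k → g x j * g x k * rec (j ℕ.+ k)))
  ∑δs-closed-form N = begin
    ∑ N (δs K)           ≡⟨ sym (∑δs≡ω N) ⟩
    ω K a b              ≡⟨ ∑-ext K inner ⟩
    ∑ K (λ j → a j * ∑₁ N b + c * (b j * ∑₁ N (λ k → b k * rec (j ℕ.+ k)))) ≡⟨ ∑-+ K _ _ ⟩
    ∑ K (λ j → a j * ∑₁ N b) + ∑ K (λ j → c * (b j * ∑₁ N (λ k → b k * rec (j ℕ.+ k))))
      ≡⟨ cong₂ _+_ (∑-*ʳ K (∑₁ N b) a) (∑-*ˡ K c _) ⟩
    ∑ K a * ∑₁ N b + c * ∑ K (λ j → b j * ∑₁ N (λ k → b k * rec (j ℕ.+ k)))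
      ≡⟨ cong₂ (λ y z → y * ∑₁ N b + c * z) (trans (∑-head N a) (cong (1ℚ +_) (∑-*ˡ N (sq x) _))) tail ⟩
    (1ℚ + sq x * ∑₁ N (λ k → rec k * g x k)) * ∑₁ N b + c * (sq x * S)
      ≡⟨ cong (λ z → (1ℚ + sq x * ∑₁ N (λ k → rec k * g x k)) * z + c * (sq x * S)) (∑-*ˡ N x (λ k → g x (suc k))) ⟩
    (1ℚ + sq x * ∑₁ N (λ k → rec k * g x k)) * (x * ∑₁ N (g x)) + c * (sq x * S)
      ≡⟨ lem ((1ℚ + sq x * ∑₁ N (λ k → rec k * g x k)) * (x * ∑₁ N (g x))) x S ⟩
    (1ℚ + sq x * ∑₁ N (λ k → rec k * g x k)) * (x * ∑₁ N (g x)) - 2ℚ * x * sq x * S ∎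
    where
    K = suc N
    x c S : ℚ
    x = ι N
    c = - (2ℚ * x)
    S = ∑₁ N (λ j → ∑₁ N (λ k → g x j * g x k * rec (j ℕ.+ k)))
    a b : ℕ → ℚ
    a = half-sum x
    b = half-diff x
    lem : ∀ y x s → y + - (2ℚ * x) * (x * x * s) ≡ y - 2ℚ * x * (x * x) * s
    lem = solve-∀ ℚ-ring
    tail : ∑ K (λ j → b j * ∑₁ N (λ k → b k * rec (j ℕ.+ k))) ≡ sq x * S
    tail = begin
      ∑ K (λ j → b j * ∑₁ N (λ k → b k * rec (j ℕ.+ k))) ≡⟨ ∑-head N _ ⟩
      b 0 * ∑₁ N (λ k → b k * rec k) + T
        ≡⟨ cong (λ z → z * ∑₁ N (λ k → b k * rec k) + T) (half-diff-0 x) ⟩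
      0ℚ * ∑₁ N (λ k → b k * rec k) + T                  ≡⟨ lem₁ (∑₁ N (λ k → b k * rec k)) T ⟩
      T
        ≡⟨ ∑-ext N (λ j → trans (sym (∑-*ˡ N (b (suc j)) _)) (trans (∑-ext N (λ k → lem₂ x (g x (suc j)) (g x (suc k)) (rec (suc j ℕ.+ suc k)))) (∑-*ˡ N (sq x) _))) ⟩
      ∑₁ N (λ j → sq x * ∑₁ N (λ k → g x j * g x k * rec (j ℕ.+ k))) ≡⟨ ∑-*ˡ N (sq x) _ ⟩
      sq x * S ∎
      where
      T : ℚ
      T = ∑₁ N (λ j → b j * ∑₁ N (λ k → b k * rec (j ℕ.+ k)))
      lem₁ : ∀ y t → 0ℚ * y + t ≡ t
      lem₁ = solve-∀ ℚ-ring
      lem₂ : ∀ x v w r → (x * v) * ((x * w) * r) ≡ x * x * (v * w * r)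
      lem₂ = solve-∀ ℚ-ring
    pointwise : ∀ j k → a j * b (suc k) * θ j (suc k) ≡ a j * b (suc k) + c * (b j * (b (suc k) * rec (j ℕ.+ suc k)))
    pointwise j k = begin
      a j * β * ((i - J) * R)                                ≡⟨ lem₁ (a j) β i J R ⟩
      a j * β * ((J + i) * R) - 2ℚ * ((J * a j) * (β * R))
        ≡⟨ cong₂ (λ y z → a j * β * y - 2ℚ * (z * (β * R))) J+i*R (half-sum-ι x j) ⟩
      a j * β * 1ℚ - 2ℚ * ((x * b j) * (β * R))              ≡⟨ lem₂ (a j) β x (b j) R ⟩
      a j * β + c * (b j * (β * R)) ∎
      where
      i J R β : ℚ
      i = ι (suc k)
      J = ι j
      R = rec (j ℕ.+ suc k)
      β = b (suc k)
      J+i*R : (J + i) * R ≡ 1ℚ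
      J+i*R = trans (cong (_* R) (sym (ι-+ j (suc k)))) (ι*rec⁺ (subst (0 <_) (sym (ℕ.+-suc j k)) (s≤s z≤n)))
      lem₁ : ∀ a β i J R → a * β * ((i - J) * R) ≡ a * β * ((J + i) * R) - 2ℚ * ((J * a) * (β * R))
      lem₁ = solve-∀ ℚ-ring
      lem₂ : ∀ a β x b R → a * β * 1ℚ - 2ℚ * ((x * b) * (β * R)) ≡ a * β + - (2ℚ * x) * (b * (β * R))
      lem₂ = solve-∀ ℚ-ring
    inner : ∀ j → ∑ K (λ k → a j * b k * θ j k) ≡ a j * ∑₁ N b + c * (b j * ∑₁ N (λ k → b k * rec (j ℕ.+ k)))
    inner j = begin
      ∑ K (λ k → a j * b k * θ j k)                             ≡⟨ ∑-head N _ ⟩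
      a j * b 0 * θ j 0 + ∑₁ N (λ k → a j * b k * θ j k)
        ≡⟨ cong (λ z → a j * z * θ j 0 + ∑₁ N (λ k → a j * b k * θ j k)) (half-diff-0 x) ⟩
      a j * 0ℚ * θ j 0 + ∑₁ N (λ k → a j * b k * θ j k)         ≡⟨ lem₁ (a j) (θ j 0) (∑₁ N (λ k → a j * b k * θ j k)) ⟩
      ∑₁ N (λ k → a j * b k * θ j k)                            ≡⟨ ∑-ext N (pointwise j) ⟩
      ∑₁ N (λ k → a j * b k + c * (b j * (b k * rec (j ℕ.+ k)))) ≡⟨ ∑-+ N _ _ ⟩
      ∑₁ N (λ k → a j * b k) + ∑₁ N (λ k → c * (b j * (b k * rec (j ℕ.+ k))))
        ≡⟨ cong₂ _+_ (∑-*ˡ N (a j) _) (trans (∑-*ˡ N c _) (cong (c *_) (∑-*ˡ N (b j) _))) ⟩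
      a j * ∑₁ N b + c * (b j * ∑₁ N (λ k → b k * rec (j ℕ.+ k))) ∎
      where
      lem₁ : ∀ a t s → a * 0ℚ * t + s ≡ s
      lem₁ = solve-∀ ℚ-ring

  -- Binomial sums and Bernoulli numbers

  -- The local functions of Defs are out of scope; each metavariable below is solved to one of them,
  -- by a goal in which all its arguments have been abstracted to distinct variables.
  mutual
    sumFromTo-go : ℕ → ℕ → (ℕ → ℚ) → ℕ → ℕ → ℚ
    sumFromTo-go = _

    sumFromTo≡R : ∀ a b f (R : ℕ → ℕ → ℚ) → (∀ i m → sumFromTo-go a b f i m ≡ R i m) →
      (∀ i → 0ℚ ≡ R i 0) → (∀ i m → R i (suc m) ≡ f i + R (suc i) m) → sumFromTo a b f ≡ R a (suc b ∸ a)
    sumFromTo≡R a b f R eq R0 Rs with suc b ∸ a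
    ... | zero = R0 a
    ... | suc m rewrite Rs a m with suc a
    ...   | i = cong (f a +_) (eq i m)

  sumFromTo≡∑ : ∀ a b f → sumFromTo a b f ≡ ∑ (suc b ∸ a) (λ k → f (a ℕ.+ k))
  sumFromTo≡∑ a b f = sumFromTo≡R a b f R go≡R (λ _ → refl) Rs
    where
    R : ℕ → ℕ → ℚ
    R i m = ∑ m (λ k → f (i ℕ.+ k))
    Rs : ∀ i m → R i (suc m) ≡ f i + R (suc i) m
    Rs i m = trans (∑-head m _) (cong₂ _+_ (cong f (ℕ.+-identityʳ i)) (∑-ext m λ k → cong f (ℕ.+-suc i k)))
    go≡R : ∀ i m → sumFromTo-go a b f i m ≡ R i m
    go≡R i zero    = refl
    go≡R i (suc m) = trans (cong (f i +_) (go≡R (suc i) m)) (sym (Rs i m))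

  sumFromTo≡∑₁ : ∀ n (f : ℕ → ℚ) {h : ℕ → ℚ} → (∀ k → f k ≡ h k) → sumFromTo 1 n f ≡ ∑₁ n h
  sumFromTo≡∑₁ n f eq = trans (sumFromTo≡∑ 1 n f) (∑₁-ext n eq)

  ε : ℕ → ℚ
  ε zero    = 1ℚ
  ε (suc k) = - ε k

  mutual
    altHarmonic-term : ℕ → ℕ → ℚ
    altHarmonic-term = _

    altHarmonic≡sumFromTo : ∀ n → altHarmonic n ≡ sumFromTo 1 n (altHarmonic-term n)
    altHarmonic≡sumFromTo n = refl

  mutual
    signed : ℕ → ℕ → ℚ → ℚ
    signed = _

    altHarmonic-term≡ : ∀ n k (s : ℕ → ℚ) → (∀ y → signed n k y ≡ s k * y) → altHarmonic-term n k ≡ s k * (ℤ.+ 1 / suc (k ∸ 1))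
    altHarmonic-term≡ n k s eq with ℤ.+ 1 / suc (k ∸ 1)
    ... | y = eq y

  signed≡ε : ∀ n k y → signed n k y ≡ ε k * y
  signed≡ε n zero          y = refl
  signed≡ε n (suc zero)    y = refl
  signed≡ε n (suc (suc k)) y = trans (signed≡ε n k y) (lem (ε k) y)
    where
    lem : ∀ x y → x * y ≡ - (- x) * y
    lem = solve-∀ ℚ-ring

  altHarmonic≡∑₁ : ∀ n → altHarmonic n ≡ ∑₁ n (λ k → ε k * rec k)
  altHarmonic≡∑₁ n = trans (altHarmonic≡sumFromTo n) (trans (sumFromTo≡∑₁ n (altHarmonic-term n) (λ k → altHarmonic-term≡ n k ε (signed≡ε n k)))
    (∑-ext n λ k → cong (ε (suc k) *_) (sym (rec-suc k))))

  binom : ℕ → ℕ → ℚ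
  binom n k = ι (n C k)

  binom-pascal : ∀ n k → binom (suc n) (suc k) ≡ binom n k + binom n (suc k)
  binom-pascal n k = trans (cong ι (sym (nCk+nC[k+1]≡[n+1]C[k+1] n k))) (ι-+ (n C k) (n C suc k))

  binom-0 : ∀ n → binom n 0 ≡ 1ℚ
  binom-0 n = trans (cong ι (trans (nCk≡nC[n∸k] {0} {n} z≤n) (nCn≡1 n))) ι-1

  binom-vanish : ∀ {n k} → n < k → binom n k ≡ 0ℚ
  binom-vanish n<k = trans (cong ι (k>n⇒nCk≡0 n<k)) ι-0

  binom-absorb : ∀ n k → ι (suc k) * binom n (suc k) ≡ (ι n - ι k) * binom n k
  binom-absorb zero zero = begin
    ι 1 * binom 0 1           ≡⟨ cong (ι 1 *_) (binom-vanish {0} {1} (s≤s z≤n)) ⟩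
    ι 1 * 0ℚ              ≡⟨ lem (ι 1) (ι 0) (binom 0 0) ⟩
    (ι 0 - ι 0) * binom 0 0   ∎
    where
    lem : ∀ x y z → x * 0ℚ ≡ (y - y) * z
    lem = solve-∀ ℚ-ring
  binom-absorb zero (suc k) = begin
    ι (suc (suc k)) * binom 0 (suc (suc k)) ≡⟨ cong (ι (suc (suc k)) *_) (binom-vanish {0} {suc (suc k)} (s≤s z≤n)) ⟩
    ι (suc (suc k)) * 0ℚ                ≡⟨ lem (ι (suc (suc k))) (ι 0 - ι (suc k)) ⟩
    (ι 0 - ι (suc k)) * 0ℚ              ≡⟨ cong ((ι 0 - ι (suc k)) *_) (sym (binom-vanish {0} {suc k} (s≤s z≤n))) ⟩
    (ι 0 - ι (suc k)) * binom 0 (suc k)     ∎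
    where
    lem : ∀ x y → x * 0ℚ ≡ y * 0ℚ
    lem = solve-∀ ℚ-ring
  binom-absorb (suc n) zero = begin
    ι 1 * binom (suc n) 1                   ≡⟨ cong₂ _*_ ι-1 (binom-pascal n 0) ⟩
    1ℚ * (binom n 0 + binom n 1)                ≡⟨ lem₁ (binom n 0) (binom n 1) ⟩
    binom n 0 + 1ℚ * binom n 1
      ≡⟨ cong (binom n 0 +_) (trans (cong (_* binom n 1) (sym ι-1)) (binom-absorb n 0)) ⟩
    binom n 0 + (ι n - ι 0) * binom n 0         ≡⟨ lem₂ (binom n 0) (ι n) (ι 0) ⟩
    (ι n + 1ℚ - ι 0) * binom n 0
      ≡⟨ cong₂ (λ y z → (y - ι 0) * z) (sym (ι-suc n)) (trans (binom-0 n) (sym (binom-0 (suc n)))) ⟩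
    (ι (suc n) - ι 0) * binom (suc n) 0     ∎
    where
    lem₁ : ∀ x y → 1ℚ * (x + y) ≡ x + 1ℚ * y
    lem₁ = solve-∀ ℚ-ring
    lem₂ : ∀ x y z → x + (y - z) * x ≡ (y + 1ℚ - z) * x
    lem₂ = solve-∀ ℚ-ring
  binom-absorb (suc n) (suc k) = begin
    ι (suc (suc k)) * binom (suc n) (suc (suc k))             ≡⟨ cong (ι (suc (suc k)) *_) (binom-pascal n (suc k)) ⟩
    ι (suc (suc k)) * (y + binom n (suc (suc k)))
      ≡⟨ ℚ.*-distribˡ-+ (ι (suc (suc k))) y (binom n (suc (suc k))) ⟩
    ι (suc (suc k)) * y + ι (suc (suc k)) * binom n (suc (suc k))
      ≡⟨ cong₂ (λ z w → z * y + w) (ι-suc (suc k)) (binom-absorb n (suc k)) ⟩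
    (i + 1ℚ) * y + (N - i) * y                            ≡⟨ lem₁ i y N ⟩
    i * y + ((N + 1ℚ) - i) * y
      ≡⟨ cong₂ _+_ (binom-absorb n k) (cong (λ z → (N + 1ℚ - z) * y) (ι-suc k)) ⟩
    (N - κ) * x + ((N + 1ℚ) - (κ + 1ℚ)) * y               ≡⟨ lem₂ κ x y N ⟩
    (N + 1ℚ - (κ + 1ℚ)) * (x + y)
      ≡⟨ cong₂ _*_ (cong₂ _-_ (sym (ι-suc n)) (sym (ι-suc k))) (sym (binom-pascal n k)) ⟩
    (ι (suc n) - ι (suc k)) * binom (suc n) (suc k)           ∎
    where
    i κ N x y : ℚ
    i = ι (suc k)
    κ = ι k
    N = ι n
    x = binom n k
    y = binom n (suc k)
    lem₁ : ∀ i y N → (i + 1ℚ) * y + (N - i) * y ≡ i * y + ((N + 1ℚ) - i) * y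
    lem₁ = solve-∀ ℚ-ring
    lem₂ : ∀ κ x y N → (N - κ) * x + ((N + 1ℚ) - (κ + 1ℚ)) * y ≡ (N + 1ℚ - (κ + 1ℚ)) * (x + y)
    lem₂ = solve-∀ ℚ-ring

  binom-absorb′ : ∀ n k → ι (suc k) * binom (suc n) (suc k) ≡ ι (suc n) * binom n k
  binom-absorb′ n k = begin
    ι (suc k) * binom (suc n) (suc k)                     ≡⟨ cong (ι (suc k) *_) (binom-pascal n k) ⟩
    ι (suc k) * (binom n k + binom n (suc k))
      ≡⟨ ℚ.*-distribˡ-+ (ι (suc k)) (binom n k) (binom n (suc k)) ⟩
    ι (suc k) * binom n k + ι (suc k) * binom n (suc k)
      ≡⟨ cong₂ (λ y z → y * binom n k + z) (ι-suc k) (binom-absorb n k) ⟩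
    (ι k + 1ℚ) * binom n k + (ι n - ι k) * binom n k          ≡⟨ lem (ι k) (ι n) (binom n k) ⟩
    (ι n + 1ℚ) * binom n k                                ≡⟨ cong (_* binom n k) (sym (ι-suc n)) ⟩
    ι (suc n) * binom n k                                 ∎
    where
    lem : ∀ k n x → (k + 1ℚ) * x + (n - k) * x ≡ (n + 1ℚ) * x
    lem = solve-∀ ℚ-ring

  binom-n : ∀ n → binom n n ≡ 1ℚ
  binom-n n = trans (cong ι (nCn≡1 n)) ι-1

  binom-pred : ∀ n → binom (suc n) n ≡ ι (suc n)
  binom-pred n = begin
    binom (suc n) n                          ≡⟨ lem (ι n) (binom (suc n) n) ⟩
    (ι n + 1ℚ - ι n) * binom (suc n) n       ≡⟨ cong (λ z → (z - ι n) * binom (suc n) n) (sym (ι-suc n)) ⟩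
    (ι (suc n) - ι n) * binom (suc n) n      ≡⟨ sym (binom-absorb (suc n) n) ⟩
    ι (suc n) * binom (suc n) (suc n)        ≡⟨ cong (ι (suc n) *_) (binom-n (suc n)) ⟩
    ι (suc n) * 1ℚ                       ≡⟨ ℚ.*-identityʳ (ι (suc n)) ⟩
    ι (suc n)                            ∎
    where
    lem : ∀ x y → y ≡ ((x + 1ℚ) - x) * y
    lem = solve-∀ ℚ-ring

  pow : ℚ → ℕ → ℚ
  pow x zero    = 1ℚ
  pow x (suc n) = x * pow x n

  pow-* : ∀ x y n → pow (x * y) n ≡ pow x n * pow y n
  pow-* x y zero    = refl
  pow-* x y (suc n) = trans (cong (x * y *_) (pow-* x y n)) (lem x y (pow x n) (pow y n))
    where
    lem : ∀ x y a b → x * y * (a * b) ≡ x * a * (y * b)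
    lem = solve-∀ ℚ-ring

  binomial : ∀ x n → pow (x + 1ℚ) n ≡ ∑ (suc n) (λ i → binom n i * pow x i)
  binomial x zero = sym (trans (ℚ.+-identityˡ _) (trans (cong (_* 1ℚ) (binom-0 0)) refl))
  binomial x (suc n) = sym (begin
    ∑ (suc (suc n)) (λ i → binom (suc n) i * pow x i)
      ≡⟨ ∑-head (suc n) _ ⟩
    binom (suc n) 0 * 1ℚ + ∑ (suc n) (λ i → binom (suc n) (suc i) * (x * pow x i))
      ≡⟨ cong₂ (λ y z → y * 1ℚ + z) (trans (binom-0 (suc n)) (sym (binom-0 n))) (trans (∑-ext (suc n) λ i → trans (cong (_* (x * pow x i)) (binom-pascal n i)) (lem₁ (binom n i) (binom n (suc i)) x (pow x i))) (∑-+ (suc n) _ _)) ⟩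
    binom n 0 * 1ℚ + (∑ (suc n) (λ i → x * (binom n i * pow x i)) + T)
      ≡⟨ cong (λ z → binom n 0 * 1ℚ + (z + T)) (∑-*ˡ (suc n) x _) ⟩
    binom n 0 * 1ℚ + (x * S + T)
      ≡⟨ lem₂ (binom n 0 * 1ℚ) (x * S) T ⟩
    x * S + (binom n 0 * 1ℚ + T)
      ≡⟨ cong (x * S +_) (sym (∑-head (suc n) (λ i → binom n i * pow x i))) ⟩
    x * S + (S + binom n (suc n) * pow x (suc n))
      ≡⟨ cong (λ z → x * S + (S + z * pow x (suc n))) (binom-vanish (ℕ.n<1+n n)) ⟩
    x * S + (S + 0ℚ * pow x (suc n))
      ≡⟨ lem₃ x S (pow x (suc n)) ⟩
    (x + 1ℚ) * S
      ≡⟨ cong ((x + 1ℚ) *_) (sym (binomial x n)) ⟩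
    (x + 1ℚ) * pow (x + 1ℚ) n ∎)
    where
    S T : ℚ
    S = ∑ (suc n) (λ i → binom n i * pow x i)
    T = ∑ (suc n) (λ i → binom n (suc i) * pow x (suc i))
    lem₁ : ∀ a b x y → (a + b) * (x * y) ≡ x * (a * y) + b * (x * y)
    lem₁ = solve-∀ ℚ-ring
    lem₂ : ∀ a b c → a + (b + c) ≡ b + (a + c)
    lem₂ = solve-∀ ℚ-ring
    lem₃ : ∀ x s y → x * s + (s + 0ℚ * y) ≡ (x + 1ℚ) * s
    lem₃ = solve-∀ ℚ-ring

  pow-difference : ∀ x n → pow (x + 1ℚ) (suc n) - pow x (suc n) ≡ ∑ (suc n) (λ i → binom (suc n) i * pow x i)
  pow-difference x n = trans (cong (_- pow x (suc n)) (trans (binomial x (suc n)) (cong (λ z → S + z * pow x (suc n)) (binom-n (suc n)))))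
    (lem S (pow x (suc n)))
    where
    S : ℚ
    S = ∑ (suc n) (λ i → binom (suc n) i * pow x i)
    lem : ∀ s y → (s + 1ℚ * y) - y ≡ s
    lem = solve-∀ ℚ-ring

  ∑-telescope : ∀ n (f : ℕ → ℚ) → ∑ n (λ k → f (suc k) - f k) ≡ f n - f 0
  ∑-telescope zero    f = sym (ℚ.+-inverseʳ (f 0))
  ∑-telescope (suc n) f = trans (cong (_+ (f (suc n) - f n)) (∑-telescope n f)) (lem (f n) (f 0) (f (suc n)))
    where
    lem : ∀ a b c → (a - b) + (c - a) ≡ c - b
    lem = solve-∀ ℚ-ring

  powerSum : ℕ → ℕ → ℚ
  powerSum N i = ∑ N (λ k → pow (ι k) i)

  -- Summing the expansion of `(k+1)^(n+1) - k^(n+1)` over `k < N` telescopes. The coefficients are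
  -- those of `bernoulli-recurrence`, so the two sequences can be compared term by term.
  powerSum-recurrence : ∀ N n → ∑ (suc n) (λ i → binom (suc n) i * powerSum N i) ≡ pow (ι N) (suc n)
  powerSum-recurrence N n = begin
    ∑ (suc n) (λ i → binom (suc n) i * powerSum N i)
      ≡⟨ ∑-ext (suc n) (λ i → sym (∑-*ˡ N (binom (suc n) i) _)) ⟩
    ∑ (suc n) (λ i → ∑ N (λ k → binom (suc n) i * pow (ι k) i)) ≡⟨ ∑-swap (suc n) N _ ⟩
    ∑ N (λ k → ∑ (suc n) (λ i → binom (suc n) i * pow (ι k) i))
      ≡⟨ ∑-ext N (λ k → trans (sym (pow-difference (ι k) n)) (cong (λ z → pow z (suc n) - pow (ι k) (suc n)) (sym (ι-suc k)))) ⟩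
    ∑ N (λ k → pow (ι (suc k)) (suc n) - pow (ι k) (suc n)) ≡⟨ ∑-telescope N (λ k → pow (ι k) (suc n)) ⟩
    pow (ι N) (suc n) - ι 0 * pow (ι 0) n                 ≡⟨ cong (λ z → pow (ι N) (suc n) - z * pow (ι 0) n) ι-0 ⟩
    pow (ι N) (suc n) - 0ℚ * pow (ι 0) n                  ≡⟨ lem (pow (ι N) (suc n)) (pow (ι 0) n) ⟩
    pow (ι N) (suc n)                                     ∎
    where
    lem : ∀ x y → x - 0ℚ * y ≡ x
    lem = solve-∀ ℚ-ring

  binom-diagonal : ∀ n k → ι (suc k) * binom (n ℕ.+ suc k) (suc k) ≡ (ι n + ι k + 1ℚ) * binom (n ℕ.+ k) k
  binom-diagonal n k = begin
    i * binom (n ℕ.+ suc k) (suc k)             ≡⟨ cong (λ z → i * binom z (suc k)) (ℕ.+-suc n k) ⟩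
    i * binom (suc (n ℕ.+ k)) (suc k)           ≡⟨ cong (i *_) (binom-pascal (n ℕ.+ k) k) ⟩
    i * (x + binom (n ℕ.+ k) (suc k))           ≡⟨ ℚ.*-distribˡ-+ i x (binom (n ℕ.+ k) (suc k)) ⟩
    i * x + i * binom (n ℕ.+ k) (suc k)         ≡⟨ cong₂ (λ y z → y * x + z) (ι-suc k) (binom-absorb (n ℕ.+ k) k) ⟩
    (κ + 1ℚ) * x + (ι (n ℕ.+ k) - κ) * x    ≡⟨ cong (λ z → (κ + 1ℚ) * x + (z - κ) * x) (ι-+ n k) ⟩
    (κ + 1ℚ) * x + ((ι n + κ) - κ) * x      ≡⟨ lem κ x (ι n) ⟩
    (ι n + κ + 1ℚ) * x                      ∎
    where
    i κ x : ℚ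
    i = ι (suc k)
    κ = ι k
    x = binom (n ℕ.+ k) k
    lem : ∀ κ x N → (κ + 1ℚ) * x + ((N + κ) - κ) * x ≡ (N + κ + 1ℚ) * x
    lem = solve-∀ ℚ-ring

  -- Both sides obey the same recurrence in `k`: each binomial coefficient supplies one of the two
  -- linear factors of `D-step`.
  D≡binom*binom : ∀ n k → D (ι n) k ≡ binom n k * binom (n ℕ.+ k) k
  D≡binom*binom n zero = sym (trans (cong₂ _*_ (binom-0 n) (binom-0 (n ℕ.+ 0))) refl)
  D≡binom*binom n (suc k) = sq-cancel k (begin
    D (ι n) (suc k) * sq i                                          ≡⟨ D-step (ι n) k ⟩
    D (ι n) k * ((ι n - ι k) * (ι n + ι k + 1ℚ))
      ≡⟨ cong (_* ((ι n - ι k) * (ι n + ι k + 1ℚ))) (D≡binom*binom n k) ⟩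
    binom n k * binom (n ℕ.+ k) k * ((ι n - ι k) * (ι n + ι k + 1ℚ))
      ≡⟨ lem₁ (binom n k) (binom (n ℕ.+ k) k) (ι n - ι k) (ι n + ι k + 1ℚ) ⟩
    ((ι n - ι k) * binom n k) * ((ι n + ι k + 1ℚ) * binom (n ℕ.+ k) k)
      ≡⟨ cong₂ _*_ (sym (binom-absorb n k)) (sym (binom-diagonal n k)) ⟩
    (i * binom n (suc k)) * (i * binom (n ℕ.+ suc k) (suc k))
      ≡⟨ lem₂ i (binom n (suc k)) (binom (n ℕ.+ suc k) (suc k)) ⟩
    binom n (suc k) * binom (n ℕ.+ suc k) (suc k) * sq i                    ∎)
    where
    i : ℚ
    i = ι (suc k)
    lem₁ : ∀ a b c d → a * b * (c * d) ≡ (c * a) * (d * b)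
    lem₁ = solve-∀ ℚ-ring
    lem₂ : ∀ i a b → (i * a) * (i * b) ≡ a * b * (i * i)
    lem₂ = solve-∀ ℚ-ring

  delannoy≡∑D : ∀ K n → n < K → delannoy n ≡ ∑ K (D (ι n))
  delannoy≡∑D K n n<K = begin
    delannoy n         ≡⟨ sumFromTo≡∑ 0 n _ ⟩
    ∑ (suc n) _
      ≡⟨ ∑-ext (suc n) (λ k → trans (cong₂ _*_ (sym (ι≡ℕtoℚ _)) (sym (ι≡ℕtoℚ _))) (sym (D≡binom*binom n k))) ⟩
    ∑ (suc n) (D (ι n)) ≡⟨ sym (∑-extend K (D (ι n)) n<K (D-vanish n)) ⟩
    ∑ K (D (ι n))      ∎

  schroeder≡∑D : ∀ K n → n < K → schroeder n ≡ ∑ K (λ k → D (ι n) k * rec (suc k))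
  schroeder≡∑D K n n<K = begin
    schroeder n        ≡⟨ sumFromTo≡∑ 0 n _ ⟩
    ∑ (suc n) _
      ≡⟨ ∑-ext (suc n) (λ k → cong₂ _*_ (trans (cong₂ _*_ (sym (ι≡ℕtoℚ _)) (sym (ι≡ℕtoℚ _))) (sym (D≡binom*binom n k))) (sym (rec-suc k))) ⟩
    ∑ (suc n) (λ k → D (ι n) k * rec (suc k))
      ≡⟨ sym (∑-extend K _ n<K λ k n<k → trans (cong (_* rec (suc k)) (D-vanish n k n<k)) (ℚ.*-zeroˡ (rec (suc k)))) ⟩
    ∑ K (λ k → D (ι n) k * rec (suc k)) ∎

  1+∑delannoy*schroeder≡∑δs : ∀ n → 1ℚ + sumFromTo 1 n (λ k → delannoy k * schroeder k) ≡ ∑ (suc n) (δs (suc (suc n)))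
  1+∑delannoy*schroeder≡∑δs n = begin
    1ℚ + sumFromTo 1 n (λ k → delannoy k * schroeder k)  ≡⟨ cong (1ℚ +_) (sumFromTo≡∑ 1 n _) ⟩
    -- The leading `1ℚ` is the term of index 0, by computation.
    delannoy 0 * schroeder 0 + ∑₁ n (λ k → delannoy k * schroeder k)
      ≡⟨ sym (∑-head n (λ k → delannoy k * schroeder k)) ⟩
    ∑ (suc n) (λ k → delannoy k * schroeder k)
      ≡⟨ ∑-cong (suc n) (λ k k≤n → cong₂ _*_ (delannoy≡∑D (suc (suc n)) k (ℕ.m<n⇒m<1+n k≤n)) (schroeder≡∑D (suc (suc n)) k (ℕ.m<n⇒m<1+n k≤n))) ⟩
    ∑ (suc n) (δs (suc (suc n)))                         ∎

  -- The list of Bernoulli numbers and its recurrence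

  nth : List ℚ → ℕ → ℚ
  nth []       _       = 0ℚ
  nth (x ∷ xs) zero    = x
  nth (x ∷ xs) (suc k) = nth xs k

  mutual
    Defs-nth : List ℚ → ℕ → ℚ
    Defs-nth = _

    bernoulli≡Defs-nth : ∀ n → bernoulli n ≡ Defs-nth (bernoulliList n) n
    bernoulli≡Defs-nth n with bernoulliList n
    ... | xs = refl {x = Defs-nth xs n}

  Defs-nth≡nth : ∀ xs k → Defs-nth xs k ≡ nth xs k
  Defs-nth≡nth []       k       = refl
  Defs-nth≡nth (x ∷ xs) zero    = refl
  Defs-nth≡nth (x ∷ xs) (suc k) = Defs-nth≡nth xs k

  nth-++ : ∀ xs ys k → k < List.length xs → nth (xs List.++ ys) k ≡ nth xs k
  nth-++ (x ∷ xs) ys zero    _         = refl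
  nth-++ (x ∷ xs) ys (suc k) (s≤s k<n) = nth-++ xs ys k k<n

  nth-last : ∀ xs y → nth (xs List.++ (y ∷ [])) (List.length xs) ≡ y
  nth-last []       y = refl
  nth-last (x ∷ xs) y = nth-last xs y

  length-bernoulliList : ∀ n → List.length (bernoulliList n) ≡ suc n
  length-bernoulliList zero    = refl
  length-bernoulliList (suc n) = trans (List.length-++ (bernoulliList n)) (trans (ℕ.+-comm _ 1) (cong suc (length-bernoulliList n)))

  -- Each list extends the preceding one by a single last entry, so earlier entries never change.
  nth-bernoulliList : ∀ n k → k ≤ n → nth (bernoulliList n) k ≡ bernoulli k
  nth-bernoulliList zero    zero z≤n = refl
  nth-bernoulliList (suc n) k k≤1+n with ℕ.m≤n⇒m<n∨m≡n k≤1+n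
  ... | inj₂ refl = sym (Defs-nth≡nth (bernoulliList (suc n)) (suc n))
  ... | inj₁ (s≤s k≤n) = trans (nth-++ (bernoulliList n) _ k (subst (k <_) (sym (length-bernoulliList n)) (s≤s k≤n))) (nth-bernoulliList n k k≤n)

  bernoulli-suc : ∀ n → bernoulli (suc n) ≡ - (rec (suc (suc n)) * ∑ (suc n) (λ k → binom (suc (suc n)) k * bernoulli k))
  bernoulli-suc n = begin
    bernoulli (suc n)                  ≡⟨ Defs-nth≡nth (bernoulliList (suc n)) (suc n) ⟩
    nth (bernoulliList (suc n)) (suc n) ≡⟨ cong (nth (bernoulliList (suc n))) (sym (length-bernoulliList n)) ⟩
    nth (bernoulliList n List.++ _) (List.length (bernoulliList n)) ≡⟨ nth-last (bernoulliList n) _ ⟩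
    - ((ℤ.+ 1 / suc (suc n)) * sumFromTo 0 n (λ k → ℕtoℚ (suc (suc n) C k) * Defs-nth (bernoulliList n) k))
      ≡⟨ cong₂ (λ y z → - (y * z)) (sym (rec-suc (suc n))) (trans (sumFromTo≡∑ 0 n _) (∑-cong (suc n) λ { k (s≤s k≤n) →
           cong₂ _*_ (sym (ι≡ℕtoℚ _)) (trans (Defs-nth≡nth (bernoulliList n) k) (nth-bernoulliList n k k≤n)) })) ⟩
    - (rec (suc (suc n)) * ∑ (suc n) (λ k → binom (suc (suc n)) k * bernoulli k)) ∎

  bernoulli-recurrence : ∀ n → ∑ (suc (suc n)) (λ k → binom (suc (suc n)) k * bernoulli k) ≡ 0ℚ
  bernoulli-recurrence n = begin
    S + binom N (suc n) * bernoulli (suc n)  ≡⟨ cong₂ (λ y z → S + y * z) (binom-pred (suc n)) (bernoulli-suc n) ⟩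
    S + ι N * (- (rec N * S))            ≡⟨ lem S (ι N) (rec N) ⟩
    S - (ι N * rec N) * S                ≡⟨ cong (λ z → S - z * S) (ι*rec (suc n)) ⟩
    S - 1ℚ * S                           ≡⟨ lem′ S ⟩
    0ℚ ∎
    where
    N = suc (suc n)
    S : ℚ
    S = ∑ (suc n) (λ k → binom N k * bernoulli k)
    lem : ∀ s i r → s + i * (- (r * s)) ≡ s - (i * r) * s
    lem = solve-∀ ℚ-ring
    lem′ : ∀ s → s - 1ℚ * s ≡ 0ℚ
    lem′ = solve-∀ ℚ-ring

-- Alternating signs and the Kronecker delta

ε-+ : ∀ m n → ε (m ℕ.+ n) ≡ ε m * ε n
ε-+ zero    n = sym (ℚ.*-identityˡ (ε n))
ε-+ (suc m) n = trans (cong -_ (ε-+ m n)) (ℚ.neg-distribˡ-* (ε m) (ε n))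

ε-double : ∀ n → ε (n ℕ.+ n) ≡ 1ℚ
ε-double zero    = refl
ε-double (suc n) = trans (cong (λ z → - ε z) (ℕ.+-suc n n)) (trans (lem (ε (n ℕ.+ n))) (ε-double n))
  where
  lem : ∀ x → - (- x) ≡ x
  lem = solve-∀ ℚ-ring

ε-sq : ∀ n → ε n * ε n ≡ 1ℚ
ε-sq n = trans (sym (ε-+ n n)) (ε-double n)

-- The weight `1 + ε k` is 2 for even `k` and 0 for odd `k`.
∑₁-even : ∀ h (f : ℕ → ℚ) → ∑₁ (h ℕ.+ h) (λ k → f k + ε k * f k) ≡ 2ℚ * ∑₁ h (λ j → f (j ℕ.+ j))
∑₁-even zero    f = refl
∑₁-even (suc h) f = begin
  ∑₁ (suc h ℕ.+ suc h) t        ≡⟨ cong (λ z → ∑₁ (suc z) t) (ℕ.+-suc h h) ⟩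
  ∑₁ m t + t (suc m) + t (suc (suc m))
    ≡⟨ cong₂ (λ y z → y + (f (suc m) + - z * f (suc m)) + (f (suc (suc m)) + - (- z) * f (suc (suc m)))) (∑₁-even h f) (ε-double h) ⟩
  2ℚ * S + (f (suc m) + - 1ℚ * f (suc m)) + (f (suc (suc m)) + - (- 1ℚ) * f (suc (suc m)))
    ≡⟨ lem S (f (suc m)) (f (suc (suc m))) ⟩
  2ℚ * (S + f (suc (suc m)))    ≡⟨ cong (λ z → 2ℚ * (S + f (suc z))) (sym (ℕ.+-suc h h)) ⟩
  2ℚ * (S + f (suc h ℕ.+ suc h)) ∎
  where
  open ≡-Reasoning
  m : ℕ
  m = h ℕ.+ h
  t : ℕ → ℚ
  t k = f k + ε k * f k
  S : ℚ
  S = ∑₁ h (λ j → f (j ℕ.+ j))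
  lem : ∀ s x y → 2ℚ * s + (x + - 1ℚ * x) + (y + - (- 1ℚ) * y) ≡ 2ℚ * (s + y)
  lem = solve-∀ ℚ-ring

δ : ℕ → ℕ → ℚ
δ zero    zero    = 1ℚ
δ zero    (suc k) = 0ℚ
δ (suc j) zero    = 0ℚ
δ (suc j) (suc k) = δ j k

δ-refl : ∀ j → δ j j ≡ 1ℚ
δ-refl zero    = refl
δ-refl (suc j) = δ-refl j

δ-< : ∀ {j k} → j < k → δ j k ≡ 0ℚ
δ-< {zero}  {suc k} _         = refl
δ-< {suc j} {suc k} (s≤s j<k) = δ-< j<k

δ-> : ∀ {j k} → k < j → δ j k ≡ 0ℚ
δ-> {suc j} {zero}  _         = refl
δ-> {suc j} {suc k} (s≤s k<j) = δ-> k<j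

∑-δ : ∀ n j (f : ℕ → ℚ) → j < n → ∑ n (λ k → δ j k * f k) ≡ f j
∑-δ (suc n) zero f _ = trans (∑-head n _) (trans (cong (1ℚ * f 0 +_)
  (trans (∑-ext n λ k → ℚ.*-zeroˡ (f (suc k))) (∑-0 n))) (lem (f 0)))
  where
  lem : ∀ x → 1ℚ * x + 0ℚ ≡ x
  lem = solve-∀ ℚ-ring
∑-δ (suc n) (suc j) f (s≤s j<n) = trans (∑-head n _) (trans (cong (0ℚ * f 0 +_) (∑-δ n j (λ k → f (suc k)) j<n)) (lem (f 0) (f (suc j))))
  where
  lem : ∀ x y → 0ℚ * x + y ≡ y
  lem = solve-∀ ℚ-ring

-- Congruences between p-integral rationals

module Congruence (p : ℕ) (pp : Prime p) where

  P : ℚ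
  P = ι p

  -- The power `p^r`, with a recursion that makes `≈-scale` and `≈-weaken` plain ring identities.
  π : ℕ → ℚ
  π zero    = 1ℚ
  π (suc r) = P * π r

  -- Any denominator prime to `p` is accepted, reduced or not, and the numerator is a difference of
  -- naturals. Closure under the ring operations then needs neither gcds nor signs; the reduced
  -- denominator appears only in `integral⇒p∤denominator`.
  record Integral (x : ℚ) : Set where
    constructor integral
    field
      den num⁺ num⁻ : ℕ
      p∤den         : ¬ p ∣ den
      x*den≡num     : x * ι den ≡ ι num⁺ - ι num⁻

  p∤* : ∀ {m n} → ¬ p ∣ m → ¬ p ∣ n → ¬ p ∣ m ℕ.* n
  p∤* {m} {n} p∤m p∤n p∣mn with euclidsLemma m n pp p∣mn
  ... | inj₁ p∣m = p∤m p∣m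
  ... | inj₂ p∣n = p∤n p∣n

  p∤1 : ¬ p ∣ 1
  p∤1 p∣1 = ℕ.<⇒≱ (ℕ.nonTrivial⇒n>1 p {{prime⇒nonTrivial pp}}) (∣⇒≤ p∣1)

  p∤⇒>0 : ∀ {k} → ¬ p ∣ k → 0 < k
  p∤⇒>0 {zero}  p∤0 with () ← p∤0 (p ∣0)
  p∤⇒>0 {suc k} _   = s≤s z≤n

  p∤small : ∀ {k} → 0 < k → k < p → ¬ p ∣ k
  p∤small {suc k} _ k<p p∣k = ℕ.<⇒≱ k<p (∣⇒≤ p∣k)

  Int-ι : ∀ n → Integral (ι n)
  Int-ι n = integral 1 n 0 p∤1 (trans (cong (ι n *_) ι-1) (trans (lem (ι n)) (cong (λ z → ι n - z) (sym ι-0))))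
    where
    lem : ∀ x → x * 1ℚ ≡ x - 0ℚ
    lem = solve-∀ ℚ-ring

  Int-0 : Integral 0ℚ
  Int-0 = subst Integral ι-0 (Int-ι 0)

  Int-1 : Integral 1ℚ
  Int-1 = subst Integral ι-1 (Int-ι 1)

  Int-2 : Integral 2ℚ
  Int-2 = subst Integral ι-2 (Int-ι 2)

  Int-+ : ∀ {x y} → Integral x → Integral y → Integral (x + y)
  Int-+ {x} {y} (integral d a b p∤d eq) (integral d′ a′ b′ p∤d′ eq′) =
    integral (d ℕ.* d′) (a ℕ.* d′ ℕ.+ a′ ℕ.* d) (b ℕ.* d′ ℕ.+ b′ ℕ.* d) (p∤* p∤d p∤d′) (begin
      (x + y) * ι (d ℕ.* d′)                                      ≡⟨ cong ((x + y) *_) (ι-* d d′) ⟩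
      (x + y) * (ι d * ι d′)                                      ≡⟨ lem₁ x y (ι d) (ι d′) ⟩
      (x * ι d) * ι d′ + (y * ι d′) * ι d                         ≡⟨ cong₂ (λ z w → z * ι d′ + w * ι d) eq eq′ ⟩
      (ι a - ι b) * ι d′ + (ι a′ - ι b′) * ι d                    ≡⟨ lem₂ (ι a) (ι b) (ι d′) (ι a′) (ι b′) (ι d) ⟩
      (ι a * ι d′ + ι a′ * ι d) - (ι b * ι d′ + ι b′ * ι d)       ≡⟨ sym (cong₂ _-_ (expand a a′) (expand b b′)) ⟩
      ι (a ℕ.* d′ ℕ.+ a′ ℕ.* d) - ι (b ℕ.* d′ ℕ.+ b′ ℕ.* d)       ∎)
    where
    open ≡-Reasoning
    expand : ∀ a a′ → ι (a ℕ.* d′ ℕ.+ a′ ℕ.* d) ≡ ι a * ι d′ + ι a′ * ι d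
    expand a a′ = trans (ι-+ (a ℕ.* d′) (a′ ℕ.* d)) (cong₂ _+_ (ι-* a d′) (ι-* a′ d))
    lem₁ : ∀ x y d e → (x + y) * (d * e) ≡ (x * d) * e + (y * e) * d
    lem₁ = solve-∀ ℚ-ring
    lem₂ : ∀ a b e a′ b′ d → (a - b) * e + (a′ - b′) * d ≡ (a * e + a′ * d) - (b * e + b′ * d)
    lem₂ = solve-∀ ℚ-ring

  Int-* : ∀ {x y} → Integral x → Integral y → Integral (x * y)
  Int-* {x} {y} (integral d a b p∤d eq) (integral d′ a′ b′ p∤d′ eq′) =
    integral (d ℕ.* d′) (a ℕ.* a′ ℕ.+ b ℕ.* b′) (a ℕ.* b′ ℕ.+ b ℕ.* a′) (p∤* p∤d p∤d′) (begin
      (x * y) * ι (d ℕ.* d′)                                      ≡⟨ cong ((x * y) *_) (ι-* d d′) ⟩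
      (x * y) * (ι d * ι d′)                                      ≡⟨ lem₁ x y (ι d) (ι d′) ⟩
      (x * ι d) * (y * ι d′)                                      ≡⟨ cong₂ _*_ eq eq′ ⟩
      (ι a - ι b) * (ι a′ - ι b′)                                 ≡⟨ lem₂ (ι a) (ι b) (ι a′) (ι b′) ⟩
      (ι a * ι a′ + ι b * ι b′) - (ι a * ι b′ + ι b * ι a′)
        ≡⟨ sym (cong₂ _-_ (expand a a′ b b′) (expand a b′ b a′)) ⟩
      ι (a ℕ.* a′ ℕ.+ b ℕ.* b′) - ι (a ℕ.* b′ ℕ.+ b ℕ.* a′)       ∎)
    where
    open ≡-Reasoning
    expand : ∀ a b c d → ι (a ℕ.* b ℕ.+ c ℕ.* d) ≡ ι a * ι b + ι c * ι d
    expand a b c d = trans (ι-+ (a ℕ.* b) (c ℕ.* d)) (cong₂ _+_ (ι-* a b) (ι-* c d))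
    lem₁ : ∀ x y d e → (x * y) * (d * e) ≡ (x * d) * (y * e)
    lem₁ = solve-∀ ℚ-ring
    lem₂ : ∀ a b a′ b′ → (a - b) * (a′ - b′) ≡ (a * a′ + b * b′) - (a * b′ + b * a′)
    lem₂ = solve-∀ ℚ-ring

  Int-neg : ∀ {x} → Integral x → Integral (- x)
  Int-neg {x} (integral d a b p∤d eq) = integral d b a p∤d
    (trans (lem₁ x (ι d)) (trans (cong -_ eq) (lem₂ (ι a) (ι b))))
    where
    lem₁ : ∀ x d → (- x) * d ≡ - (x * d)
    lem₁ = solve-∀ ℚ-ring
    lem₂ : ∀ a b → - (a - b) ≡ b - a
    lem₂ = solve-∀ ℚ-ring

  Int-- : ∀ {x y} → Integral x → Integral y → Integral (x - y)
  Int-- ix iy = Int-+ ix (Int-neg iy)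

  Int-rec : ∀ {k} → ¬ p ∣ k → Integral (rec k)
  Int-rec {k} p∤k = integral k 1 0 p∤k (trans (ℚ.*-comm (rec k) (ι k))
    (trans (ι*rec⁺ (p∤⇒>0 p∤k)) (sym (cong₂ _-_ ι-1 ι-0))))

  Int-∑ : ∀ n {f : ℕ → ℚ} → (∀ k → k < n → Integral (f k)) → Integral (∑ n f)
  Int-∑ zero    int = Int-0
  Int-∑ (suc n) int = Int-+ (Int-∑ n λ k k<n → int k (ℕ.m<n⇒m<1+n k<n)) (int n ℕ.≤-refl)

  infix 4 _≈[_]_

  -- The equation is solved for `x`, so that matching it with `refl` eliminates `x` and the rules
  -- below become ring identities.
  record _≈[_]_ (x : ℚ) (r : ℕ) (y : ℚ) : Set where
    constructor congruent
    field
      {quot}   : ℚ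
      int-quot : Integral quot
      x≡y+     : x ≡ y + π r * quot

  ≈-reflexive : ∀ {r x y} → x ≡ y → x ≈[ r ] y
  ≈-reflexive {r} {x} refl = congruent Int-0 (lem x (π r))
    where
    lem : ∀ x q → x ≡ x + q * 0ℚ
    lem = solve-∀ ℚ-ring

  ≈-refl : ∀ {r x} → x ≈[ r ] x
  ≈-refl = ≈-reflexive refl

  ≈-sym : ∀ {r x y} → x ≈[ r ] y → y ≈[ r ] x
  ≈-sym {r} {x} {y} (congruent {q} iq refl) = congruent (Int-neg iq) (lem y (π r) q)
    where
    lem : ∀ y a q → y ≡ y + a * q + a * (- q)
    lem = solve-∀ ℚ-ring

  ≈-trans : ∀ {r x y z} → x ≈[ r ] y → y ≈[ r ] z → x ≈[ r ] z
  ≈-trans {r} {z = z} (congruent {q} iq refl) (congruent {q′} iq′ refl) = congruent (Int-+ iq′ iq) (lem z (π r) q q′)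
    where
    lem : ∀ z a q q′ → z + a * q′ + a * q ≡ z + a * (q′ + q)
    lem = solve-∀ ℚ-ring

  ≈-setoid : ℕ → Setoid 0ℓ 0ℓ
  ≈-setoid r = record
    { Carrier = ℚ ; _≈_ = λ x y → x ≈[ r ] y
    ; isEquivalence = record { refl = ≈-refl ; sym = ≈-sym ; trans = ≈-trans } }

  ≈-+ : ∀ {r x y x′ y′} → x ≈[ r ] y → x′ ≈[ r ] y′ → x + x′ ≈[ r ] y + y′
  ≈-+ {r} {y = y} {y′ = y′} (congruent {q} iq refl) (congruent {q′} iq′ refl) = congruent (Int-+ iq iq′) (lem y y′ (π r) q q′)
    where
    lem : ∀ y z a q q′ → (y + a * q) + (z + a * q′) ≡ (y + z) + a * (q + q′)
    lem = solve-∀ ℚ-ring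

  ≈-neg : ∀ {r x y} → x ≈[ r ] y → - x ≈[ r ] - y
  ≈-neg {r} {y = y} (congruent {q} iq refl) = congruent (Int-neg iq) (lem y (π r) q)
    where
    lem : ∀ y a q → - (y + a * q) ≡ - y + a * (- q)
    lem = solve-∀ ℚ-ring

  ≈-- : ∀ {r x y x′ y′} → x ≈[ r ] y → x′ ≈[ r ] y′ → x - x′ ≈[ r ] y - y′
  ≈-- e e′ = ≈-+ e (≈-neg e′)

  ≈-*ˡ : ∀ {r x y c} → Integral c → x ≈[ r ] y → c * x ≈[ r ] c * y
  ≈-*ˡ {r} {y = y} {c} ic (congruent {q} iq refl) = congruent (Int-* ic iq) (lem y (π r) q c)
    where
    lem : ∀ y a q c → c * (y + a * q) ≡ c * y + a * (c * q)
    lem = solve-∀ ℚ-ring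

  ≈-*ʳ : ∀ {r x y c} → Integral c → x ≈[ r ] y → x * c ≈[ r ] y * c
  ≈-*ʳ {x = x} {y} {c} ic e = ≈-trans (≈-reflexive (ℚ.*-comm x c)) (≈-trans (≈-*ˡ ic e) (≈-reflexive (ℚ.*-comm c y)))

  Int-π : ∀ r → Integral (π r)
  Int-π zero    = Int-1
  Int-π (suc r) = Int-* (Int-ι p) (Int-π r)

  Int-≈ : ∀ {r x y} → x ≈[ r ] y → Integral y → Integral x
  Int-≈ {r} (congruent iq refl) iy = Int-+ iy (Int-* (Int-π r) iq)

  ≈-* : ∀ {r x y x′ y′} → Integral y → Integral y′ → x ≈[ r ] y → x′ ≈[ r ] y′ → x * x′ ≈[ r ] y * y′
  ≈-* iy iy′ e e′ = ≈-trans (≈-*ʳ (Int-≈ e′ iy′) e) (≈-*ˡ iy e′)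

  ≈-integral : ∀ {x y} → Integral x → Integral y → x ≈[ 0 ] y
  ≈-integral {x} {y} ix iy = congruent (Int-- ix iy) (lem x y)
    where
    lem : ∀ x y → x ≡ y + 1ℚ * (x - y)
    lem = solve-∀ ℚ-ring

  ≈-scale : ∀ {r x y} → x ≈[ r ] y → P * x ≈[ suc r ] P * y
  ≈-scale {r} {y = y} (congruent {q} iq refl) = congruent iq (lem P y (π r) q)
    where
    lem : ∀ p y a q → p * (y + a * q) ≡ p * y + p * a * q
    lem = solve-∀ ℚ-ring

  ≈-weaken : ∀ {r x y} → x ≈[ suc r ] y → x ≈[ r ] y
  ≈-weaken {r} {y = y} (congruent {q} iq refl) = congruent (Int-* (Int-ι p) iq) (lem P y (π r) q)
    where
    lem : ∀ p y a q → y + p * a * q ≡ y + a * (p * q)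
    lem = solve-∀ ℚ-ring

  P*≈0 : ∀ {x} → Integral x → P * x ≈[ 1 ] 0ℚ
  P*≈0 ix = ≈-trans (≈-scale (≈-integral ix Int-0)) (≈-reflexive (ℚ.*-zeroʳ P))

  ≈-cancel : ∀ {r x y} k → ¬ p ∣ k → ι k * x ≈[ r ] ι k * y → x ≈[ r ] y
  ≈-cancel {x = x} {y} k p∤k e = ≈-trans (≈-reflexive (sym (lem x))) (≈-trans (≈-*ˡ (Int-rec p∤k) e) (≈-reflexive (lem y)))
    where
    lem′ : ∀ r i z → r * (i * z) ≡ (i * r) * z
    lem′ = solve-∀ ℚ-ring
    lem : ∀ z → rec k * (ι k * z) ≡ z
    lem z = trans (lem′ (rec k) (ι k) z) (trans (cong (_* z) (ι*rec⁺ (p∤⇒>0 p∤k))) (ℚ.*-identityˡ z))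

  ∑-≈ : ∀ {r} n {f g : ℕ → ℚ} → (∀ k → k < n → f k ≈[ r ] g k) → ∑ n f ≈[ r ] ∑ n g
  ∑-≈ zero    e = ≈-refl
  ∑-≈ (suc n) e = ≈-+ (∑-≈ n λ k k<n → e k (ℕ.m<n⇒m<1+n k<n)) (e n ℕ.≤-refl)

  ∑₁-≈ : ∀ {r} n {f g : ℕ → ℚ} → (∀ k → 0 < k → k ≤ n → f k ≈[ r ] g k) → ∑₁ n f ≈[ r ] ∑₁ n g
  ∑₁-≈ n e = ∑-≈ n λ k k<n → e (suc k) (s≤s z≤n) k<n

  Int-∑₁ : ∀ n {f : ℕ → ℚ} → (∀ k → 0 < k → k ≤ n → Integral (f k)) → Integral (∑₁ n f)
  Int-∑₁ n int = Int-∑ n λ k k<n → int (suc k) (s≤s z≤n) k<n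

  π≡ℕtoℚ^ : ∀ r → π r ≡ ℕtoℚ (p ^ r)
  π≡ℕtoℚ^ r = trans (lem r) (ι≡ℕtoℚ (p ^ r))
    where
    lem : ∀ r → π r ≡ ι (p ^ r)
    lem zero    = sym ι-1
    lem (suc r) = trans (cong (P *_) (lem r)) (sym (ι-* p (p ^ r)))

  -- If `x = a / e` is reduced, clearing denominators in the integrality equation gives
  -- `a * den + num⁻ * e = num⁺ * e` over the integers. A divisor of `e` therefore divides
  -- `a * den`.
  p∣denominator⇒p∣numerator*den : ∀ {x} (ix : Integral x) → p ∣ ↧ₙ x → p ∣ ℤ.∣ ↥ x ∣ ℕ.* Integral.den ix
  p∣denominator⇒p∣numerator*den {x@(mkℚ a d-1 coprime)} (integral d b⁺ b⁻ p∤d eq) p∣den =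
    subst (p ∣_) (ℤ.abs-* a (ℤ.+ d)) (Signed.∣⇒∣ᵤ p∣a*d)
    where
    toℚᵘ-ι : ∀ k → toℚᵘ (ι k) ℚᵘ.≃ ℚᵘ.mkℚᵘ (ℤ.+ k) 0
    toℚᵘ-ι k = ℚᵘ.≃-trans (ℚᵘ.≃-reflexive (cong toℚᵘ (ι≡ℕtoℚ k))) (ℚ.toℚᵘ-fromℚᵘ (ℚᵘ.mkℚᵘ (ℤ.+ k) 0))
    eq′ : x * ι d + ι b⁻ ≡ ι b⁺
    eq′ = trans (cong (_+ ι b⁻) eq) (lem (ι b⁺) (ι b⁻))
      where
      lem : ∀ y z → (y - z) + z ≡ y
      lem = solve-∀ ℚ-ring
    eqᵘ : ℚᵘ.mkℚᵘ a d-1 ℚᵘ.* ℚᵘ.mkℚᵘ (ℤ.+ d) 0 ℚᵘ.+ ℚᵘ.mkℚᵘ (ℤ.+ b⁻) 0 ℚᵘ.≃ ℚᵘ.mkℚᵘ (ℤ.+ b⁺) 0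
    eqᵘ = begin
      toℚᵘ x ℚᵘ.* ℚᵘ.mkℚᵘ (ℤ.+ d) 0 ℚᵘ.+ ℚᵘ.mkℚᵘ (ℤ.+ b⁻) 0
        ≈⟨ ℚᵘ.+-cong (ℚᵘ.*-cong (ℚᵘ.≃-refl {toℚᵘ x}) (toℚᵘ-ι d)) (toℚᵘ-ι b⁻) ⟨
      toℚᵘ x ℚᵘ.* toℚᵘ (ι d) ℚᵘ.+ toℚᵘ (ι b⁻)
        ≈⟨ ℚᵘ.+-cong (ℚ.toℚᵘ-homo-* x (ι d)) (ℚᵘ.≃-refl {toℚᵘ (ι b⁻)}) ⟨
      toℚᵘ (x * ι d) ℚᵘ.+ toℚᵘ (ι b⁻)                       ≈⟨ ℚ.toℚᵘ-homo-+ (x * ι d) (ι b⁻) ⟨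
      toℚᵘ (x * ι d + ι b⁻)                                 ≈⟨ ℚᵘ.≃-reflexive (cong toℚᵘ eq′) ⟩
      toℚᵘ (ι b⁺)                                           ≈⟨ toℚᵘ-ι b⁺ ⟩
      ℚᵘ.mkℚᵘ (ℤ.+ b⁺) 0                                    ∎
      where open ≈-Reasoning ℚᵘ.≃-setoid
    e : ℤ
    e = ℤ.+ (suc d-1 ℕ.* 1)
    eqℤ : (a ℤ.* ℤ.+ d ℤ.* ℤ.+ 1 ℤ.+ ℤ.+ b⁻ ℤ.* e) ℤ.* ℤ.+ 1 ≡ ℤ.+ b⁺ ℤ.* (ℤ.+ (suc d-1 ℕ.* 1 ℕ.* 1))
    eqℤ = ℚᵘ.drop-*≡* eqᵘ
    p∣e : ℤ.+ p Signed.∣ e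
    p∣e = Signed.∣ᵤ⇒∣ (subst (p ∣_) (sym (ℕ.*-identityʳ (suc d-1))) p∣den)
    p∣a*d : ℤ.+ p Signed.∣ a ℤ.* ℤ.+ d
    p∣a*d = Signed.∣m+n∣n⇒∣m {m = a ℤ.* ℤ.+ d}
      (subst (ℤ.+ p Signed.∣_) (sym eq″) (Signed.∣n⇒∣m*n (ℤ.+ b⁺) p∣e)) (Signed.∣n⇒∣m*n (ℤ.+ b⁻) p∣e)
      where
      eq″ : a ℤ.* ℤ.+ d ℤ.+ ℤ.+ b⁻ ℤ.* e ≡ ℤ.+ b⁺ ℤ.* e
      eq″ = lem (a ℤ.* ℤ.+ d) (ℤ.+ b⁻ ℤ.* e) (trans eqℤ (cong (λ z → ℤ.+ b⁺ ℤ.* ℤ.+ z) (ℕ.*-identityʳ (suc d-1 ℕ.* 1))))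
        where
        lem : ∀ y z {x} → (y ℤ.* ℤ.+ 1 ℤ.+ z) ℤ.* ℤ.+ 1 ≡ x → y ℤ.+ z ≡ x
        lem y z eq = trans (sym (trans (ℤ.*-identityʳ (y ℤ.* ℤ.+ 1 ℤ.+ z)) (cong (ℤ._+ z) (ℤ.*-identityʳ y)))) eq

  -- Otherwise, by Euclid's lemma, `p` would divide either `den` or the numerator, and the latter
  -- contradicts reducedness.
  integral⇒p∤denominator : ∀ {x} → Integral x → ¬ p ∣ ↧ₙ x
  integral⇒p∤denominator {x@(mkℚ a d-1 coprime)} ix p∣den = [ p∤numerator , Integral.p∤den ix ]′
    (euclidsLemma ℤ.∣ a ∣ (Integral.den ix) pp (p∣denominator⇒p∣numerator*den ix p∣den))
    where
    -- The coprimality stored in a rational is irrelevant; deciding it again makes it usable.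
    coprime′ : Coprime.Coprime ℤ.∣ a ∣ (suc d-1)
    coprime′ = Coprime.recompute {ℤ.∣ a ∣} {suc d-1} coprime
    p∤numerator : ¬ p ∣ ℤ.∣ a ∣
    p∤numerator p∣a = p∤1 (∣-reflexive (coprime′ (p∣a , p∣den)))

  ≈⇒≡[modℚ] : ∀ {x y} r → x ≈[ r ] y → x ≡ y [modℚ p ^ r ]
  ≈⇒≡[modℚ] {x} {y} r (congruent {q} iq eq) = q , trans (cong (_- y) eq) (trans (lem y (π r * q)) (cong (_* q) (π≡ℕtoℚ^ r))) , integral⇒p∤denominator iq
    where
    lem : ∀ y z → y + z - y ≡ z
    lem = solve-∀ ℚ-ring

-- Sums of inverse powers modulo an odd prime

module OddPrime (h : ℕ) (pp : Prime (suc (h ℕ.+ h))) (3<p : 3 < suc (h ℕ.+ h)) where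

  n p : ℕ
  n = h ℕ.+ h
  p = suc n

  open Congruence p pp public

  Int-ε : ∀ k → Integral (ε k)
  Int-ε zero    = Int-1
  Int-ε (suc k) = Int-neg (Int-ε k)

  -- As `p` is odd, `k` and `p - k` have opposite parity.
  ε-reflect : ∀ {k} → k ≤ n → ε (p ∸ k) ≡ - ε k
  ε-reflect {k} k≤n = begin
    ε (p ∸ k)                    ≡⟨ sym (ℚ.*-identityʳ _) ⟩
    ε (p ∸ k) * 1ℚ               ≡⟨ cong (ε (p ∸ k) *_) (sym (ε-sq k)) ⟩
    ε (p ∸ k) * (ε k * ε k)      ≡⟨ sym (ℚ.*-assoc (ε (p ∸ k)) (ε k) (ε k)) ⟩
    ε (p ∸ k) * ε k * ε k        ≡⟨ cong (_* ε k) (trans (sym (ε-+ (p ∸ k) k)) (cong ε (ℕ.m∸n+n≡m (ℕ.m≤n⇒m≤1+n k≤n)))) ⟩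
    - ε n * ε k                  ≡⟨ cong (λ z → - z * ε k) (ε-double h) ⟩
    - 1ℚ * ε k                   ≡⟨ lem (ε k) ⟩
    - ε k                        ∎
    where
    open ≡-Reasoning
    lem : ∀ x → - 1ℚ * x ≡ - x
    lem = solve-∀ ℚ-ring

  p∤ : ∀ {k} → 0 < k → k ≤ n → ¬ p ∣ k
  p∤ 0<k k≤n = p∤small 0<k (s≤s k≤n)

  0<p∸k : ∀ {k} → k ≤ n → 0 < p ∸ k
  0<p∸k {k} k≤n = ℕ.m<n⇒0<n∸m (s≤s k≤n)

  p∸k≤n : ∀ {k} → 0 < k → p ∸ k ≤ n
  p∸k≤n {suc k} _ = ℕ.m∸n≤m n k

  Int-rec′ : ∀ {k} → 0 < k → k ≤ n → Integral (rec k)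
  Int-rec′ 0<k k≤n = Int-rec (p∤ 0<k k≤n)

  -- Stated exactly, so that it can be substituted into its own last term. Each substitution gains a
  -- power of `p`, which yields `rec-reflect₁` and then `rec-reflect₂`.
  rec-reflect : ∀ {k} → 0 < k → k ≤ n → rec (p ∸ k) ≡ - rec k + P * (rec k * rec (p ∸ k))
  rec-reflect {k} 0<k k≤n = begin
    ρ′                                           ≡⟨ lem₁ ρ′ ρ ⟩
    1ℚ * ρ′ - ρ * 1ℚ + ρ * 1ℚ                    ≡⟨ lem₂ ρ′ ρ ⟩
    - (ρ * 1ℚ) + ρ * 1ℚ + 1ℚ * ρ′
      ≡⟨ cong₂ (λ y z → - (ρ * 1ℚ) + ρ * y + z * ρ′) (sym eq′) (sym (ι*rec⁺ 0<k)) ⟩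
    - (ρ * 1ℚ) + ρ * ((P - κ) * ρ′) + (κ * ρ) * ρ′ ≡⟨ lem₃ ρ′ ρ P κ ⟩
    - ρ + P * (ρ * ρ′)                           ∎
    where
    open ≡-Reasoning
    ρ ρ′ κ : ℚ
    ρ = rec k
    ρ′ = rec (p ∸ k)
    κ = ι k
    eq′ : (P - κ) * ρ′ ≡ 1ℚ
    eq′ = trans (cong (_* ρ′) (sym (ι-∸ (ℕ.m≤n⇒m≤1+n k≤n)))) (ι*rec⁺ (0<p∸k k≤n))
    lem₁ : ∀ x y → x ≡ 1ℚ * x - y * 1ℚ + y * 1ℚ
    lem₁ = solve-∀ ℚ-ring
    lem₂ : ∀ x y → 1ℚ * x - y * 1ℚ + y * 1ℚ ≡ - (y * 1ℚ) + y * 1ℚ + 1ℚ * x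
    lem₂ = solve-∀ ℚ-ring
    lem₃ : ∀ x y p κ → - (y * 1ℚ) + y * ((p - κ) * x) + (κ * y) * x ≡ - y + p * (y * x)
    lem₃ = solve-∀ ℚ-ring

  -- The terms at `k` and `p - k` cancel in pairs.
  ∑-odd≈0 : ∀ {G : ℕ → ℚ} → (∀ k → 0 < k → k ≤ n → G (p ∸ k) ≈[ 1 ] - G k) → ∑₁ n G ≈[ 1 ] 0ℚ
  ∑-odd≈0 {G} G-refl = ≈-trans (≈-reflexive (∑₁-halves h G)) (≈-trans
    (≈-+ (≈-refl {x = b}) (∑₁-≈ h λ k 0<k k≤h → G-refl k 0<k (ℕ.≤-trans k≤h (ℕ.m≤m+n h h))))
    (≈-reflexive (trans (cong (b +_) (trans (∑-ext h λ k → lem (G (suc k))) (∑-*ˡ h (- 1ℚ) _))) (lem′ b))))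
    where
    b : ℚ
    b = ∑₁ h G
    lem : ∀ x → - x ≡ - 1ℚ * x
    lem = solve-∀ ℚ-ring
    lem′ : ∀ x → x + - 1ℚ * x ≡ 0ℚ
    lem′ = solve-∀ ℚ-ring

  -- Under `k ↦ p - k` the sign `ε` flips while `F` changes only by `P * G`, so the alternating sum
  -- `E` satisfies `E ≡ -E + P B`.
  alternating-reflection : ∀ {F G : ℕ → ℚ} → (∀ k → 0 < k → k ≤ n → F (p ∸ k) ≈[ 2 ] F k - P * G k) →
    ∑₁ n (λ k → ε k * F k) + ∑₁ n (λ k → ε k * F k) ≈[ 2 ] P * ∑₁ n (λ k → ε k * G k)
  alternating-reflection {F} {G} F-refl = begin
    E + E ≡⟨ cong (E +_) (∑₁-rev n (λ k → ε k * F k)) ⟩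
    E + ∑₁ n (λ k → ε (p ∸ k) * F (p ∸ k))
      ≈⟨ ≈-+ (≈-refl {x = E}) (∑₁-≈ n λ k 0<k k≤n → ≈-trans (≈-reflexive (cong (_* F (p ∸ k)) (ε-reflect k≤n))) (≈-*ˡ (Int-neg (Int-ε k)) (F-refl k 0<k k≤n))) ⟩
    E + ∑₁ n (λ k → - ε k * (F k - P * G k))
      ≡⟨ cong (E +_) (trans (∑-ext n λ k → lem (ε (suc k)) (F (suc k)) P (G (suc k))) (trans (∑-+ n _ _) (cong₂ _+_ (∑-*ˡ n (- 1ℚ) _) (∑-*ˡ n P _)))) ⟩
    E + (- 1ℚ * E + P * B) ≡⟨ lem′ E (P * B) ⟩
    P * B ∎
    where
    open ≈-Reasoning (≈-setoid 2)
    E B : ℚ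
    E = ∑₁ n (λ k → ε k * F k)
    B = ∑₁ n (λ k → ε k * G k)
    lem : ∀ e f p g → - e * (f - p * g) ≡ - 1ℚ * (e * f) + p * (e * g)
    lem = solve-∀ ℚ-ring
    lem′ : ∀ e x → e + (- 1ℚ * e + x) ≡ x
    lem′ = solve-∀ ℚ-ring

  -- Σ F and Σ (-1)^k F(k) are both expressed through the half sum Σ_{k≤h} F, which is then eliminated.
  reflection : ∀ {F G : ℕ → ℚ} {c} → Integral c →
    (∀ k → 0 < k → k ≤ n → F (p ∸ k) ≈[ 2 ] F k - P * G k) →
    (∀ k → 0 < k → k ≤ n → G (p ∸ k) ≈[ 1 ] - G k) →
    (∀ k → F (k ℕ.+ k) ≡ c * F k) → (∀ k → 2ℚ * G (k ℕ.+ k) ≡ c * G k) →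
    2ℚ * (1ℚ - c) * ∑₁ n F ≈[ 2 ] P * ∑₁ n (λ k → ε k * G k)
  reflection {F} {G} {c} ic F-refl G-refl F-double G-double = begin
    2ℚ * (1ℚ - c) * A                                  ≡⟨ lem₁ A E c ⟩
    -- Here `A + E` selects the even indices and equals `2ca`, while `2a ≡ A + P b` and `2E ≡ P B`,
    -- so `A` cancels. What remains is expressed by `cb = K + B`, where `K` vanishes modulo `p`.
    2ℚ * (A + E) - (E + E) - 2ℚ * c * A                ≡⟨ cong (λ z → 2ℚ * z - (E + E) - 2ℚ * c * A) A+E ⟩
    2ℚ * (2ℚ * (c * a)) - (E + E) - 2ℚ * c * A         ≡⟨ lem₂ a c E A ⟩
    2ℚ * c * (a + a) - (E + E) - 2ℚ * c * A            ≈⟨ ≈-- (≈-- (≈-*ˡ (Int-* Int-2 ic) a+a) E+E) ≈-refl ⟩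
    2ℚ * c * (A + P * b) - P * B - 2ℚ * c * A          ≡⟨ lem₃ c A P b B ⟩
    2ℚ * (P * (c * b)) - P * B                         ≡⟨ cong (λ z → 2ℚ * (P * z) - P * B) (sym K+B) ⟩
    2ℚ * (P * (K + B)) - P * B                         ≡⟨ lem₄ P K B ⟩
    2ℚ * (P * K) + P * B                               ≈⟨ ≈-+ (≈-*ˡ Int-2 (≈-scale K≈0)) ≈-refl ⟩
    2ℚ * (P * 0ℚ) + P * B                              ≡⟨ lem₅ P B ⟩
    P * B                                              ∎
    where
    open ≈-Reasoning (≈-setoid 2)
    A E B K a b : ℚ
    A = ∑₁ n F
    E = ∑₁ n (λ k → ε k * F k)
    B = ∑₁ n (λ k → ε k * G k)
    K = ∑₁ n G
    a = ∑₁ h F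
    b = ∑₁ h G
    h≤n : h ≤ n
    h≤n = ℕ.m≤m+n h h
    lem₁ : ∀ A E c → 2ℚ * (1ℚ - c) * A ≡ 2ℚ * (A + E) - (E + E) - 2ℚ * c * A
    lem₁ = solve-∀ ℚ-ring
    lem₂ : ∀ a c E A → 2ℚ * (2ℚ * (c * a)) - (E + E) - 2ℚ * c * A ≡ 2ℚ * c * (a + a) - (E + E) - 2ℚ * c * A
    lem₂ = solve-∀ ℚ-ring
    lem₃ : ∀ c A P b B → 2ℚ * c * (A + P * b) - P * B - 2ℚ * c * A ≡ 2ℚ * (P * (c * b)) - P * B
    lem₃ = solve-∀ ℚ-ring
    lem₄ : ∀ P K B → 2ℚ * (P * (K + B)) - P * B ≡ 2ℚ * (P * K) + P * B
    lem₄ = solve-∀ ℚ-ring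
    lem₅ : ∀ P B → 2ℚ * (P * 0ℚ) + P * B ≡ P * B
    lem₅ = solve-∀ ℚ-ring
    A+E : A + E ≡ 2ℚ * (c * a)
    A+E = trans (sym (∑-+ n _ _)) (trans (∑₁-even h F) (cong (2ℚ *_) (trans (∑₁-ext h F-double) (∑-*ˡ h c _))))
    K+B : K + B ≡ c * b
    K+B = trans (sym (∑-+ n _ _)) (trans (∑₁-even h G) (trans (sym (∑-*ˡ h 2ℚ _)) (trans (∑₁-ext h G-double) (∑-*ˡ h c _))))
    K≈0 : K ≈[ 1 ] 0ℚ
    K≈0 = ∑-odd≈0 G-refl
    a+a : a + a ≈[ 2 ] A + P * b
    a+a = ≈-sym (begin
      A + P * b ≡⟨ cong (_+ P * b) (∑₁-halves h F) ⟩
      a + ∑₁ h (λ k → F (p ∸ k)) + P * b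
        ≈⟨ ≈-+ (≈-+ (≈-refl {x = a}) (∑₁-≈ h λ k 0<k k≤h → F-refl k 0<k (ℕ.≤-trans k≤h h≤n))) (≈-refl {x = P * b}) ⟩
      a + ∑₁ h (λ k → F k - P * G k) + P * b
        ≡⟨ cong (λ z → a + z + P * b) (trans (∑-ext h λ k → lem (F (suc k)) P (G (suc k))) (trans (∑-+ h _ _) (cong (a +_) (∑-*ˡ h (- P) _)))) ⟩
      a + (a + - P * b) + P * b ≡⟨ lem′ a P b ⟩
      a + a ∎)
      where
      lem : ∀ f p g → f - p * g ≡ f + - p * g
      lem = solve-∀ ℚ-ring
      lem′ : ∀ a p b → a + (a + - p * b) + p * b ≡ a + a
      lem′ = solve-∀ ℚ-ring
    E+E : E + E ≈[ 2 ] P * B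
    E+E = alternating-reflection {F} {G} F-refl

  rec-reflect₁ : ∀ k → 0 < k → k ≤ n → rec (p ∸ k) ≈[ 1 ] - rec k
  rec-reflect₁ k 0<k k≤n = congruent (Int-* (Int-rec′ 0<k k≤n) (Int-rec′ (0<p∸k k≤n) (p∸k≤n 0<k)))
    (trans (rec-reflect 0<k k≤n) (lem (rec k) P (rec k * rec (p ∸ k))))
    where
    lem : ∀ x p y → - x + p * y ≡ - x + p * 1ℚ * y
    lem = solve-∀ ℚ-ring

  rec-reflect₂ : ∀ k → 0 < k → k ≤ n → rec (p ∸ k) ≈[ 2 ] - rec k - P * sq (rec k)
  rec-reflect₂ k 0<k k≤n = begin
    rec (p ∸ k)                             ≡⟨ rec-reflect 0<k k≤n ⟩
    - rec k + P * (rec k * rec (p ∸ k))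
      ≈⟨ ≈-+ (≈-refl {x = - rec k}) (≈-scale (≈-*ˡ (Int-rec′ 0<k k≤n) (rec-reflect₁ k 0<k k≤n))) ⟩
    - rec k + P * (rec k * - rec k)         ≡⟨ lem (rec k) P ⟩
    - rec k - P * sq (rec k)               ∎
    where
    open ≈-Reasoning (≈-setoid 2)
    lem : ∀ x p → - x + p * (x * - x) ≡ - x - p * (x * x)
    lem = solve-∀ ℚ-ring

  Int-sq : ∀ {x} → Integral x → Integral (sq x)
  Int-sq ix = Int-* ix ix

  Int-cube : ∀ {x} → Integral x → Integral (cube x)
  Int-cube ix = Int-* ix (Int-* ix ix)

  sq-rec-reflect : ∀ k → 0 < k → k ≤ n → sq (rec (p ∸ k)) ≈[ 2 ] sq (rec k) - P * (- 2ℚ * cube (rec k))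
  sq-rec-reflect k 0<k k≤n = begin
    sq (rec (p ∸ k))                       ≈⟨ ≈-* int int (rec-reflect₂ k 0<k k≤n) (rec-reflect₂ k 0<k k≤n) ⟩
    sq (- rec k - P * sq (rec k))         ≈⟨ congruent (Int-sq (Int-sq (Int-rec′ 0<k k≤n))) (lem (rec k) P) ⟩
    sq (rec k) - P * (- 2ℚ * cube (rec k)) ∎
    where
    open ≈-Reasoning (≈-setoid 2)
    int : Integral (- rec k - P * sq (rec k))
    int = Int-- (Int-neg (Int-rec′ 0<k k≤n)) (Int-* (Int-ι p) (Int-sq (Int-rec′ 0<k k≤n)))
    lem : ∀ x p → (- x - p * (x * x)) * (- x - p * (x * x))
      ≡ (x * x - p * (- 2ℚ * (x * (x * x)))) + p * (p * 1ℚ) * ((x * x) * (x * x))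
    lem = solve-∀ ℚ-ring

  cube-rec-reflect : ∀ k → 0 < k → k ≤ n → cube (rec (p ∸ k)) ≈[ 1 ] - cube (rec k)
  cube-rec-reflect k 0<k k≤n = ≈-trans (≈-* int (Int-* int int) e (≈-* int int e e)) (≈-reflexive (lem (rec k)))
    where
    e : rec (p ∸ k) ≈[ 1 ] - rec k
    e = rec-reflect₁ k 0<k k≤n
    int : Integral (- rec k)
    int = Int-neg (Int-rec′ 0<k k≤n)
    lem : ∀ x → - x * (- x * - x) ≡ - (x * (x * x))
    lem = solve-∀ ℚ-ring

  -- Sums of inverse squares and cubes

  R : ℕ → ℚ
  R i = ∑₁ i (λ k → sq (rec k))

  E₂ E₃ : ℚ
  E₂ = ∑₁ n (λ k → ε k * sq (rec k))
  E₃ = ∑₁ n (λ k → ε k * cube (rec k))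

  ∑-ε-cube : ∑₁ n (λ k → ε k * (- 2ℚ * cube (rec k))) ≡ - 2ℚ * E₃
  ∑-ε-cube = trans (∑-ext n λ k → lem (ε (suc k)) (cube (rec (suc k)))) (∑-*ˡ n (- 2ℚ) _)
    where
    lem : ∀ e x → e * (- 2ℚ * x) ≡ - 2ℚ * (e * x)
    lem = solve-∀ ℚ-ring

  p∤2 : ¬ p ∣ 2
  p∤2 = p∤small (s≤s z≤n) (ℕ.<-trans (s≤s (s≤s (s≤s z≤n))) 3<p)

  p∤3 : ¬ p ∣ 3
  p∤3 = p∤small (s≤s z≤n) 3<p

  E₂≈ : E₂ ≈[ 2 ] - (P * E₃)
  E₂≈ = ≈-cancel 2 p∤2 (begin
    ι 2 * E₂             ≡⟨ trans (cong (_* E₂) ι-2) (lem₁ E₂) ⟩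
    E₂ + E₂              ≈⟨ alternating-reflection {λ k → sq (rec k)} {λ k → - 2ℚ * cube (rec k)} sq-rec-reflect ⟩
    P * ∑₁ n (λ k → ε k * (- 2ℚ * cube (rec k))) ≡⟨ cong (P *_) ∑-ε-cube ⟩
    P * (- 2ℚ * E₃)      ≡⟨ trans (lem₂ P E₃) (cong (_* (- (P * E₃))) (sym ι-2)) ⟩
    ι 2 * - (P * E₃)     ∎)
    where
    open ≈-Reasoning (≈-setoid 2)
    lem₁ : ∀ x → 2ℚ * x ≡ x + x
    lem₁ = solve-∀ ℚ-ring
    lem₂ : ∀ p x → p * (- 2ℚ * x) ≡ 2ℚ * - (p * x)
    lem₂ = solve-∀ ℚ-ring

  -- This is `reflection` for `k^(-2)` with `c = 1/4`: its factor `2(1 - c)` is `3/2`, and doubling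
  -- clears the denominator.
  3R≈ : ι 3 * R n ≈[ 2 ] - (4ℚ * (P * E₃))
  3R≈ = begin
    ι 3 * R n                                  ≡⟨ trans (cong (_* R n) ι-3) (lem₁ (R n)) ⟩
    2ℚ * (2ℚ * R n) - sq 1ℚ * R n             ≡⟨ cong (λ z → 2ℚ * (2ℚ * R n) - sq z * R n) (sym 2*rec2) ⟩
    2ℚ * (2ℚ * R n) - sq (2ℚ * rec 2) * R n   ≡⟨ lem₂ (R n) (rec 2) ⟩
    2ℚ * (2ℚ * (1ℚ - sq (rec 2)) * R n)
      ≈⟨ ≈-*ˡ Int-2 (reflection {λ k → sq (rec k)} {λ k → - 2ℚ * cube (rec k)} (Int-sq (Int-rec p∤2)) sq-rec-reflect odd double₁ double₂) ⟩
    2ℚ * (P * ∑₁ n (λ k → ε k * (- 2ℚ * cube (rec k)))) ≡⟨ cong (λ z → 2ℚ * (P * z)) ∑-ε-cube ⟩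
    2ℚ * (P * (- 2ℚ * E₃))                     ≡⟨ lem₃ P E₃ ⟩
    - (4ℚ * (P * E₃))                          ∎
    where
    open ≈-Reasoning (≈-setoid 2)
    lem₁ : ∀ x → (2ℚ + 1ℚ) * x ≡ 2ℚ * (2ℚ * x) - 1ℚ * 1ℚ * x
    lem₁ = solve-∀ ℚ-ring
    lem₂ : ∀ x r → 2ℚ * (2ℚ * x) - (2ℚ * r) * (2ℚ * r) * x ≡ 2ℚ * (2ℚ * (1ℚ - r * r) * x)
    lem₂ = solve-∀ ℚ-ring
    lem₃ : ∀ p x → 2ℚ * (p * (- 2ℚ * x)) ≡ - (4ℚ * (p * x))
    lem₃ = solve-∀ ℚ-ring
    lem₄ : ∀ x → - 2ℚ * - x ≡ - (- 2ℚ * x)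
    lem₄ = solve-∀ ℚ-ring
    odd : ∀ k → 0 < k → k ≤ n → - 2ℚ * cube (rec (p ∸ k)) ≈[ 1 ] - (- 2ℚ * cube (rec k))
    odd k 0<k k≤n = ≈-trans (≈-*ˡ (Int-neg Int-2) (cube-rec-reflect k 0<k k≤n)) (≈-reflexive (lem₄ (cube (rec k))))
    lem₅ : ∀ r x → (r * x) * (r * x) ≡ (r * r) * (x * x)
    lem₅ = solve-∀ ℚ-ring
    lem₆ : ∀ r x → 2ℚ * (- 2ℚ * ((r * x) * ((r * x) * (r * x)))) ≡ (2ℚ * r) * ((r * r) * (- 2ℚ * (x * (x * x))))
    lem₆ = solve-∀ ℚ-ring
    double₁ : ∀ k → sq (rec (k ℕ.+ k)) ≡ sq (rec 2) * sq (rec k)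
    double₁ k = trans (cong sq (rec-double k)) (lem₅ (rec 2) (rec k))
    double₂ : ∀ k → 2ℚ * (- 2ℚ * cube (rec (k ℕ.+ k))) ≡ sq (rec 2) * (- 2ℚ * cube (rec k))
    double₂ k = trans (cong (λ z → 2ℚ * (- 2ℚ * cube z)) (rec-double k)) (trans (lem₆ (rec 2) (rec k))
      (trans (cong (_* (sq (rec 2) * (- 2ℚ * cube (rec k)))) 2*rec2) (ℚ.*-identityˡ _)))

  Int-E₃ : Integral E₃
  Int-E₃ = Int-∑₁ n λ k 0<k k≤n → Int-* (Int-ε k) (Int-cube (Int-rec′ 0<k k≤n))

  Int-R : ∀ {i} → i ≤ n → Integral (R i)
  Int-R i≤n = Int-∑₁ _ λ k 0<k k≤i → Int-sq (Int-rec′ 0<k (ℕ.≤-trans k≤i i≤n))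

  R≈0 : R n ≈[ 1 ] 0ℚ
  R≈0 = ≈-cancel 3 p∤3 (begin
    ι 3 * R n           ≈⟨ ≈-weaken 3R≈ ⟩
    - (4ℚ * (P * E₃))   ≡⟨ lem P E₃ ⟩
    - 4ℚ * (P * E₃)     ≈⟨ ≈-*ˡ (Int-neg (Int-+ Int-2 Int-2)) (P*≈0 Int-E₃) ⟩
    - 4ℚ * 0ℚ           ≡⟨ trans (ℚ.*-zeroʳ (- 4ℚ)) (sym (ℚ.*-zeroʳ (ι 3))) ⟩
    ι 3 * 0ℚ            ∎)
    where
    open ≈-Reasoning (≈-setoid 1)
    lem : ∀ p x → - (4ℚ * (p * x)) ≡ - 4ℚ * (p * x)
    lem = solve-∀ ℚ-ring

  -- Fermat's congruence, power sums and Bernoulli numbers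

  Int-binom : ∀ n k → Integral (binom n k)
  Int-binom n k = Int-ι _

  Int-pow : ∀ {x} → Integral x → ∀ n → Integral (pow x n)
  Int-pow ix zero    = Int-1
  Int-pow ix (suc n) = Int-* ix (Int-pow ix n)

  -- Absorption gives `C(p,k) = p (1/k) C(p-1,k-1)`, and `1/k` is `p`-integral.
  binom-p≈0 : ∀ k → 0 < k → k ≤ n → binom p k ≈[ 1 ] 0ℚ
  binom-p≈0 (suc k) 0<k k≤n = ≈-trans (≈-reflexive (ι-cancel 0<k (trans (binom-absorb′ n k) (sym (begin
    ι (suc k) * (P * (rec (suc k) * binom n k))    ≡⟨ lem (ι (suc k)) P (rec (suc k)) (binom n k) ⟩
    (ι (suc k) * rec (suc k)) * (P * binom n k)    ≡⟨ cong (_* (P * binom n k)) (ι*rec k) ⟩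
    1ℚ * (P * binom n k)                           ≡⟨ ℚ.*-identityˡ (P * binom n k) ⟩
    P * binom n k                                  ∎)))))
    (P*≈0 (Int-* (Int-rec′ 0<k k≤n) (Int-binom n k)))
    where
    open ≡-Reasoning
    lem : ∀ i p r x → i * (p * (r * x)) ≡ (i * r) * (p * x)
    lem = solve-∀ ℚ-ring

  -- Induction on `k`: only the two extreme terms of the expansion of `(k+1)^p` survive modulo `p`.
  fermat : ∀ k → pow (ι k) p ≈[ 1 ] ι k
  fermat zero = ≈-reflexive (trans (cong (_* pow (ι 0) n) ι-0) (trans (ℚ.*-zeroˡ (pow (ι 0) n)) (sym ι-0)))
  fermat (suc k) = begin
    pow (ι (suc k)) p                          ≡⟨ cong (λ z → pow z p) (ι-suc k) ⟩
    pow (x + 1ℚ) p                             ≡⟨ binomial x p ⟩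
    ∑ p t + binom p p * pow x p                    ≡⟨ cong₂ _+_ (∑-head n t) (cong (_* pow x p) (binom-n p)) ⟩
    (binom p 0 * 1ℚ + ∑₁ n t) + 1ℚ * pow x p       ≈⟨ ≈-+ (≈-+ (≈-reflexive (cong (_* 1ℚ) (binom-0 p)))
                                                    (∑₁-≈ n λ i 0<i i≤n → ≈-trans (≈-*ʳ (Int-pow (Int-ι k) i) (binom-p≈0 i 0<i i≤n)) (≈-reflexive (ℚ.*-zeroˡ (pow x i)))))
                                                    (≈-*ˡ Int-1 (fermat k)) ⟩
    (1ℚ * 1ℚ + ∑₁ n (λ _ → 0ℚ)) + 1ℚ * x       ≡⟨ trans (cong (λ z → 1ℚ * 1ℚ + z + 1ℚ * x) (∑-0 n)) (lem x) ⟩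
    x + 1ℚ                                     ≡⟨ sym (ι-suc k) ⟩
    ι (suc k)                                  ∎
    where
    open ≈-Reasoning (≈-setoid 1)
    x : ℚ
    x = ι k
    t : ℕ → ℚ
    t i = binom p i * pow x i
    lem : ∀ x → 1ℚ * 1ℚ + 0ℚ + 1ℚ * x ≡ x + 1ℚ
    lem = solve-∀ ℚ-ring

  fermat′ : ∀ {k} → ¬ p ∣ k → pow (ι k) n ≈[ 1 ] 1ℚ
  fermat′ {k} p∤k = ≈-cancel k p∤k (≈-trans (fermat k) (≈-reflexive (sym (ℚ.*-identityʳ (ι k)))))

  -- The difference t of the two sides satisfies Σ_{j≤i} C(i+1,j) t_j ≡ 0, and i + 1 is invertible modulo p.
  powerSum≈P*bernoulli : ∀ b i → i < b → suc i < p → powerSum p i ≈[ 2 ] P * bernoulli i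
  -- The bound `b` makes the strong induction structural. At exponent 0 the index `k = 0` counts as
  -- well, and the sum is exactly `p`.
  powerSum≈P*bernoulli (suc b) zero    _         _     = ≈-reflexive (trans (lem′ p) (sym (ℚ.*-identityʳ P)))
    where
    lem′ : ∀ m → ∑ m (λ _ → 1ℚ) ≡ ι m
    lem′ zero    = sym ι-0
    lem′ (suc m) = trans (cong (_+ 1ℚ) (lem′ m)) (sym (ι-suc m))
  powerSum≈P*bernoulli (suc b) (suc i) (s≤s i<b) 2+i<p = ≈-trans (≈-reflexive (lem₁ (powerSum p (suc i)) (P * bernoulli (suc i))))
    (≈-trans (≈-+ t≈0 (≈-refl {x = P * bernoulli (suc i)})) (≈-reflexive (ℚ.+-identityˡ _)))
    where
    open ≈-Reasoning (≈-setoid 2)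
    lem₁ : ∀ x y → x ≡ (x - y) + y
    lem₁ = solve-∀ ℚ-ring
    lem₃ : ∀ a s p b → a * (s - p * b) ≡ a * s + - p * (a * b)
    lem₃ = solve-∀ ℚ-ring
    lem₄ : ∀ p z → p * (p * z) + - p * 0ℚ ≡ 0ℚ + p * (p * 1ℚ) * z
    lem₄ = solve-∀ ℚ-ring
    lem₅ : ∀ s x → x ≡ (s + x) - s
    lem₅ = solve-∀ ℚ-ring
    N : ℕ
    N = suc (suc i)
    t : ℕ → ℚ
    t j = powerSum p j - P * bernoulli j
    S : ℚ
    S = ∑ (suc i) (λ j → binom N j * t j)
    S≈0 : S ≈[ 2 ] 0ℚ
    S≈0 = ≈-trans (∑-≈ (suc i) λ j j≤i → ≈-trans (≈-*ˡ (Int-binom N j) (≈-trans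
        (≈-- (powerSum≈P*bernoulli b j (ℕ.<-≤-trans j≤i i<b) (ℕ.<-trans (s≤s j≤i) 2+i<p)) (≈-refl {x = P * bernoulli j}))
        (≈-reflexive (ℚ.+-inverseʳ (P * bernoulli j))))) (≈-reflexive (ℚ.*-zeroʳ (binom N j))))
      (≈-reflexive (∑-0 (suc i)))
    S+≈0 : S + binom N (suc i) * t (suc i) ≈[ 2 ] 0ℚ
    S+≈0 = begin
      ∑ N (λ j → binom N j * t j)
        ≡⟨ trans (∑-ext N λ j → lem₃ (binom N j) (powerSum p j) P (bernoulli j)) (∑-+ N _ _) ⟩
      ∑ N (λ j → binom N j * powerSum p j) + ∑ N (λ j → - P * (binom N j * bernoulli j))
        ≡⟨ cong₂ _+_ (powerSum-recurrence p (suc i)) (trans (∑-*ˡ N (- P) _) (cong (- P *_) (bernoulli-recurrence i))) ⟩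
      P * (P * pow P i) + - P * 0ℚ      ≈⟨ congruent (Int-pow (Int-ι p) i) (lem₄ P (pow P i)) ⟩
      0ℚ                                ∎
    t≈0 : t (suc i) ≈[ 2 ] 0ℚ
    t≈0 = ≈-cancel N (p∤small (s≤s z≤n) 2+i<p) (begin
      ι N * t (suc i)                          ≡⟨ cong (_* t (suc i)) (sym (binom-pred (suc i))) ⟩
      binom N (suc i) * t (suc i)                  ≡⟨ lem₅ S (binom N (suc i) * t (suc i)) ⟩
      (S + binom N (suc i) * t (suc i)) - S        ≈⟨ ≈-- S+≈0 S≈0 ⟩
      0ℚ - 0ℚ                                  ≡⟨ sym (ℚ.*-zeroʳ (ι N)) ⟩
      ι N * 0ℚ                                 ∎)

  -- The sum of the powers k^(p-3) modulo p²

  pow-reflect₁ : ∀ {x} → Integral x → ∀ i → pow (P - x) i ≈[ 1 ] ε i * pow x i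
  pow-reflect₁     ix zero    = ≈-refl
  pow-reflect₁ {x} ix (suc i) = begin
    (P - x) * pow (P - x) i
      ≈⟨ ≈-* (Int-neg ix) (Int-* (Int-ε i) (Int-pow ix i)) (congruent Int-1 (lem₁ P x)) (pow-reflect₁ ix i) ⟩
    - x * (ε i * pow x i)                    ≡⟨ lem₂ x (ε i) (pow x i) ⟩
    - ε i * (x * pow x i)                    ∎
    where
    open ≈-Reasoning (≈-setoid 1)
    lem₁ : ∀ p x → p - x ≡ - x + p * 1ℚ * 1ℚ
    lem₁ = solve-∀ ℚ-ring
    lem₂ : ∀ x e y → - x * (e * y) ≡ - e * (x * y)
    lem₂ = solve-∀ ℚ-ring

  pow-reflect₂ : ∀ {x} → Integral x → ∀ i → pow (P - x) (suc i) ≈[ 2 ] ε (suc i) * (pow x (suc i) - P * (ι (suc i) * pow x i))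
  pow-reflect₂ {x} ix zero    = ≈-reflexive (trans (lem P x) (cong (λ z → - 1ℚ * (x * 1ℚ - P * (z * 1ℚ))) (sym ι-1)))
    where
    lem : ∀ p x → (p - x) * 1ℚ ≡ - 1ℚ * (x * 1ℚ - p * (1ℚ * 1ℚ))
    lem = solve-∀ ℚ-ring
  pow-reflect₂ {x} ix (suc i) = begin
    (P - x) * pow (P - x) (suc i)                        ≈⟨ ≈-*ˡ (Int-- (Int-ι p) ix) (pow-reflect₂ ix i) ⟩
    (P - x) * (- e * (x * y - P * (ι (suc i) * y)))
      ≈⟨ congruent (Int-* (Int-* (Int-ε i) (Int-ι (suc i))) (Int-pow ix i)) (lem P x e y (ι (suc i))) ⟩
    - - e * (x * (x * y) - P * ((ι (suc i) + 1ℚ) * (x * y)))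
      ≡⟨ cong (λ z → - - e * (x * (x * y) - P * (z * (x * y)))) (sym (ι-suc (suc i))) ⟩
    - - e * (x * (x * y) - P * (ι (suc (suc i)) * (x * y))) ∎
    where
    open ≈-Reasoning (≈-setoid 2)
    e y : ℚ
    e = ε i
    y = pow x i
    lem : ∀ p x e y i → (p - x) * (- e * (x * y - p * (i * y)))
      ≡ - - e * (x * (x * y) - p * ((i + 1ℚ) * (x * y))) + p * (p * 1ℚ) * (e * i * y)
    lem = solve-∀ ℚ-ring

  -- The power `k^(p-3)` has exponent `suc m`, its derivative exponent `m`. As `m` is odd, the
  -- former is even and the latter odd under `k ↦ -k`.
  m : ℕ
  m = p ∸ 4

  3+m≡n : 3 ℕ.+ m ≡ n
  3+m≡n = ℕ.m+[n∸m]≡n (ℕ.s≤s⁻¹ 3<p)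

  1+m≡p∸3 : suc m ≡ p ∸ 3
  1+m≡p∸3 = cong (_∸ 2) 3+m≡n

  ε-m : ε m ≡ - 1ℚ
  ε-m = trans (lem (ε m)) (cong -_ (trans (cong ε 3+m≡n) (ε-double h)))
    where
    lem : ∀ x → x ≡ - - - - x
    lem = solve-∀ ℚ-ring

  s : ℚ
  s = ∑₁ n (λ k → pow (ι k) (suc m))

  powerSum≡s : powerSum p (suc m) ≡ s
  powerSum≡s = trans (∑-head n _) (trans (cong (λ z → z * pow (ι 0) m + s) ι-0) (lem (pow (ι 0) m) s))
    where
    lem : ∀ x y → 0ℚ * x + y ≡ y
    lem = solve-∀ ℚ-ring

  s-reflection : 2ℚ * (1ℚ - pow 2ℚ (suc m)) * s ≈[ 2 ] P * ∑₁ n (λ k → ε k * (ι (suc m) * pow (ι k) m))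
  s-reflection = reflection {λ k → pow (ι k) (suc m)} {λ k → ι (suc m) * pow (ι k) m} (Int-pow Int-2 (suc m)) F-reflect G-reflect F-double G-double
    where
    ι-p∸ : ∀ {k} → k ≤ n → ι (p ∸ k) ≡ P - ι k
    ι-p∸ k≤n = ι-∸ (ℕ.m≤n⇒m≤1+n k≤n)
    F-reflect : ∀ k → 0 < k → k ≤ n → pow (ι (p ∸ k)) (suc m) ≈[ 2 ] pow (ι k) (suc m) - P * (ι (suc m) * pow (ι k) m)
    F-reflect k _ k≤n = ≈-trans (≈-reflexive (cong (λ z → pow z (suc m)) (ι-p∸ k≤n))) (≈-trans (pow-reflect₂ (Int-ι k) m)
      (≈-reflexive (trans (cong (λ z → - z * X) ε-m) (lem X))))
      where
      X : ℚ
      X = pow (ι k) (suc m) - P * (ι (suc m) * pow (ι k) m)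
      lem : ∀ x → - - 1ℚ * x ≡ x
      lem = solve-∀ ℚ-ring
    G-reflect : ∀ k → 0 < k → k ≤ n → ι (suc m) * pow (ι (p ∸ k)) m ≈[ 1 ] - (ι (suc m) * pow (ι k) m)
    G-reflect k _ k≤n = ≈-trans (≈-*ˡ (Int-ι (suc m)) (≈-trans (≈-reflexive (cong (λ z → pow z m) (ι-p∸ k≤n))) (pow-reflect₁ (Int-ι k) m)))
      (≈-reflexive (trans (cong (λ z → ι (suc m) * (z * pow (ι k) m)) ε-m) (lem (ι (suc m)) (pow (ι k) m))))
      where
      lem : ∀ x y → x * (- 1ℚ * y) ≡ - (x * y)
      lem = solve-∀ ℚ-ring
    ι-double : ∀ k → ι (k ℕ.+ k) ≡ 2ℚ * ι k
    ι-double k = trans (ι-+ k k) (lem (ι k))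
      where
      lem : ∀ x → x + x ≡ 2ℚ * x
      lem = solve-∀ ℚ-ring
    F-double : ∀ k → pow (ι (k ℕ.+ k)) (suc m) ≡ pow 2ℚ (suc m) * pow (ι k) (suc m)
    F-double k = trans (cong (λ z → pow z (suc m)) (ι-double k)) (pow-* 2ℚ (ι k) (suc m))
    G-double : ∀ k → 2ℚ * (ι (suc m) * pow (ι (k ℕ.+ k)) m) ≡ pow 2ℚ (suc m) * (ι (suc m) * pow (ι k) m)
    G-double k = trans (cong (λ z → 2ℚ * (ι (suc m) * z)) (trans (cong (λ z → pow z m) (ι-double k)) (pow-* 2ℚ (ι k) m)))
      (lem (ι (suc m)) (pow 2ℚ m) (pow (ι k) m))
      where
      lem : ∀ i x y → 2ℚ * (i * (x * y)) ≡ 2ℚ * x * (i * y)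
      lem = solve-∀ ℚ-ring

  -- By Fermat, since `k^(p-4) = k^(p-1) / k³`.
  pow≈cube-rec : ∀ k → 0 < k → k ≤ n → pow (ι k) m ≈[ 1 ] cube (rec k)
  pow≈cube-rec k 0<k k≤n = begin
    y                                     ≡⟨ lem₁ y ⟩
    cube 1ℚ * y                           ≡⟨ cong (λ z → cube z * y) (sym (ι*rec⁺ 0<k)) ⟩
    cube (ι k * r) * y                    ≡⟨ lem₂ (ι k) r y ⟩
    cube r * pow (ι k) (3 ℕ.+ m)          ≡⟨ cong (λ z → cube r * pow (ι k) z) 3+m≡n ⟩
    cube r * pow (ι k) n                  ≈⟨ ≈-*ˡ (Int-cube (Int-rec′ 0<k k≤n)) (fermat′ (p∤ 0<k k≤n)) ⟩
    cube r * 1ℚ                           ≡⟨ ℚ.*-identityʳ (cube r) ⟩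
    cube r                                ∎
    where
    open ≈-Reasoning (≈-setoid 1)
    r y : ℚ
    r = rec k
    y = pow (ι k) m
    lem₁ : ∀ y → y ≡ 1ℚ * (1ℚ * 1ℚ) * y
    lem₁ = solve-∀ ℚ-ring
    lem₂ : ∀ i r y → (i * r) * ((i * r) * (i * r)) * y ≡ (r * (r * r)) * (i * (i * (i * y)))
    lem₂ = solve-∀ ℚ-ring

  ι[1+m]≈-3 : ι (suc m) ≈[ 1 ] - (2ℚ + 1ℚ)
  ι[1+m]≈-3 = congruent Int-1 (trans (lem (ι (suc m))) (trans (cong (λ z → - (2ℚ + 1ℚ) + (z + ι (suc m))) (sym ι-3))
    (trans (cong (- (2ℚ + 1ℚ) +_) (trans (sym (ι-+ 3 (suc m))) (cong ι (trans (ℕ.+-suc 3 m) (cong suc 3+m≡n))))) (lem′ P))))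
    where
    lem : ∀ x → x ≡ - (2ℚ + 1ℚ) + ((2ℚ + 1ℚ) + x)
    lem = solve-∀ ℚ-ring
    lem′ : ∀ p → - (2ℚ + 1ℚ) + p ≡ - (2ℚ + 1ℚ) + p * 1ℚ * 1ℚ
    lem′ = solve-∀ ℚ-ring

  s-reflection′ : 2ℚ * (1ℚ - pow 2ℚ (suc m)) * s ≈[ 2 ] P * (- (2ℚ + 1ℚ) * E₃)
  s-reflection′ = ≈-trans s-reflection (≈-scale (≈-trans
    (∑₁-≈ n λ k 0<k k≤n → ≈-*ˡ (Int-ε k) (≈-* (Int-neg (Int-+ Int-2 Int-1)) (Int-cube (Int-rec′ 0<k k≤n)) ι[1+m]≈-3 (pow≈cube-rec k 0<k k≤n)))
    (≈-reflexive (trans (∑-ext n λ k → lem (ε (suc k)) (- (2ℚ + 1ℚ)) (cube (rec (suc k)))) (∑-*ˡ n (- (2ℚ + 1ℚ)) _)))))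
    where
    lem : ∀ e a x → e * (a * x) ≡ a * (e * x)
    lem = solve-∀ ℚ-ring

  4*2^≈1 : 4ℚ * pow 2ℚ (suc m) ≈[ 1 ] 1ℚ
  4*2^≈1 = ≈-trans (≈-reflexive (trans (lem (pow 2ℚ m)) (trans (cong (pow 2ℚ) 3+m≡n) (cong (λ z → pow z n) (sym ι-2))))) (fermat′ p∤2)
    where
    lem : ∀ x → 4ℚ * (2ℚ * x) ≡ 2ℚ * (2ℚ * (2ℚ * x))
    lem = solve-∀ ℚ-ring

  Int-s : Integral s
  Int-s = Int-∑₁ n λ k _ _ → Int-pow (Int-ι k) (suc m)

  p∤6 : ¬ p ∣ 6
  p∤6 = p∤* {2} {3} p∤2 p∤3

  ι-6 : ι 6 ≡ 2ℚ * (2ℚ + 1ℚ)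
  ι-6 = trans (ι-* 2 3) (cong₂ _*_ ι-2 ι-3)

  -- With `q = 2^(p-3)` one has `6 = 8(1 - q) + 2(4q - 1)`. The first part is governed by the
  -- reflection, and `4q - 1` is divisible by `p`. This avoids inverting `1 - q` modulo `p²`.
  6s-expand : ι 6 * s ≡ 4ℚ * (2ℚ * (1ℚ - pow 2ℚ (suc m)) * s) + 2ℚ * ((4ℚ * pow 2ℚ (suc m) - 1ℚ) * s)
  6s-expand = trans (cong (_* s) ι-6) (lem (pow 2ℚ (suc m)) s)
    where
    lem : ∀ q s → 2ℚ * (2ℚ + 1ℚ) * s ≡ 4ℚ * (2ℚ * (1ℚ - q) * s) + 2ℚ * ((4ℚ * q - 1ℚ) * s)
    lem = solve-∀ ℚ-ring

  Int-4 : Integral 4ℚ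
  Int-4 = Int-+ Int-2 Int-2

  4*2^-1≈0 : 4ℚ * pow 2ℚ (suc m) - 1ℚ ≈[ 1 ] 0ℚ
  4*2^-1≈0 = ≈-trans (≈-- 4*2^≈1 (≈-refl {x = 1ℚ})) (≈-reflexive (ℚ.+-inverseʳ 1ℚ))

  -- A first pass at low precision. It makes `(4q - 1) s` a product of two multiples of `p`, which
  -- is then dropped modulo `p²` in `s≈`.
  s≈0 : s ≈[ 1 ] 0ℚ
  s≈0 = ≈-cancel 6 p∤6 (begin
    ι 6 * s               ≡⟨ 6s-expand ⟩
    4ℚ * (2ℚ * (1ℚ - pow 2ℚ (suc m)) * s) + 2ℚ * ((4ℚ * pow 2ℚ (suc m) - 1ℚ) * s)
      ≈⟨ ≈-+ (≈-*ˡ Int-4 (≈-trans (≈-weaken s-reflection′) (P*≈0 (Int-* (Int-neg (Int-+ Int-2 Int-1)) Int-E₃)))) (≈-*ˡ Int-2 (≈-*ʳ Int-s 4*2^-1≈0)) ⟩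
    4ℚ * 0ℚ + 2ℚ * (0ℚ * s)  ≡⟨ lem s (ι 6) ⟩
    ι 6 * 0ℚ              ∎)
    where
    open ≈-Reasoning (≈-setoid 1)
    lem : ∀ x y → 4ℚ * 0ℚ + 2ℚ * (0ℚ * x) ≡ y * 0ℚ
    lem = solve-∀ ℚ-ring

  ≈-*₁₁ : ∀ {x y} → x ≈[ 1 ] 0ℚ → y ≈[ 1 ] 0ℚ → x * y ≈[ 2 ] 0ℚ
  ≈-*₁₁ (congruent {q} iq refl) (congruent {q′} iq′ refl) = congruent (Int-* iq iq′) (lem P q q′)
    where
    lem : ∀ p q q′ → (0ℚ + p * 1ℚ * q) * (0ℚ + p * 1ℚ * q′) ≡ 0ℚ + p * (p * 1ℚ) * (q * q′)
    lem = solve-∀ ℚ-ring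

  s≈ : s ≈[ 2 ] - (2ℚ * (P * E₃))
  s≈ = ≈-cancel 6 p∤6 (begin
    ι 6 * s               ≡⟨ 6s-expand ⟩
    4ℚ * (2ℚ * (1ℚ - pow 2ℚ (suc m)) * s) + 2ℚ * ((4ℚ * pow 2ℚ (suc m) - 1ℚ) * s)
      ≈⟨ ≈-+ (≈-*ˡ Int-4 s-reflection′) (≈-*ˡ Int-2 (≈-*₁₁ 4*2^-1≈0 s≈0)) ⟩
    4ℚ * (P * (- (2ℚ + 1ℚ) * E₃)) + 2ℚ * 0ℚ ≡⟨ trans (lem P E₃) (cong (_* - (2ℚ * (P * E₃))) (sym ι-6)) ⟩
    ι 6 * - (2ℚ * (P * E₃)) ∎)
    where
    open ≈-Reasoning (≈-setoid 2)
    lem : ∀ p x → 4ℚ * (p * (- (2ℚ + 1ℚ) * x)) + 2ℚ * 0ℚ ≡ 2ℚ * (2ℚ + 1ℚ) * - (2ℚ * (p * x))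
    lem = solve-∀ ℚ-ring

  P*bernoulli≈ : P * bernoulli (p ∸ 3) ≈[ 2 ] - (2ℚ * (P * E₃))
  P*bernoulli≈ = begin
    P * bernoulli (p ∸ 3)   ≡⟨ cong (λ z → P * bernoulli z) (sym 1+m≡p∸3) ⟩
    P * bernoulli (suc m)   ≈⟨ ≈-sym (powerSum≈P*bernoulli p (suc m) (ℕ.<-trans (ℕ.n<1+n (suc m)) 2+m<p) 2+m<p) ⟩
    powerSum p (suc m)      ≡⟨ powerSum≡s ⟩
    s                       ≈⟨ s≈ ⟩
    - (2ℚ * (P * E₃))       ∎
    where
    open ≈-Reasoning (≈-setoid 2)
    2+m<p : suc (suc m) < p
    2+m<p = s≤s (ℕ.≤-trans (ℕ.n≤1+n (suc (suc m))) (ℕ.≤-reflexive 3+m≡n))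

  -- The p-adic expansion of the closed form

  U G : ℕ → ℚ
  U = u P
  G = g P

  -- When the product is expanded, any two of the terms `p²/i²` already contribute `p⁴`.
  U≈ : ∀ i → i ≤ n → U i ≈[ 4 ] ε i * (1ℚ - P * P * R i)
  U≈ zero    _   = ≈-reflexive (lem P)
    where
    lem : ∀ p → 1ℚ ≡ 1ℚ * (1ℚ - p * p * 0ℚ)
    lem = solve-∀ ℚ-ring
  U≈ (suc i) i<n = begin
    U i * (P * P * q - 1ℚ)
      ≈⟨ ≈-*ʳ (Int-- (Int-* (Int-* (Int-ι p) (Int-ι p)) iq) Int-1) (U≈ i (ℕ.<⇒≤ i<n)) ⟩
    ε i * (1ℚ - P * P * R i) * (P * P * q - 1ℚ)
      ≈⟨ congruent (Int-* (Int-neg (Int-ε i)) (Int-* (Int-R (ℕ.<⇒≤ i<n)) iq)) (lem P (ε i) (R i) q) ⟩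
    - ε i * (1ℚ - P * P * (R i + q))                     ∎
    where
    open ≈-Reasoning (≈-setoid 4)
    q : ℚ
    q = sq (rec (suc i))
    iq : Integral q
    iq = Int-sq (Int-rec′ (s≤s z≤n) i<n)
    lem : ∀ p e r q → e * (1ℚ - p * p * r) * (p * p * q - 1ℚ)
      ≡ - e * (1ℚ - p * p * (r + q)) + p * (p * (p * (p * 1ℚ))) * (- e * (r * q))
    lem = solve-∀ ℚ-ring

  ε-∸1 : ∀ {k} → 0 < k → ε (k ∸ 1) ≡ - ε k
  ε-∸1 {suc k} _ = lem (ε k)
    where
    lem : ∀ x → x ≡ - - x
    lem = solve-∀ ℚ-ring

  ∸1≤n : ∀ {k} → k ≤ n → k ∸ 1 ≤ n
  ∸1≤n {k} k≤n = ℕ.≤-trans (ℕ.m∸n≤m k 1) k≤n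

  G≈₄ : ∀ k → 0 < k → k ≤ n → G k ≈[ 4 ] - (ε k * rec k) + P * (P * (ε k * rec k * R (k ∸ 1)))
  G≈₄ k 0<k k≤n = ≈-trans (≈-*ˡ (Int-rec′ 0<k k≤n) (U≈ (k ∸ 1) (∸1≤n k≤n)))
    (≈-reflexive (trans (cong (λ z → rec k * (z * (1ℚ - P * P * R (k ∸ 1)))) (ε-∸1 0<k)) (lem P (ε k) (rec k) (R (k ∸ 1)))))
    where
    lem : ∀ p e x r → x * (- e * (1ℚ - p * p * r)) ≡ - (e * x) + p * (p * (e * x * r))
    lem = solve-∀ ℚ-ring

  G≈₂ : ∀ k → 0 < k → k ≤ n → G k ≈[ 2 ] - (ε k * rec k)
  G≈₂ k 0<k k≤n = ≈-trans (≈-weaken (≈-weaken (G≈₄ k 0<k k≤n)))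
    (congruent (Int-* (Int-* (Int-ε k) (Int-rec′ 0<k k≤n)) (Int-R (∸1≤n k≤n))) (lem P (- (ε k * rec k)) (ε k * rec k * R (k ∸ 1))))
    where
    lem : ∀ p x y → x + p * (p * y) ≡ x + p * (p * 1ℚ) * y
    lem = solve-∀ ℚ-ring

  Int-ερ : ∀ k → 0 < k → k ≤ n → Integral (- (ε k * rec k))
  Int-ερ k 0<k k≤n = Int-neg (Int-* (Int-ε k) (Int-rec′ 0<k k≤n))

  Int-G : ∀ k → 0 < k → k ≤ n → Integral (G k)
  Int-G k 0<k k≤n = Int-≈ (G≈₂ k 0<k k≤n) (Int-ερ k 0<k k≤n)

  -- The sums of the closed form restricted to indices below `p`. Cross terms with index `p` give
  -- `γ`, and `Z` is the `p²` correction in `β`. The factor `P` in `Δ` is there because `j + k` can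
  -- equal `p`, its only multiple of `p`.
  α β γ Δ H Z : ℚ
  α = ∑₁ n (λ k → rec k * G k)
  β = ∑₁ n G
  γ = ∑₁ n (λ k → G k * rec (p ℕ.+ k))
  Δ = ∑₁ n (λ j → ∑₁ n (λ k → G j * G k * (P * rec (j ℕ.+ k))))
  H = ∑₁ n (λ k → ε k * rec k)
  Z = ∑₁ n (λ k → ε k * rec k * R (k ∸ 1))

  α≈ : α ≈[ 2 ] P * E₃
  α≈ = begin
    α                                        ≈⟨ ∑₁-≈ n (λ k 0<k k≤n → ≈-*ˡ (Int-rec′ 0<k k≤n) (G≈₂ k 0<k k≤n)) ⟩
    ∑₁ n (λ k → rec k * - (ε k * rec k))     ≡⟨ trans (∑-ext n λ k → lem (rec (suc k)) (ε (suc k))) (∑-*ˡ n (- 1ℚ) _) ⟩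
    - 1ℚ * E₂                                ≈⟨ ≈-*ˡ (Int-neg Int-1) E₂≈ ⟩
    - 1ℚ * - (P * E₃)                        ≡⟨ lem′ (P * E₃) ⟩
    P * E₃                                   ∎
    where
    open ≈-Reasoning (≈-setoid 2)
    lem : ∀ x e → x * - (e * x) ≡ - 1ℚ * (e * (x * x))
    lem = solve-∀ ℚ-ring
    lem′ : ∀ x → - 1ℚ * - x ≡ x
    lem′ = solve-∀ ℚ-ring

  p∤p+k : ∀ {k} → 0 < k → k ≤ n → ¬ p ∣ p ℕ.+ k
  p∤p+k 0<k k≤n p∣p+k = p∤ 0<k k≤n (∣m+n∣m⇒∣n p∣p+k ∣-refl)

  rec-p+ : ∀ {k} → 0 < k → k ≤ n → rec (p ℕ.+ k) ≡ rec k - P * (rec k * rec (p ℕ.+ k))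
  rec-p+ {k} 0<k k≤n = begin
    σ                                             ≡⟨ lem₁ σ ρ ⟩
    1ℚ * σ - ρ * 1ℚ + ρ                           ≡⟨ cong₂ (λ y z → y * σ - ρ * z + ρ) (sym (ι*rec⁺ 0<k)) (sym p+k*σ) ⟩
    (κ * ρ) * σ - ρ * ((P + κ) * σ) + ρ           ≡⟨ lem₂ σ ρ P κ ⟩
    ρ - P * (ρ * σ)                               ∎
    where
    open ≡-Reasoning
    ρ σ κ : ℚ
    ρ = rec k
    σ = rec (p ℕ.+ k)
    κ = ι k
    p+k*σ : (P + κ) * σ ≡ 1ℚ
    p+k*σ = trans (cong (_* σ) (sym (ι-+ p k))) (ι*rec⁺ (s≤s z≤n))
    lem₁ : ∀ x y → x ≡ 1ℚ * x - y * 1ℚ + y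
    lem₁ = solve-∀ ℚ-ring
    lem₂ : ∀ x y p κ → (κ * y) * x - y * ((p + κ) * x) + y ≡ y - p * (y * x)
    lem₂ = solve-∀ ℚ-ring

  rec-p+≈₁ : ∀ k → 0 < k → k ≤ n → rec (p ℕ.+ k) ≈[ 1 ] rec k
  rec-p+≈₁ k 0<k k≤n = congruent (Int-neg (Int-* (Int-rec′ 0<k k≤n) (Int-rec (p∤p+k 0<k k≤n))))
    (trans (rec-p+ 0<k k≤n) (lem (rec k) P (rec k * rec (p ℕ.+ k))))
    where
    lem : ∀ x p y → x - p * y ≡ x + p * 1ℚ * - y
    lem = solve-∀ ℚ-ring

  γ≈ : γ ≈[ 2 ] 2ℚ * (P * E₃)
  γ≈ = begin
    γ
      ≈⟨ ∑₁-≈ n (λ k 0<k k≤n → ≈-* (Int-ερ k 0<k k≤n) (int k 0<k k≤n) (G≈₂ k 0<k k≤n) (rec-p+≈₂ k 0<k k≤n)) ⟩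
    ∑₁ n (λ k → - (ε k * rec k) * (rec k - P * (rec k * rec k)))
      ≡⟨ trans (∑-ext n λ k → lem (rec (suc k)) (ε (suc k)) P) (trans (∑-+ n _ _) (cong₂ _+_ (∑-*ˡ n (- 1ℚ) _) (∑-*ˡ n P _))) ⟩
    - 1ℚ * E₂ + P * E₃                                    ≈⟨ ≈-+ (≈-*ˡ (Int-neg Int-1) E₂≈) ≈-refl ⟩
    - 1ℚ * - (P * E₃) + P * E₃                            ≡⟨ lem′ (P * E₃) ⟩
    2ℚ * (P * E₃)                                         ∎
    where
    open ≈-Reasoning (≈-setoid 2)
    rec-p+≈₂ : ∀ k → 0 < k → k ≤ n → rec (p ℕ.+ k) ≈[ 2 ] rec k - P * (rec k * rec k)
    rec-p+≈₂ k 0<k k≤n = ≈-trans (≈-reflexive (rec-p+ 0<k k≤n)) (≈-- (≈-refl {x = rec k}) (≈-scale (≈-*ˡ (Int-rec′ 0<k k≤n) (rec-p+≈₁ k 0<k k≤n))))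
    int : ∀ k → 0 < k → k ≤ n → Integral (rec k - P * (rec k * rec k))
    int k 0<k k≤n = Int-- (Int-rec′ 0<k k≤n) (Int-* (Int-ι p) (Int-sq (Int-rec′ 0<k k≤n)))
    lem : ∀ x e p → - (e * x) * (x - p * (x * x)) ≡ - 1ℚ * (e * (x * x)) + p * (e * (x * (x * x)))
    lem = solve-∀ ℚ-ring
    lem′ : ∀ x → - 1ℚ * - x + x ≡ 2ℚ * x
    lem′ = solve-∀ ℚ-ring

  β≈ : β ≈[ 4 ] - H + P * (P * Z)
  β≈ = ≈-trans (∑₁-≈ n G≈₄) (≈-reflexive (trans (∑-+ n _ _) (cong₂ _+_
    (trans (∑-ext n λ k → lem (ε (suc k) * rec (suc k))) (trans (∑-*ˡ n (- 1ℚ) _) (sym (lem H))))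
    (trans (∑-*ˡ n P _) (cong (P *_) (∑-*ˡ n P _))))))
    where
    lem : ∀ x → - x ≡ - 1ℚ * x
    lem = solve-∀ ℚ-ring

  -- The full sum vanishes modulo `p`, and the squares taken off its upper end are, by `k ↦ p - k`,
  -- congruent to those in `R k`.
  R-reflect : ∀ k → k ≤ n → R (n ∸ k) ≈[ 1 ] - R k
  R-reflect zero    _   = R≈0
  R-reflect (suc k) k<n = begin
    R (n ∸ suc k)                                         ≡⟨ lem₁ (R (n ∸ suc k)) (sq (rec (suc (n ∸ suc k)))) ⟩
    R (suc (n ∸ suc k)) - sq (rec (suc (n ∸ suc k)))     ≡⟨ cong (λ z → R z - sq (rec z)) (suc[n∸suck]≡n∸k k<n) ⟩
    R (n ∸ k) - sq (rec (p ∸ suc k))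
      ≈⟨ ≈-- (R-reflect k (ℕ.<⇒≤ k<n)) (≈-* ir ir (rec-reflect₁ (suc k) (s≤s z≤n) k<n) (rec-reflect₁ (suc k) (s≤s z≤n) k<n)) ⟩
    - R k - sq (- rec (suc k))                           ≡⟨ lem₂ (R k) (rec (suc k)) ⟩
    - (R k + sq (rec (suc k)))                           ∎
    where
    open ≈-Reasoning (≈-setoid 1)
    ir : Integral (- rec (suc k))
    ir = Int-neg (Int-rec′ (s≤s z≤n) k<n)
    lem₁ : ∀ x y → x ≡ (x + y) - y
    lem₁ = solve-∀ ℚ-ring
    lem₂ : ∀ r x → - r - (- x) * (- x) ≡ - (r + x * x)
    lem₂ = solve-∀ ℚ-ring

  -- Under `k ↦ p - k` the signs of `ε k` and `rec k` flip, and `R (k - 1)` becomes `- R k`, that is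
  -- `- (R (k - 1) + 1/k²)`. Hence `Z ≡ -Z - E₃`.
  2Z≈ : 2ℚ * Z ≈[ 1 ] - E₃
  2Z≈ = begin
    2ℚ * Z                                                ≡⟨ lem₁ Z ⟩
    Z + Z                                                 ≡⟨ cong (Z +_) (∑₁-rev n (λ k → ε k * rec k * R (k ∸ 1))) ⟩
    Z + ∑₁ n (λ k → ε (p ∸ k) * rec (p ∸ k) * R (p ∸ k ∸ 1)) ≈⟨ ≈-+ (≈-refl {x = Z}) (∑₁-≈ n term) ⟩
    Z + ∑₁ n (λ k → - 1ℚ * (ε k * rec k * R (k ∸ 1)) + - 1ℚ * (ε k * cube (rec k)))
      ≡⟨ cong (Z +_) (trans (∑-+ n _ _) (cong₂ _+_ (∑-*ˡ n (- 1ℚ) _) (∑-*ˡ n (- 1ℚ) _))) ⟩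
    Z + (- 1ℚ * Z + - 1ℚ * E₃)                            ≡⟨ lem₂ Z E₃ ⟩
    - E₃                                                  ∎
    where
    open ≈-Reasoning (≈-setoid 1)
    lem₁ : ∀ x → 2ℚ * x ≡ x + x
    lem₁ = solve-∀ ℚ-ring
    lem₂ : ∀ x y → x + (- 1ℚ * x + - 1ℚ * y) ≡ - y
    lem₂ = solve-∀ ℚ-ring
    term : ∀ k → 0 < k → k ≤ n → ε (p ∸ k) * rec (p ∸ k) * R (p ∸ k ∸ 1) ≈[ 1 ] - 1ℚ * (ε k * rec k * R (k ∸ 1)) + - 1ℚ * (ε k * cube (rec k))
    term (suc i) 0<k k≤n = begin
      ε (p ∸ suc i) * rec (p ∸ suc i) * R (n ∸ i ∸ 1)
        ≡⟨ cong₂ (λ y z → y * rec (p ∸ suc i) * R z) (ε-reflect k≤n) (trans (ℕ.∸-+-assoc n i 1) (cong (n ∸_) (ℕ.+-comm i 1))) ⟩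
      - ε (suc i) * rec (p ∸ suc i) * R (n ∸ suc i)
        ≈⟨ ≈-* (Int-* (Int-neg (Int-ε (suc i))) ir) (Int-neg (Int-R k≤n)) (≈-*ˡ (Int-neg (Int-ε (suc i))) (rec-reflect₁ (suc i) 0<k k≤n)) (R-reflect (suc i) k≤n) ⟩
      - ε (suc i) * - rec (suc i) * - (R i + sq (rec (suc i)))
        ≡⟨ lem (ε (suc i)) (rec (suc i)) (R i) ⟩
      - 1ℚ * (ε (suc i) * rec (suc i) * R i) + - 1ℚ * (ε (suc i) * cube (rec (suc i))) ∎
      where
      ir : Integral (- rec (suc i))
      ir = Int-neg (Int-rec′ 0<k k≤n)
      lem : ∀ e x r → - e * - x * - (r + x * x) ≡ - 1ℚ * (e * x * r) + - 1ℚ * (e * (x * (x * x)))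
      lem = solve-∀ ℚ-ring

  -- The antisymmetric kernel that 1/(j + (p - k)) reduces to modulo p when j ≠ k.
  N : ℕ → ℕ → ℚ
  N j k = rec (j ∸ k) - rec (k ∸ j)

  P*rec-p : P * rec p ≡ 1ℚ
  P*rec-p = ι*rec n

  -- The index is `p` for `j = k`, `p + (j - k)` for `j > k` and `p - (k - j)` for `j < k`.
  -- Truncated subtraction and `rec 0 = 0` leave only the relevant reciprocal in `N`.
  kernel : ∀ j k → 0 < j → j ≤ n → 0 < k → k ≤ n → P * rec (j ℕ.+ (p ∸ k)) ≈[ 2 ] δ j k + P * N j k
  kernel j k 0<j j≤n 0<k k≤n with ℕ.<-cmp j k
  ... | tri≈ _ refl _ = ≈-reflexive (trans (cong (λ z → P * rec z) (ℕ.m+[n∸m]≡n (ℕ.m≤n⇒m≤1+n j≤n)))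
          (trans P*rec-p (trans (lem P (rec (j ∸ j))) (cong (_+ P * N j j) (sym (δ-refl j))))))
    where
    lem : ∀ p x → 1ℚ ≡ 1ℚ + p * (x - x)
    lem = solve-∀ ℚ-ring
  ... | tri> _ _ k<j = ≈-trans (≈-reflexive (cong (λ z → P * rec z) index)) (≈-trans
          (≈-scale (rec-p+≈₁ (j ∸ k) (ℕ.m<n⇒0<n∸m k<j) (ℕ.≤-trans (ℕ.m∸n≤m j k) j≤n)))
          (≈-reflexive (trans (lem P (rec (j ∸ k))) (cong₂ (λ y z → y + P * (rec (j ∸ k) - z)) (sym (δ-> k<j)) (sym (trans (cong rec (ℕ.m≤n⇒m∸n≡0 (ℕ.<⇒≤ k<j))) rec-0))))))
    where
    index : j ℕ.+ (p ∸ k) ≡ p ℕ.+ (j ∸ k)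
    index = trans (sym (ℕ.+-∸-assoc j (ℕ.m≤n⇒m≤1+n k≤n))) (trans (cong (_∸ k) (ℕ.+-comm j p)) (ℕ.+-∸-assoc p (ℕ.<⇒≤ k<j)))
    lem : ∀ p x → p * x ≡ 0ℚ + p * (x - 0ℚ)
    lem = solve-∀ ℚ-ring
  ... | tri< j<k _ _ = ≈-trans (≈-reflexive (cong (λ z → P * rec z) index)) (≈-trans
          (≈-scale (rec-reflect₁ (k ∸ j) (ℕ.m<n⇒0<n∸m j<k) (ℕ.≤-trans (ℕ.m∸n≤m k j) k≤n)))
          (≈-reflexive (trans (lem P (rec (k ∸ j))) (cong₂ (λ y z → y + P * (z - rec (k ∸ j))) (sym (δ-< j<k)) (sym (trans (cong rec (ℕ.m≤n⇒m∸n≡0 (ℕ.<⇒≤ j<k))) rec-0))))))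
    where
    index : j ℕ.+ (p ∸ k) ≡ p ∸ (k ∸ j)
    index = trans (sym (ℕ.+-∸-assoc j (ℕ.m≤n⇒m≤1+n k≤n))) (trans (cong (j ℕ.+ p ∸_) (sym (ℕ.m+[n∸m]≡n (ℕ.<⇒≤ j<k)))) (ℕ.[m+n]∸[m+o]≡n∸o j p (k ∸ j)))
    lem : ∀ p x → p * - x ≡ 0ℚ + p * (0ℚ - x)
    lem = solve-∀ ℚ-ring

  Int-rec≤n : ∀ {k} → k ≤ n → Integral (rec k)
  Int-rec≤n {zero}  _   = subst Integral (sym rec-0) Int-0
  Int-rec≤n {suc k} k≤n = Int-rec′ (s≤s z≤n) k≤n

  Int-N : ∀ {j k} → j ≤ n → k ≤ n → Integral (N j k)
  Int-N {j} {k} j≤n k≤n = Int-- (Int-rec≤n (ℕ.≤-trans (ℕ.m∸n≤m j k) j≤n)) (Int-rec≤n (ℕ.≤-trans (ℕ.m∸n≤m k j) k≤n))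

  G-reflect₂ : ∀ k → 0 < k → k ≤ n → G (p ∸ k) ≈[ 2 ] ε k * rec (p ∸ k)
  G-reflect₂ k 0<k k≤n = ≈-trans (G≈₂ (p ∸ k) (0<p∸k k≤n) (p∸k≤n 0<k))
    (≈-reflexive (trans (cong (λ z → - (z * rec (p ∸ k))) (ε-reflect k≤n)) (lem (ε k) (rec (p ∸ k)))))
    where
    lem : ∀ e x → - (- e * x) ≡ e * x
    lem = solve-∀ ℚ-ring

  G-reflect₁ : ∀ k → 0 < k → k ≤ n → G (p ∸ k) ≈[ 1 ] G k
  G-reflect₁ k 0<k k≤n = ≈-trans (≈-weaken (G-reflect₂ k 0<k k≤n)) (≈-trans (≈-*ˡ (Int-ε k) (rec-reflect₁ k 0<k k≤n))
    (≈-trans (≈-reflexive (lem (ε k) (rec k))) (≈-sym (≈-weaken (G≈₂ k 0<k k≤n)))))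
    where
    lem : ∀ e x → e * - x ≡ - (e * x)
    lem = solve-∀ ℚ-ring

  -- This is the diagonal of the reflected double sum. The signs multiply to 1, and the correction
  -- `P Σ 1/j³` vanishes modulo `p²` by pairing.
  ∑GG≈R : ∑₁ n (λ j → G j * G (p ∸ j)) ≈[ 2 ] R n
  ∑GG≈R = begin
    ∑₁ n (λ j → G j * G (p ∸ j))                 ≈⟨ ∑₁-≈ n term ⟩
    ∑₁ n (λ j → sq (rec j) + P * cube (rec j))  ≡⟨ trans (∑-+ n _ _) (cong (R n +_) (∑-*ˡ n P _)) ⟩
    R n + P * ∑₁ n (λ j → cube (rec j))
      ≈⟨ ≈-+ (≈-refl {x = R n}) (≈-scale (∑-odd≈0 {λ j → cube (rec j)} cube-rec-reflect)) ⟩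
    R n + P * 0ℚ                                 ≡⟨ lem (R n) P ⟩
    R n                                          ∎
    where
    open ≈-Reasoning (≈-setoid 2)
    lem : ∀ x p → x + p * 0ℚ ≡ x
    lem = solve-∀ ℚ-ring
    term : ∀ j → 0 < j → j ≤ n → G j * G (p ∸ j) ≈[ 2 ] sq (rec j) + P * cube (rec j)
    term j 0<j j≤n = begin
      G j * G (p ∸ j)
        ≈⟨ ≈-* (Int-ερ j 0<j j≤n) (Int-* (Int-ε j) (Int-rec′ (0<p∸k j≤n) (p∸k≤n 0<j))) (G≈₂ j 0<j j≤n) (G-reflect₂ j 0<j j≤n) ⟩
      - (ε j * rec j) * (ε j * rec (p ∸ j))      ≡⟨ lem₁ (ε j) (rec j) (rec (p ∸ j)) ⟩
      (ε j * ε j) * (- rec j * rec (p ∸ j))      ≡⟨ cong (_* (- rec j * rec (p ∸ j))) (ε-sq j) ⟩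
      1ℚ * (- rec j * rec (p ∸ j))               ≡⟨ ℚ.*-identityˡ _ ⟩
      - rec j * rec (p ∸ j)                      ≈⟨ ≈-*ˡ (Int-neg (Int-rec′ 0<j j≤n)) (rec-reflect₂ j 0<j j≤n) ⟩
      - rec j * (- rec j - P * sq (rec j))      ≡⟨ lem₂ (rec j) P ⟩
      sq (rec j) + P * cube (rec j)             ∎
      where
      lem₁ : ∀ e x y → - (e * x) * (e * y) ≡ (e * e) * (- x * y)
      lem₁ = solve-∀ ℚ-ring
      lem₂ : ∀ x p → - x * (- x - p * (x * x)) ≡ x * x + p * (x * (x * x))
      lem₂ = solve-∀ ℚ-ring

  -- Off the diagonal the kernel carries a factor `P`, so `G (p - k)` may be replaced by `G k`
  -- modulo `p`. The weight is then symmetric, against the antisymmetric `N`.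
  Δ≈ : Δ ≈[ 2 ] R n
  Δ≈ = begin
    Δ                                                                     ≈⟨ ∑₁-≈ n inner ⟩
    ∑₁ n (λ j → G j * G (p ∸ j) + P * ∑₁ n (λ k → G j * G k * N j k))
      ≡⟨ trans (∑-+ n _ _) (cong (∑₁ n (λ j → G j * G (p ∸ j)) +_) (trans (∑-*ˡ n P _) (cong (P *_) antisym))) ⟩
    ∑₁ n (λ j → G j * G (p ∸ j)) + P * 0ℚ                                 ≈⟨ ≈-+ ∑GG≈R (≈-refl {x = P * 0ℚ}) ⟩
    R n + P * 0ℚ                                                          ≡⟨ lem (R n) P ⟩
    R n                                                                   ∎
    where
    open ≈-Reasoning (≈-setoid 2)
    lem : ∀ x p → x + p * 0ℚ ≡ x
    lem = solve-∀ ℚ-ring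
    antisym : ∑₁ n (λ j → ∑₁ n (λ k → G j * G k * N j k)) ≡ 0ℚ
    antisym = ∑∑-antisym n (λ i j → G (suc i) * G (suc j) * N (suc i) (suc j)) λ i j → lem′ (G (suc i)) (G (suc j)) (rec (i ∸ j)) (rec (j ∸ i))
      where
      lem′ : ∀ a b x y → a * b * (x - y) + b * a * (y - x) ≡ 0ℚ
      lem′ = solve-∀ ℚ-ring
    pair : ∀ j k → 0 < j → j ≤ n → 0 < k → k ≤ n →
      G j * G (p ∸ k) * (P * rec (j ℕ.+ (p ∸ k))) ≈[ 2 ] δ j k * (G j * G (p ∸ k)) + P * (G j * G k * N j k)
    pair j k 0<j j≤n 0<k k≤n = begin
      G j * G (p ∸ k) * (P * rec (j ℕ.+ (p ∸ k)))     ≈⟨ ≈-*ˡ (Int-* iG iG′) (kernel j k 0<j j≤n 0<k k≤n) ⟩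
      G j * G (p ∸ k) * (δ j k + P * N j k)           ≡⟨ lem₁ (G j) (G (p ∸ k)) (δ j k) P (N j k) ⟩
      δ j k * (G j * G (p ∸ k)) + P * (G j * G (p ∸ k) * N j k)
        ≈⟨ ≈-+ (≈-refl {x = δ j k * (G j * G (p ∸ k))}) (≈-scale (≈-*ʳ (Int-N j≤n k≤n) (≈-*ˡ iG (G-reflect₁ k 0<k k≤n)))) ⟩
      δ j k * (G j * G (p ∸ k)) + P * (G j * G k * N j k) ∎
      where
      iG : Integral (G j)
      iG = Int-G j 0<j j≤n
      iG′ : Integral (G (p ∸ k))
      iG′ = Int-G (p ∸ k) (0<p∸k k≤n) (p∸k≤n 0<k)
      lem₁ : ∀ a b d p x → a * b * (d + p * x) ≡ d * (a * b) + p * (a * b * x)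
      lem₁ = solve-∀ ℚ-ring
    inner : ∀ j → 0 < j → j ≤ n → ∑₁ n (λ k → G j * G k * (P * rec (j ℕ.+ k))) ≈[ 2 ] G j * G (p ∸ j) + P * ∑₁ n (λ k → G j * G k * N j k)
    inner (suc i) 0<j j≤n = begin
      ∑₁ n (λ k → G (suc i) * G k * (P * rec (suc i ℕ.+ k)))
        ≡⟨ ∑₁-rev n (λ k → G (suc i) * G k * (P * rec (suc i ℕ.+ k))) ⟩
      ∑₁ n (λ k → G (suc i) * G (p ∸ k) * (P * rec (suc i ℕ.+ (p ∸ k))))      ≈⟨ ∑₁-≈ n (λ k → pair (suc i) k 0<j j≤n) ⟩
      ∑₁ n (λ k → δ (suc i) k * (G (suc i) * G (p ∸ k)) + P * (G (suc i) * G k * N (suc i) k))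
        ≡⟨ trans (∑-+ n _ _) (cong₂ _+_ (∑-δ n i (λ k → G (suc i) * G (p ∸ suc k)) j≤n) (∑-*ˡ n P _)) ⟩
      G (suc i) * G (p ∸ suc i) + P * ∑₁ n (λ k → G (suc i) * G k * N (suc i) k) ∎

  -- The term of index `p` is `g_p = w / p`.
  w : ℚ
  w = U n

  -- The terms of index p, for which p·(1/p) = 1, are split off.
  ∑δs-split : ∑ p (δs (suc p)) ≡ (1ℚ + (P * P * α + w)) * (P * β + w) - w * w - 4ℚ * (P * P) * (w * γ) - 2ℚ * (P * (P * Δ))
  ∑δs-split = begin
    ∑ p (δs (suc p))
      ≡⟨ ∑δs-closed-form p ⟩
    (1ℚ + P * P * (α + r * (r * w))) * (P * (β + r * w))
      - 2ℚ * P * (P * P) * (∑₁ n (λ j → ∑₁ n (X j) + G j * (r * w) * rec (j ℕ.+ p)) + (∑₁ n (X p) + (r * w) * (r * w) * q))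
      ≡⟨ cong₂ (λ y z → (1ℚ + P * P * (α + r * (r * w))) * (P * (β + r * w)) - 2ℚ * P * (P * P) * (y + (z + (r * w) * (r * w) * q))) column row ⟩
    (1ℚ + P * P * (α + r * (r * w))) * (P * (β + r * w))
      - 2ℚ * P * (P * P) * ((δ₀ + (r * w) * γ) + ((r * w) * γ + (r * w) * (r * w) * q))
      ≡⟨ lem P r q w α β γ δ₀ ⟩
    -- Each `r = 1/p` is paired with a `P`, `q = 1/(2p)` with `P + P`, and `δ₀` with the `P` that
    -- makes it `Δ`. No denominator divisible by `p` is left after this.
    (1ℚ + (P * P * α + (P * r) * (P * r) * w)) * (P * β + (P * r) * w) - (P * r) * (P * r) * ((P + P) * q) * (w * w) - 4ℚ * (P * P) * ((P * r) * (w * γ)) - 2ℚ * (P * (P * (P * δ₀)))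
      ≡⟨ cong₂ (λ y z → (1ℚ + (P * P * α + y * y * w)) * (P * β + y * w) - y * y * z * (w * w) - 4ℚ * (P * P) * (y * (w * γ)) - 2ℚ * (P * (P * (P * δ₀)))) P*rec-p 2Pq≡1 ⟩
    (1ℚ + (P * P * α + 1ℚ * 1ℚ * w)) * (P * β + 1ℚ * w) - 1ℚ * 1ℚ * 1ℚ * (w * w) - 4ℚ * (P * P) * (1ℚ * (w * γ)) - 2ℚ * (P * (P * (P * δ₀)))
      ≡⟨ cong (λ z → (1ℚ + (P * P * α + 1ℚ * 1ℚ * w)) * (P * β + 1ℚ * w) - 1ℚ * 1ℚ * 1ℚ * (w * w) - 4ℚ * (P * P) * (1ℚ * (w * γ)) - 2ℚ * (P * (P * z))) (sym Δ≡) ⟩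
    (1ℚ + (P * P * α + 1ℚ * 1ℚ * w)) * (P * β + 1ℚ * w) - 1ℚ * 1ℚ * 1ℚ * (w * w) - 4ℚ * (P * P) * (1ℚ * (w * γ)) - 2ℚ * (P * (P * Δ))
      ≡⟨ lem′ P w α β γ Δ ⟩
    (1ℚ + (P * P * α + w)) * (P * β + w) - w * w - 4ℚ * (P * P) * (w * γ) - 2ℚ * (P * (P * Δ)) ∎
    where
    open ≡-Reasoning
    r q δ₀ : ℚ
    r = rec p
    q = rec (p ℕ.+ p)
    X : ℕ → ℕ → ℚ
    X j k = G j * G k * rec (j ℕ.+ k)
    δ₀ = ∑₁ n (λ j → ∑₁ n (X j))
    2Pq≡1 : (P + P) * q ≡ 1ℚ
    2Pq≡1 = trans (cong (_* q) (sym (ι-+ p p))) (ι*rec⁺ (s≤s z≤n))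
    Δ≡ : Δ ≡ P * δ₀
    Δ≡ = trans (∑-ext n λ j → trans (∑-ext n λ k → lem₁ (G (suc j)) (G (suc k)) P (rec (suc j ℕ.+ suc k))) (∑-*ˡ n P _)) (∑-*ˡ n P _)
      where
      lem₁ : ∀ a b p x → a * b * (p * x) ≡ p * (a * b * x)
      lem₁ = solve-∀ ℚ-ring
    column : ∑₁ n (λ j → ∑₁ n (X j) + G j * (r * w) * rec (j ℕ.+ p)) ≡ δ₀ + (r * w) * γ
    column = trans (∑-+ n _ _) (cong (δ₀ +_) (trans (∑-ext n λ j → trans (cong (λ z → G (suc j) * (r * w) * rec z) (ℕ.+-comm (suc j) p)) (lem₁ (G (suc j)) (r * w) (rec (p ℕ.+ suc j)))) (∑-*ˡ n (r * w) _)))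
      where
      lem₁ : ∀ a b x → a * b * x ≡ b * (a * x)
      lem₁ = solve-∀ ℚ-ring
    row : ∑₁ n (X p) ≡ (r * w) * γ
    row = trans (∑-ext n λ k → lem₁ (r * w) (G (suc k)) (rec (p ℕ.+ suc k))) (∑-*ˡ n (r * w) _)
      where
      lem₁ : ∀ a b x → a * b * x ≡ a * (b * x)
      lem₁ = solve-∀ ℚ-ring
    lem : ∀ P r q w α β γ δ₀ → (1ℚ + P * P * (α + r * (r * w))) * (P * (β + r * w))
        - 2ℚ * P * (P * P) * ((δ₀ + (r * w) * γ) + ((r * w) * γ + (r * w) * (r * w) * q))
      ≡ (1ℚ + (P * P * α + (P * r) * (P * r) * w)) * (P * β + (P * r) * w) - (P * r) * (P * r) * ((P + P) * q) * (w * w) - 4ℚ * (P * P) * ((P * r) * (w * γ)) - 2ℚ * (P * (P * (P * δ₀)))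
    lem = solve-∀ ℚ-ring
    lem′ : ∀ P w α β γ Δ → (1ℚ + (P * P * α + 1ℚ * 1ℚ * w)) * (P * β + 1ℚ * w) - 1ℚ * 1ℚ * 1ℚ * (w * w) - 4ℚ * (P * P) * (1ℚ * (w * γ)) - 2ℚ * (P * (P * Δ))
      ≡ (1ℚ + (P * P * α + w)) * (P * β + w) - w * w - 4ℚ * (P * P) * (w * γ) - 2ℚ * (P * (P * Δ))
    lem′ = solve-∀ ℚ-ring

  -- Assembly modulo p⁴

  PPR≈0 : P * (P * R n) ≈[ 3 ] 0ℚ
  PPR≈0 = ≈-trans (≈-scale (≈-scale R≈0)) (≈-reflexive (lem P))
    where
    lem : ∀ p → p * (p * 0ℚ) ≡ 0ℚ
    lem = solve-∀ ℚ-ring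

  w≈₄ : w ≈[ 4 ] 1ℚ - P * (P * R n)
  w≈₄ = ≈-trans (U≈ n ℕ.≤-refl) (≈-reflexive (trans (cong (_* (1ℚ - P * P * R n)) (ε-double h)) (lem P (R n))))
    where
    lem : ∀ p r → 1ℚ * (1ℚ - p * p * r) ≡ 1ℚ - p * (p * r)
    lem = solve-∀ ℚ-ring

  w≈₃ : w ≈[ 3 ] 1ℚ
  w≈₃ = ≈-trans (≈-weaken w≈₄) (≈-- (≈-refl {x = 1ℚ}) PPR≈0)

  w≈₂ : w ≈[ 2 ] 1ℚ
  w≈₂ = ≈-weaken w≈₃

  Int-H : Integral H
  Int-H = Int-∑₁ n λ k 0<k k≤n → Int-* (Int-ε k) (Int-rec′ 0<k k≤n)

  Int-Z : Integral Z
  Int-Z = Int-∑₁ n λ k 0<k k≤n → Int-* (Int-* (Int-ε k) (Int-rec′ 0<k k≤n)) (Int-R (∸1≤n k≤n))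

  Int-β : Integral β
  Int-β = Int-∑₁ n Int-G

  Int-PE₃ : Integral (P * E₃)
  Int-PE₃ = Int-* (Int-ι p) Int-E₃

  ∑δs≈ : ∑ p (δs (suc p)) ≈[ 4 ] 1ℚ - 2ℚ * (P * H) - 4ℚ * (P * (P * (P * E₃)))
  ∑δs≈ = begin
    ∑ p (δs (suc p))
      ≡⟨ ∑δs-split ⟩
    (1ℚ + (P * P * α + w)) * (P * β + w) - w * w - 4ℚ * (P * P) * (w * γ) - 2ℚ * (P * (P * Δ))
      ≡⟨ lem₁ P α β γ Δ w ⟩
    w + P * (P * (α * w)) + P * (β * (1ℚ + w)) + P * (P * (P * (α * β))) - 4ℚ * (P * (P * (w * γ))) - 2ℚ * (P * (P * Δ))
      -- A quantity multiplied by `P^i` is needed only modulo `p^(4-i)`; this decides which version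
      -- of each expansion is used.
      ≈⟨ ≈-- (≈-- (≈-+ (≈-+ (≈-+ w≈₄ (≈-scale (≈-scale (≈-* Int-PE₃ Int-1 α≈ w≈₂))))
                            (≈-scale (≈-* (Int-+ (Int-neg Int-H) (Int-* (Int-ι p) (Int-* (Int-ι p) Int-Z))) Int-2 (≈-weaken β≈) (≈-+ (≈-refl {x = 1ℚ}) w≈₃))))
                       (≈-scale (≈-scale (≈-scale αβ≈0))))
                  (≈-*ˡ Int-4 (≈-scale (≈-scale (≈-* Int-1 (Int-* Int-2 Int-PE₃) w≈₂ γ≈)))))
             (≈-*ˡ Int-2 (≈-scale (≈-scale Δ≈))) ⟩
    1ℚ - P * (P * R n) + P * (P * (P * E₃ * 1ℚ)) + P * ((- H + P * (P * Z)) * 2ℚ) + P * (P * (P * 0ℚ)) - 4ℚ * (P * (P * (1ℚ * (2ℚ * (P * E₃))))) - 2ℚ * (P * (P * R n))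
      ≡⟨ lem₂ P (R n) E₃ H Z ⟩
    -- The 7 is 8 from `γ` less 1 from `α`; the `3R` is `2R` from `Δ` and `R` from `w`. Below, `2Z`
    -- raises the 7 by 1 and `3R` lowers it by 4, which leaves 4.
    1ℚ - 2ℚ * (P * H) + P * (P * (P * (2ℚ * Z))) - 7ℚ * (P * (P * (P * E₃))) - P * (P * ((2ℚ + 1ℚ) * R n))
      ≈⟨ ≈-- (≈-- (≈-+ (≈-refl {x = 1ℚ - 2ℚ * (P * H)}) (≈-scale (≈-scale (≈-scale 2Z≈)))) (≈-refl {x = 7ℚ * (P * (P * (P * E₃)))}))
             (≈-scale (≈-scale (≈-trans (≈-reflexive (cong (_* R n) (sym ι-3))) 3R≈))) ⟩
    1ℚ - 2ℚ * (P * H) + P * (P * (P * (- E₃))) - 7ℚ * (P * (P * (P * E₃))) - P * (P * (- (4ℚ * (P * E₃))))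
      ≡⟨ lem₃ P E₃ H ⟩
    1ℚ - 2ℚ * (P * H) - 4ℚ * (P * (P * (P * E₃))) ∎
    where
    open ≈-Reasoning (≈-setoid 4)
    7ℚ : ℚ
    7ℚ = 4ℚ + 2ℚ + 1ℚ
    αβ≈0 : α * β ≈[ 1 ] 0ℚ
    αβ≈0 = ≈-trans (≈-*ʳ Int-β (≈-trans (≈-weaken α≈) (P*≈0 Int-E₃))) (≈-reflexive (ℚ.*-zeroˡ β))
    lem₁ : ∀ P α β γ Δ w → (1ℚ + (P * P * α + w)) * (P * β + w) - w * w - 4ℚ * (P * P) * (w * γ) - 2ℚ * (P * (P * Δ))
      ≡ w + P * (P * (α * w)) + P * (β * (1ℚ + w)) + P * (P * (P * (α * β))) - 4ℚ * (P * (P * (w * γ))) - 2ℚ * (P * (P * Δ))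
    lem₁ = solve-∀ ℚ-ring
    lem₂ : ∀ P R E H Z → 1ℚ - P * (P * R) + P * (P * (P * E * 1ℚ)) + P * ((- H + P * (P * Z)) * 2ℚ) + P * (P * (P * 0ℚ)) - 4ℚ * (P * (P * (1ℚ * (2ℚ * (P * E))))) - 2ℚ * (P * (P * R))
      ≡ 1ℚ - 2ℚ * (P * H) + P * (P * (P * (2ℚ * Z))) - (4ℚ + 2ℚ + 1ℚ) * (P * (P * (P * E))) - P * (P * ((2ℚ + 1ℚ) * R))
    lem₂ = solve-∀ ℚ-ring
    lem₃ : ∀ P E H → 1ℚ - 2ℚ * (P * H) + P * (P * (P * (- E))) - (4ℚ + 2ℚ + 1ℚ) * (P * (P * (P * E))) - P * (P * (- (4ℚ * (P * E))))
      ≡ 1ℚ - 2ℚ * (P * H) - 4ℚ * (P * (P * (P * E)))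
    lem₃ = solve-∀ ℚ-ring

  ∑delannoy*schroeder≈ : sumFromTo 1 n (λ k → delannoy k * schroeder k) ≈[ 4 ] 2ℚ * π 3 * bernoulli (p ∸ 3) - 2ℚ * P * altHarmonic n
  ∑delannoy*schroeder≈ = begin
    S                                                                    ≡⟨ lem₁ S ⟩
    (1ℚ + S) - 1ℚ                                                        ≡⟨ cong (_- 1ℚ) (1+∑delannoy*schroeder≡∑δs n) ⟩
    ∑ p (δs (suc p)) - 1ℚ                                                ≈⟨ ≈-- ∑δs≈ (≈-refl {x = 1ℚ}) ⟩
    1ℚ - 2ℚ * (P * H) - 4ℚ * (P * (P * (P * E₃))) - 1ℚ                   ≡⟨ lem₂ P H E₃ ⟩
    -- The inner term is congruent to `P * B` modulo `p²`, and the two outer factors `P` lift this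
    -- to `p⁴`.
    2ℚ * (P * (P * (- (2ℚ * (P * E₃))))) - 2ℚ * P * H
      ≈⟨ ≈-- (≈-*ˡ Int-2 (≈-scale (≈-scale (≈-sym P*bernoulli≈)))) (≈-refl {x = 2ℚ * P * H}) ⟩
    2ℚ * (P * (P * (P * B))) - 2ℚ * P * H
      ≡⟨ cong₂ (λ y z → y - 2ℚ * P * z) (lem₃ P B) (sym (altHarmonic≡∑₁ n)) ⟩
    2ℚ * π 3 * B - 2ℚ * P * altHarmonic n                                ∎
    where
    open ≈-Reasoning (≈-setoid 4)
    S B : ℚ
    S = sumFromTo 1 n (λ k → delannoy k * schroeder k)
    B = bernoulli (p ∸ 3)
    lem₁ : ∀ x → x ≡ (1ℚ + x) - 1ℚ
    lem₁ = solve-∀ ℚ-ring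
    lem₂ : ∀ P H E → 1ℚ - 2ℚ * (P * H) - 4ℚ * (P * (P * (P * E))) - 1ℚ
      ≡ 2ℚ * (P * (P * (- (2ℚ * (P * E))))) - 2ℚ * P * H
    lem₂ = solve-∀ ℚ-ring
    lem₃ : ∀ p b → 2ℚ * (p * (p * (p * b))) ≡ 2ℚ * (p * (p * (p * 1ℚ))) * b
    lem₃ = solve-∀ ℚ-ring

-- Oddness of p and the stated form

even⊎odd : ∀ k → (∃ λ h → k ≡ h ℕ.+ h) ⊎ (∃ λ h → k ≡ suc (h ℕ.+ h))
even⊎odd zero = inj₁ (0 , refl)
even⊎odd (suc k) with even⊎odd k
... | inj₁ (h , refl) = inj₂ (h , refl)
... | inj₂ (h , refl) = inj₁ (suc h , cong suc (sym (ℕ.+-suc h h)))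

prime>3⇒odd : ∀ {p} → Prime p → p > 3 → ∃ λ h → p ≡ suc (h ℕ.+ h)
prime>3⇒odd {p} pp p>3 with even⊎odd p
... | inj₂ odd = odd
... | inj₁ (h , refl) with prime⇒irreducible pp (divides h (trans (cong (h ℕ.+_) (sym (ℕ.+-identityʳ h))) (ℕ.*-comm 2 h)))
...   | inj₁ ()
...   | inj₂ 2≡p = contradiction (subst (_> 3) (sym 2≡p) p>3) λ { (s≤s (s≤s ())) }

theorem1p3 : (p : ℕ) → Prime p → p > 3 →
    sumFromTo 1 (p ∸ 1) (λ k → delannoy k * schroeder k)
    ≡ ℕtoℚ 2 * ℕtoℚ (p ^ 3) * bernoulli (p ∸ 3) - ℕtoℚ 2 * ℕtoℚ p * altHarmonic (p ∸ 1)
    [modℚ p ^ 4 ]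
theorem1p3 p pp p>3 with prime>3⇒odd pp p>3
-- Matching `p` with `suc (h + h)` makes `p ∸ 1` compute to the even number over which the sums were
-- reflected.
... | h , refl = ≈⇒≡[modℚ] 4 (≈-trans (∑delannoy*schroeder≈ h pp p>3)
    (≈-reflexive (cong₂ (λ y z → ℕtoℚ 2 * y * bernoulli (p ∸ 3) - ℕtoℚ 2 * z * altHarmonic (p ∸ 1)) (π≡ℕtoℚ^ 3) (ι≡ℕtoℚ p))))
  where
  open Congruence p pp
  open OddPrime using (∑delannoy*schroeder≈)
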